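{- Let $G$ be a connected graph with maximum degree $3$ which contains an odd cycle and which is not isomorphic to the Petersen graph. Then $$\gamma(G) \;\geq\; 1-\frac{2}{3\,g_{odd}(G)+2}.$$
   Context: All graphs are finite and simple. For a graph $G$ with $m\ge 1$ edges, $\gamma(G)$ denotes the largest fraction of the edges of $G$ that can be $3$-edge-coloured, i.e. $\gamma(G)=\max |E(H)|/m$, where the maximum is over all subgraphs $H$ of $G$ that admit a proper edge-colouring with $3$ colours. The odd girth $g_{odd}(G)$ is the length of a shortest odd cycle of $G$. -}

module Defs where

open import Level using (Level; 0ℓ)
open import Data.Empty using (⊥)
open import Data.Fin.Base as Fin using (Fin; zero; suc; toℕ)
open import Data.Fin.Patterns using (0F; 1F; 2F; 3F; 4F; 5F; 6F; 7F; 8F; 9F)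
import Data.Fin.Properties as Fin
open import Data.Integer.Base using (+_)
open import Data.List.Base using (List; []; _∷_; length; map; filter; allFin; cartesianProduct; cartesianProductWith)
open import Data.List.Extrema.Nat using (max)
open import Data.List.Membership.Propositional using (_∈_)
import Data.List.Membership.DecPropositional as DecMembership
open import Data.List.Membership.Propositional.Properties using (∈-filter⁺; ∈-cartesianProduct⁺; ∈-allFin)
open import Data.List.Properties using (filter-≐; length-filter)
open import Data.List.Relation.Unary.Any as Any using (Any; here; there)
import Data.List.Relation.Unary.Any.Properties as Any
open import Data.Maybe.Base using (Maybe; just; nothing; fromMaybe)
import Data.Maybe.Properties as Maybe
open import Data.Maybe.Relation.Unary.Any as MaybeAny using (just)
open import Data.Maybe using (Is-just)
open import Data.Nat.Base using (ℕ; zero; suc; _≤_; NonZero; z≤n; s≤s)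
open import Data.Nat.Divisibility using (_∣_; _∣?_)
import Data.Nat.Properties as ℕ
open import Data.Product.Base using (Σ; ∃; _×_; _,_; proj₁)
open import Data.Product.Properties using (≡-dec)
open import Data.Rational.Base using (ℚ; _/_)
open import Data.Sum.Base using (_⊎_; swap)
open import Data.Unit.Base using (tt)
import Data.Vec.Functional as VecF
open import Function.Base using (_∘_)
open import Function.Bundles using (_↔_; _⇔_; Inverse)
open import Function.Definitions using (Injective)
open import Relation.Binary.Core using (Rel)
open import Relation.Binary.Definitions using (Symmetric; Irreflexive; Decidable; tri<; tri≈; tri>)
open import Relation.Binary.Construct.Closure.ReflexiveTransitive using (Star)
open import Relation.Binary.PropositionalEquality using (_≡_; refl; sym; trans; cong; subst; subst₂)
open import Relation.Nullary.Decidable using (Dec; yes; no; map′; _×-dec_; _⊎-dec_; _→-dec_; ¬?; from-yes)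
open import Relation.Nullary.Negation using (¬_; contradiction)
open import Relation.Unary as Unary using (Pred)

private variable
  n k : ℕ

IsGreatest IsLeast : ∀ {ℓ} → Pred ℕ ℓ → Pred ℕ ℓ
IsGreatest P k = P k × (∀ j → P j → j ≤ k)
IsLeast    P k = P k × (∀ j → P j → k ≤ j)

------------------------------------------------------------------------
-- Graphs

record Graph (n : ℕ) : Set₁ where
  infix 4 _~_ _~?_
  field
    _~_    : Rel (Fin n) 0ℓ
    _~?_   : Decidable _~_
    ~-sym  : Symmetric _~_
    ~-irrefl : Irreflexive _≡_ _~_

open Graph using (~-sym; ~-irrefl)

infix 4 _[_~_] _[_~?_]

_[_~_] : Graph n → Rel (Fin n) 0ℓ
G [ u ~ v ] = Graph._~_ G u v

_[_~?_] : (G : Graph n) → Decidable (G [_~_])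
G [ u ~? v ] = Graph._~?_ G u v

-- Each unordered pair {u , v} is listed once, with u < v.
orderedPairs : {R : Rel (Fin n) 0ℓ} → Decidable R → List (Fin n × Fin n)
orderedPairs {n} R? =
  filter (λ (u , v) → (u Fin.<? v) ×-dec R? u v)
         (cartesianProduct (allFin n) (allFin n))

edges : Graph n → List (Fin n × Fin n)
edges G = orderedPairs (G [_~?_])

∣E_∣ : Graph n → ℕ
∣E G ∣ = length (edges G)

degree : Graph n → Fin n → ℕ
degree {n} G v = length (filter (λ u → G [ v ~? u ]) (allFin n))

Δ : Graph n → ℕ
Δ {n} G = max 0 (map (degree G) (allFin n))

Connected : Graph n → Set
Connected G = ∀ u v → Star (G [_~_]) u v

infix 4 _≅_

record _≅_ {m n : ℕ} (G : Graph m) (H : Graph n) : Set where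
  field
    bijection : Fin m ↔ Fin n
    adjacency : ∀ u v →
      G [ u ~ v ] ⇔ H [ Inverse.to bijection u ~ Inverse.to bijection v ]

------------------------------------------------------------------------
-- The Petersen graph

-- An outer pentagon on 0–4, an inner pentagram on 5–9, and five spokes.
petersenEdges : List (Fin 10 × Fin 10)
petersenEdges =
    (0F , 1F) ∷ (1F , 2F) ∷ (2F , 3F) ∷ (3F , 4F) ∷ (4F , 0F)
  ∷ (5F , 7F) ∷ (7F , 9F) ∷ (9F , 6F) ∷ (6F , 8F) ∷ (8F , 5F)
  ∷ (0F , 5F) ∷ (1F , 6F) ∷ (2F , 7F) ∷ (3F , 8F) ∷ (4F , 9F) ∷ []

open DecMembership (≡-dec (Fin._≟_ {10}) (Fin._≟_ {10})) using (_∈?_)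

Petersen : Graph 10
Petersen = record
  { _~_      = λ u v → (u , v) ∈ petersenEdges ⊎ (v , u) ∈ petersenEdges
  ; _~?_     = petersen?
  ; ~-sym    = swap
  ; ~-irrefl = λ { {u} refl → from-yes (Fin.all? λ v → ¬? (petersen? v v)) u }
  }
  where
  petersen? : Decidable (λ u v → (u , v) ∈ petersenEdges ⊎ (v , u) ∈ petersenEdges)
  petersen? u v = ((u , v) ∈? petersenEdges) ⊎-dec ((v , u) ∈? petersenEdges)

------------------------------------------------------------------------
-- Odd cycles

-- Vertices v₀ , … , vₖ₋₁ are distinct, with vᵢ ~ vᵢ₊₁ and vₖ₋₁ ~ v₀.
record IsCycle (G : Graph n) {k : ℕ} (v : Fin k → Fin n) : Set where
  field
    length≥3    : 3 ≤ k
    injective   : Injective _≡_ _≡_ v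
    consecutive : ∀ i j → toℕ j ≡ suc (toℕ i) → G [ v i ~ v j ]
    closing     : ∀ i j → suc (toℕ i) ≡ k → toℕ j ≡ 0 → G [ v i ~ v j ]

HasOddCycleOfLength : Graph n → Pred ℕ 0ℓ
HasOddCycleOfLength {n} G k = ¬ (2 ∣ k) × ∃ λ (v : Fin k → Fin n) → IsCycle G v

HasOddCycle : Graph n → Set
HasOddCycle G = ∃ (HasOddCycleOfLength G)

------------------------------------------------------------------------
-- Edge-colourings

-- Subgraphs are taken to be spanning: adding the missing vertices as isolated
-- ones affects neither the edges nor their colourings.
infix 4 _⊆_

_⊆_ : Rel (Graph n) 0ℓ
H ⊆ G = ∀ u v → H [ u ~ v ] → G [ u ~ v ]

-- The values of the colouring off the edges are irrelevant.
record IsProperEdgeColouring (H : Graph n) (c : Fin n → Fin n → Fin k) : Set where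
  field
    symmetric : ∀ u v → H [ u ~ v ] → c u v ≡ c v u
    proper    : ∀ u v w → H [ u ~ v ] → H [ u ~ w ] → c u v ≡ c u w → v ≡ w

EdgeColourable : ℕ → Graph n → Set
EdgeColourable {n} k H = ∃ λ (c : Fin n → Fin n → Fin k) → IsProperEdgeColouring H c

Has3ColourableSubgraphOfSize : Graph n → ℕ → Set₁
Has3ColourableSubgraphOfSize {n} G k =
  Σ (Graph n) λ H → H ⊆ G × EdgeColourable 3 H × ∣E H ∣ ≡ k

------------------------------------------------------------------------
-- Existence of the optima

private
  variable
    a ℓ : Level
    A : Set a

  least : {P : Pred ℕ ℓ} → Unary.Decidable P → ∀ k → P k → ∃ (IsLeast P)
  least P? k       pk with P? 0
  least P? k       pk | yes p0 = 0 , p0 , λ _ _ → z≤n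
  least P? zero    pk | no ¬p0 = contradiction pk ¬p0
  least {P = P} P? (suc k) pk | no ¬p0 with least {P = P ∘ suc} (P? ∘ suc) k pk
  ... | m , pm , minimal = suc m , pm , λ where
    zero    p0 → contradiction p0 ¬p0
    (suc j) pj → s≤s (minimal j pj)

  greatest : {P : Pred ℕ ℓ} → Unary.Decidable P → ∀ N → (∀ k → P k → k ≤ N) →
             ∃ P → ∃ (IsGreatest P)
  greatest P? N bound (k , pk) with P? N
  ... | yes pN = N , pN , bound
  greatest {P = P} P? zero    bound (k , pk) | no ¬pN =
    contradiction (subst P (ℕ.n≤0⇒n≡0 (bound k pk)) pk) ¬pN
  greatest {P = P} P? (suc N) bound (k , pk) | no ¬pN =
    greatest P? N
      (λ j pj → ℕ.≤-pred (ℕ.≤∧≢⇒< (bound j pj) λ j≡N → ¬pN (subst P j≡N pj)))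
      (k , pk)

  -- Finitely many elements represent all of A up to R.
  Listable : Rel A 0ℓ → Set _
  Listable {A = A} R = Σ (List A) λ xs → ∀ x → Any (R x) xs

  search : {R : Rel A 0ℓ} {P : Pred A 0ℓ} → Listable R →
           (∀ {x y} → R x y → P x → P y) → Unary.Decidable P → Dec (∃ P)
  search (xs , complete) resp P? =
    map′ Any.satisfied (λ (x , px) → Any.map (λ r → resp r px) (complete x))
         (Any.any? P? xs)

  listFin : Listable (_≡_ {A = Fin n})
  listFin = allFin _ , ∈-allFin

  listMaybe : Listable (_≡_ {A = A}) → Listable (_≡_ {A = Maybe A})
  listMaybe (xs , complete) = nothing ∷ map just xs , λ where
    nothing  → here refl
    (just x) → there (Any.map⁺ (Any.map (cong just) (complete x)))

  listFun : {R : Rel A 0ℓ} → Listable R →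
            Listable (λ (f g : Fin n → A) → ∀ i → R (f i) (g i))
  listFun {n = zero}  _ = (λ ()) ∷ [] , λ f → here λ ()
  listFun {n = suc n} l@(xs , complete) with listFun {n = n} l
  ... | fs , complete′ =
    cartesianProductWith VecF._∷_ xs fs , λ f →
      Any.cartesianProductWith⁺ VecF._∷_
        (λ { r rs zero → r ; r rs (suc i) → rs i })
        (complete (f zero)) (complete′ (f ∘ suc))

isCycle? : (G : Graph n) (v : Fin k → Fin n) → Dec (IsCycle G v)
isCycle? {k = k} G v = map′
  (λ (l , i , c , d) → record
    { length≥3 = l ; injective = λ {x} {y} → i x y ; consecutive = c ; closing = d })
  (λ p → let open IsCycle p in length≥3 , (λ _ _ → injective) , consecutive , closing)
  ( (3 ℕ.≤? k)
  ×-dec Fin.all? (λ i → Fin.all? λ j → (v i Fin.≟ v j) →-dec (i Fin.≟ j))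
  ×-dec Fin.all? (λ i → Fin.all? λ j →
          (toℕ j ℕ.≟ suc (toℕ i)) →-dec G [ v i ~? v j ])
  ×-dec Fin.all? (λ i → Fin.all? λ j →
          (suc (toℕ i) ℕ.≟ k) →-dec ((toℕ j ℕ.≟ 0) →-dec G [ v i ~? v j ])))

hasOddCycleOfLength? : (G : Graph n) → Unary.Decidable (HasOddCycleOfLength G)
hasOddCycleOfLength? G k =
  ¬? (2 ∣? k) ×-dec search (listFun listFin) resp (isCycle? G)
  where
  resp : ∀ {v w} → (∀ i → v i ≡ w i) → IsCycle G v → IsCycle G w
  resp eq p = record
    { length≥3    = length≥3
    ; injective   = λ {i} {j} e → injective (trans (eq i) (trans e (sym (eq j))))
    ; consecutive = λ i j e → subst₂ (G [_~_]) (eq i) (eq j) (consecutive i j e)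
    ; closing     = λ i j e f → subst₂ (G [_~_]) (eq i) (eq j) (closing i j e f)
    }
    where open IsCycle p

shortestOddCycle : (G : Graph n) → HasOddCycle G → ∃ (IsLeast (HasOddCycleOfLength G))
shortestOddCycle G (k , p) = least (hasOddCycleOfLength? G) k p

private
  isJust? : (m : Maybe A) → Dec (Is-just m)
  isJust? = MaybeAny.dec λ _ → yes tt

  fromMaybe-injective : ∀ {d : A} {x y} → Is-just x → Is-just y →
                        fromMaybe d x ≡ fromMaybe d y → x ≡ y
  fromMaybe-injective (just _) (just _) = cong just

  length-orderedPairs-cong :
    {R S : Rel (Fin n) 0ℓ} (R? : Decidable R) (S? : Decidable S) →
    (∀ {u v} → R u v → S u v) → (∀ {u v} → S u v → R u v) →
    length (orderedPairs R?) ≡ length (orderedPairs S?)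
  length-orderedPairs-cong {n} R? S? f g =
    cong length (filter-≐ (λ (u , v) → (u Fin.<? v) ×-dec R? u v)
                          (λ (u , v) → (u Fin.<? v) ×-dec S? u v)
                          ((λ (lt , r) → lt , f r) , (λ (lt , s) → lt , g s))
                          (cartesianProduct (allFin n) (allFin n)))

  -- A subgraph together with a 3-edge-colouring of it, encoded as one matrix.
  Matrix : ℕ → Set
  Matrix n = Fin n → Fin n → Maybe (Fin 3)

  Valid : Graph n → ℕ → Pred (Matrix n) 0ℓ
  Valid G k c =
      (∀ u v → c u v ≡ c v u)
    × (∀ u v → Is-just (c u v) → G [ u ~ v ])
    × (∀ u v w → Is-just (c u v) → c u v ≡ c u w → v ≡ w)
    × length (orderedPairs (λ u v → isJust? (c u v))) ≡ k

  valid? : (G : Graph n) (k : ℕ) → Unary.Decidable (Valid G k)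
  valid? G k c =
      Fin.all? (λ u → Fin.all? λ v → c u v ≟ c v u)
    ×-dec Fin.all? (λ u → Fin.all? λ v → isJust? (c u v) →-dec G [ u ~? v ])
    ×-dec Fin.all? (λ u → Fin.all? λ v → Fin.all? λ w →
            isJust? (c u v) →-dec ((c u v ≟ c u w) →-dec (v Fin.≟ w)))
    ×-dec (length (orderedPairs (λ u v → isJust? (c u v))) ℕ.≟ k)
    where _≟_ = Maybe.≡-dec (Fin._≟_ {3})

  valid-resp : (G : Graph n) → ∀ {c d} → (∀ u v → c u v ≡ d u v) →
               Valid G k c → Valid G k d
  valid-resp G {c} {d} eq (s , b , p , l) =
      (λ u v → trans (sym (eq u v)) (trans (s u v) (eq v u)))
    , (λ u v j → b u v (back j))
    , (λ u v w j e → p u v w (back j) (trans (eq u v) (trans e (sym (eq u w)))))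
    , trans (length-orderedPairs-cong (λ u v → isJust? (d u v)) (λ u v → isJust? (c u v))
              back (λ {u} {v} → subst Is-just (eq u v))) l
    where
    back : ∀ {u v} → Is-just (d u v) → Is-just (c u v)
    back {u} {v} = subst Is-just (sym (eq u v))

  decode : (G : Graph n) → ∃ (Valid G k) → Has3ColourableSubgraphOfSize G k
  decode G (c , s , b , p , l) = H , b , (colour , isProper) , l
    where
    H : Graph _
    H = record
      { _~_      = λ u v → Is-just (c u v)
      ; _~?_     = λ u v → isJust? (c u v)
      ; ~-sym    = λ {u} {v} → subst Is-just (s u v)
      ; ~-irrefl = λ { {u} refl j → ~-irrefl G refl (b u u j) }
      }
    colour : Fin _ → Fin _ → Fin 3
    colour u v = fromMaybe 0F (c u v)
    isProper : IsProperEdgeColouring H colour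
    isProper = record
      { symmetric = λ u v _ → cong (fromMaybe 0F) (s u v)
      ; proper    = λ u v w j j′ e → p u v w j (fromMaybe-injective j j′ e)
      }

  encode : (G : Graph n) → Has3ColourableSubgraphOfSize G k → ∃ (Valid G k)
  encode {n} G (H , H⊆G , (c , isProper) , l) = d , s , b , p , trans size l
    where
    open IsProperEdgeColouring isProper
    d : Matrix n
    d u v with H [ u ~? v ]
    ... | yes _ = just (c u v)
    ... | no  _ = nothing
    s : ∀ u v → d u v ≡ d v u
    s u v with H [ u ~? v ] | H [ v ~? u ]
    ... | yes e | yes _ = cong just (symmetric u v e)
    ... | yes e | no ¬e = contradiction (~-sym H e) ¬e
    ... | no ¬e | yes e = contradiction (~-sym H e) ¬e
    ... | no _  | no _  = refl
    to : ∀ {u v} → Is-just (d u v) → H [ u ~ v ]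
    to {u} {v} j with H [ u ~? v ]
    to {u} {v} j  | yes e = e
    to {u} {v} () | no _
    from : ∀ {u v} → H [ u ~ v ] → Is-just (d u v)
    from {u} {v} e with H [ u ~? v ]
    ... | yes _ = just tt
    ... | no ¬e = contradiction e ¬e
    b : ∀ u v → Is-just (d u v) → G [ u ~ v ]
    b u v j = H⊆G u v (to j)
    p : ∀ u v w → Is-just (d u v) → d u v ≡ d u w → v ≡ w
    p u v w j q with H [ u ~? v ] | H [ u ~? w ]
    p u v w j  q  | yes e | yes f = proper u v w e f (Maybe.just-injective q)
    p u v w j  () | yes _ | no _
    p u v w () q  | no _  | _
    size : length (orderedPairs (λ u v → isJust? (d u v))) ≡ ∣E H ∣
    size = length-orderedPairs-cong (λ u v → isJust? (d u v)) (H [_~?_]) to from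

  edgeless : Graph n
  edgeless = record
    { _~_ = λ _ _ → ⊥ ; _~?_ = λ _ _ → no λ () ; ~-sym = λ () ; ~-irrefl = λ _ () }

has3ColourableSubgraphOfSize? : (G : Graph n) →
                                Unary.Decidable (Has3ColourableSubgraphOfSize G)
has3ColourableSubgraphOfSize? G k =
  map′ (decode G) (encode G)
       (search (listFun (listFun (listMaybe listFin))) (valid-resp G) (valid? G k))

largest3ColourableSubgraph : (G : Graph n) → ∃ (IsGreatest (Has3ColourableSubgraphOfSize G))
largest3ColourableSubgraph {n} G =
  greatest (has3ColourableSubgraphOfSize? G)
    (length (cartesianProduct (allFin n) (allFin n)))
    (λ { k (H , _ , _ , refl) → length-filter _ (cartesianProduct (allFin n) (allFin n)) })
    ( ∣E edgeless {n} ∣ , edgeless , (λ _ _ ())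
    , ((λ _ _ → 0F) , record { symmetric = λ _ _ () ; proper = λ _ _ _ () }) , refl)

------------------------------------------------------------------------
-- The invariants

oddGirth : (G : Graph n) → HasOddCycle G → ℕ
oddGirth G odd = proj₁ (shortestOddCycle G odd)

γ : (G : Graph n) → .{{NonZero ∣E G ∣}} → ℚ
γ G = + proj₁ (largest3ColourableSubgraph G) / ∣E G ∣

oddCycle⇒nonZero : (G : Graph n) → HasOddCycle G → NonZero ∣E G ∣
oddCycle⇒nonZero {n} G (zero        , _ , _ , p) = contradiction (IsCycle.length≥3 p) λ ()
oddCycle⇒nonZero {n} G (suc zero    , _ , _ , p) = contradiction (IsCycle.length≥3 p) λ { (s≤s ()) }
oddCycle⇒nonZero {n} G (suc (suc k) , _ , v , p) = adjacent (IsCycle.consecutive p 0F 1F refl)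
  where
  nonEmpty : ∀ {e} {es : List (Fin n × Fin n)} → e ∈ es → NonZero (length es)
  nonEmpty (here _)  = _
  nonEmpty (there _) = _
  edge : ∀ {u w} → u Fin.< w → G [ u ~ w ] → NonZero ∣E G ∣
  edge {u} {w} lt e = nonEmpty
    (∈-filter⁺ (λ (x , y) → (x Fin.<? y) ×-dec G [ x ~? y ])
               (∈-cartesianProduct⁺ (∈-allFin u) (∈-allFin w)) (lt , e))
  adjacent : ∀ {u w} → G [ u ~ w ] → NonZero ∣E G ∣
  adjacent {u} {w} e with Fin.<-cmp u w
  ... | tri< lt _ _ = edge lt e
  ... | tri≈ _ eq _ = contradiction e (~-irrefl G eq)
  ... | tri> _ _ gt = edge gt (~-sym G e)

module Submission where

-- Take a colouring of as many edges as possible.  The Kempe chain between the ends of an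
-- uncoloured edge closes an odd cycle, along which the uncoloured edge can be moved
-- freely.  Maximality makes the cycles of different uncoloured edges disjoint and forces
-- all edges leaving a cycle to have the same colour.  If every one of the s uncoloured
-- edges can be charged with 3 g + 2 darts (oriented edges), where g is the odd girth,
-- then s (3 g + 2) ≤ 2 ∣E∣, which is the claim.
--
-- A cycle of length L whose vertices all have degree 3 has 3 L darts of its own, which
-- is enough when L ≥ g + 2.  If L = g, the cycle is chordless, and it is enough to find
-- two more darts outside the cycles.  Moving uncoloured edges shows that consecutive
-- vertices of the cycle are not joined to different cycles, and that the outer end of a
-- single edge to the outside has all of its darts to itself; hence two darts are missing
-- only when all exits lead to one and the same cycle.  That cycle either is longer and
-- has darts to spare, or has length g too.  In the latter case the graph consists of two
-- cycles of length g joined by a perfect matching; as it has no shorter odd cycle,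
-- consecutive exits are at distance 3, so g = 5 and the graph is the Petersen graph.
--
-- If a vertex of the cycle has degree 2, then moving the uncoloured edge there yields a
-- second odd cycle in other colours, and the two together have enough darts.

open import Defs
open import Data.Empty using (⊥; ⊥-elim)
open import Data.Fin.Base as Fin using (Fin; zero; suc; toℕ; fromℕ<)
open import Data.Fin.Patterns using (0F; 1F; 2F; 3F; 4F; 5F; 6F; 7F; 8F; 9F)
import Data.Fin.Properties as Fin
import Data.Integer.Base as ℤ
import Data.Integer.Properties as ℤ
open import Data.List.Base using (List; []; _∷_; _++_; length; lookup; map; filter; tabulate; allFin; cartesianProduct)
open import Data.List.Extrema.Nat using (xs≤max)
open import Data.List.Membership.Propositional using (_∈_)
open import Data.List.Membership.Propositional.Properties
  using (∈-lookup; ∈-++⁻; ∈-++⁺ˡ; ∈-++⁺ʳ; ∈-tabulate⁻; ∈-tabulate⁺; ∈-map⁺; ∈-filter⁺; ∈-filter⁻; ∈-cartesianProduct⁺; ∈-allFin)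
import Data.List.Membership.Setoid.Properties as SetoidMembership
import Data.List.Properties as List
open import Data.List.Relation.Unary.All as All using (All; []; _∷_)
open import Data.List.Relation.Unary.AllPairs using ([]; _∷_)
open import Data.List.Relation.Unary.Any as Any using (here; there)
open import Data.List.Relation.Unary.Unique.Propositional using (Unique)
import Data.List.Relation.Unary.Unique.Propositional.Properties as Unique
open import Data.Maybe.Base using (Maybe; just; nothing)
import Data.Maybe.Properties as Maybe
open import Data.Nat.Base using (ℕ; zero; suc; _+_; _*_; _∸_; _≤_; _<_; z≤n; s≤s; NonZero)
open import Data.Nat.Divisibility using (_∣_; divides)
open import Data.Nat.DivMod using (_%_; m%n<n; m<n⇒m%n≡m; [m+n]%n≡m%n; %-distribˡ-+; m≤n⇒[n∸m]%m≡n%m; n%n≡0; m≡m%n+[m/n]*n)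
import Data.Nat.DivMod as ℕ
import Data.Nat.Properties as ℕ
open import Data.Nat.Solver using (module +-*-Solver)
open import Data.Product.Base as Product using (Σ; ∃; ∃₂; _×_; _,_; proj₁; proj₂)
open import Data.Rational.Base using (1ℚ; _-_; _/_; _≥_)
import Data.Rational.Base as ℚ
import Data.Rational.Properties as ℚ
import Data.Rational.Unnormalised.Base as ℚᵘ
import Data.Rational.Unnormalised.Properties as ℚᵘ
open import Data.Sum.Base using (_⊎_; inj₁; inj₂)
open import Function.Base using (_∘_; case_of_)
open import Function.Bundles using (mk↔ₛ′; mk⇔)
open import Relation.Binary.Construct.Closure.ReflexiveTransitive using (Star; ε; _◅_)
open import Relation.Binary.Definitions using (tri<; tri≈; tri>)
open import Relation.Binary.PropositionalEquality
  using (_≡_; _≢_; refl; sym; trans; cong; cong₂; subst; subst₂; setoid; module ≡-Reasoning)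
open import Relation.Nullary.Decidable using (Dec; yes; no; from-yes; _×-dec_; _⊎-dec_; _→-dec_; ¬?; map′; decidable-stable)
open import Relation.Nullary.Negation using (¬_; contradiction)
open import Relation.Unary using (Decidable)

-- The engine is that a full turn around an odd cycle exchanges its two colours. So for each vertex
-- of the cycle and each of the two colours there is an equally large colouring in which that vertex
-- misses that colour, while nothing off the edges of the cycle has changed. Disjoint cycles can be
-- turned independently, and the local claims come from turning a few of them until one more edge
-- could be coloured. Darts are used because `3 * g + 2` is odd and because they allow an edge
-- between two cycles to be shared. Lengths are odd, so a cycle longer than g has length at least g
-- + 2; if all its degrees are 3, it yields at least 3 g + 6 darts, four more than needed. The
-- obstacle is a short cycle all of whose exits end on one longer cycle, which owns the darts coming
-- back. It goes into debt: r such debtors occupy g r different vertices of the longer cycle, whose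
-- surplus 3 L - (3 g + 2) is then at least 2 r. At a vertex of degree 2 next to the uncoloured edge
-- the third colour is missing as well, so a second Kempe chain can start there with it.

-- Finite lists and sums

lookup-injective : ∀ {A : Set} {zs : List A} → Unique zs → ∀ {i j} → lookup zs i ≡ lookup zs j → i ≡ j
lookup-injective (_ ∷ _)  {zero}  {zero}  _ = refl
lookup-injective (x≢ ∷ _) {zero}  {suc j} e = contradiction e (All.lookup x≢ (∈-lookup j))
lookup-injective (x≢ ∷ _) {suc i} {zero}  e = contradiction (sym e) (All.lookup x≢ (∈-lookup i))
lookup-injective (_ ∷ u)  {suc i} {suc j} e = cong suc (lookup-injective u e)

unique-⊆⇒length≤ : ∀ {A : Set} {xs ys : List A} → Unique xs → (∀ {x} → x ∈ xs → x ∈ ys) → length xs ≤ length ys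
unique-⊆⇒length≤ {A} {xs} {ys} uniq sub = Fin.injective⇒≤ {f = pos} inj
  where
  pos : Fin (length xs) → Fin (length ys)
  pos i = Any.index (sub (∈-lookup i))

  inj : ∀ {i j} → pos i ≡ pos j → i ≡ j
  inj {i} {j} e = lookup-injective uniq
    (SetoidMembership.index-injective (setoid A) (sub (∈-lookup i)) (sub (∈-lookup j)) e)

∑ : ∀ {s} → (Fin s → ℕ) → ℕ
∑ {zero}  f = 0
∑ {suc s} f = f zero + ∑ (f ∘ suc)

∑-mono : ∀ {s} {f g : Fin s → ℕ} → (∀ i → f i ≤ g i) → ∑ f ≤ ∑ g
∑-mono {zero}  le = z≤n
∑-mono {suc s} le = ℕ.+-mono-≤ (le zero) (∑-mono (le ∘ suc))

∑-+ : ∀ {s} (f g : Fin s → ℕ) → ∑ (λ i → f i + g i) ≡ ∑ f + ∑ g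
∑-+ {zero}  f g = refl
∑-+ {suc s} f g = begin
  (f zero + g zero) + ∑ (λ i → f (suc i) + g (suc i))      ≡⟨ cong (f zero + g zero +_) (∑-+ (f ∘ suc) (g ∘ suc)) ⟩
  (f zero + g zero) + (∑ (f ∘ suc) + ∑ (g ∘ suc))          ≡⟨ interchange (f zero) (g zero) _ _ ⟩
  (f zero + ∑ (f ∘ suc)) + (g zero + ∑ (g ∘ suc))          ∎
  where
  open ≡-Reasoning
  interchange : ∀ a b c d → (a + b) + (c + d) ≡ (a + c) + (b + d)
  interchange a b c d = begin
    (a + b) + (c + d) ≡⟨ ℕ.+-assoc a b (c + d) ⟩
    a + (b + (c + d)) ≡⟨ cong (a +_) (sym (ℕ.+-assoc b c d)) ⟩
    a + ((b + c) + d) ≡⟨ cong (λ t → a + (t + d)) (ℕ.+-comm b c) ⟩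
    a + ((c + b) + d) ≡⟨ cong (a +_) (ℕ.+-assoc c b d) ⟩
    a + (c + (b + d)) ≡⟨ sym (ℕ.+-assoc a c (b + d)) ⟩
    (a + c) + (b + d) ∎

∑-const : ∀ s c → ∑ {s} (λ _ → c) ≡ s * c
∑-const zero    c = refl
∑-const (suc s) c = cong (c +_) (∑-const s c)

∑-*ˡ : ∀ {s} c (f : Fin s → ℕ) → ∑ (λ i → c * f i) ≡ c * ∑ f
∑-*ˡ {zero}  c f = sym (ℕ.*-zeroʳ c)
∑-*ˡ {suc s} c f = trans (cong (c * f zero +_) (∑-*ˡ c (f ∘ suc))) (sym (ℕ.*-distribˡ-+ c (f zero) _))

∑-swap : ∀ {s t} (f : Fin s → Fin t → ℕ) → ∑ (λ i → ∑ (f i)) ≡ ∑ (λ j → ∑ (λ i → f i j))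
∑-swap {zero} {t} f = sym (trans (∑-const t 0) (ℕ.*-zeroʳ t))
∑-swap {suc s}  f = trans (cong (∑ (f zero) +_) (∑-swap (f ∘ suc))) (sym (∑-+ (f zero) _))

term≤∑ : ∀ {s} (f : Fin s → ℕ) i → f i ≤ ∑ f
term≤∑ f zero    = ℕ.m≤m+n _ _
term≤∑ f (suc i) = ℕ.≤-trans (term≤∑ (f ∘ suc) i) (ℕ.m≤n+m _ _)

-- Used twice: for the darts charged to different cycles among all darts, and for the vertices of
-- one cycle that are claimed by different poor cycles.
∑-disjoint-lists : ∀ {A : Set} {s} {ℓ : Fin s → List A} {ys} →
                   (∀ i → Unique (ℓ i)) → (∀ {i j x} → x ∈ ℓ i → x ∈ ℓ j → i ≡ j) →
                   (∀ {i x} → x ∈ ℓ i → x ∈ ys) → ∑ (length ∘ ℓ) ≤ length ys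
∑-disjoint-lists {A} {s} {ℓ} {ys} uniq disj sub =
  subst (_≤ length ys) (length-join ℓ) (unique-⊆⇒length≤ (unique-join ℓ uniq disj) λ x∈ →
    let i , x∈ℓi = join⁻ ℓ x∈ in sub x∈ℓi)
  where
  join : ∀ {s} → (Fin s → List A) → List A
  join {zero}  ℓ = []
  join {suc s} ℓ = ℓ zero ++ join (ℓ ∘ suc)

  length-join : ∀ {s} (ℓ : Fin s → List A) → length (join ℓ) ≡ ∑ (length ∘ ℓ)
  length-join {zero}  ℓ = refl
  length-join {suc s} ℓ = trans (List.length-++ (ℓ zero)) (cong (length (ℓ zero) +_) (length-join (ℓ ∘ suc)))

  join⁻ : ∀ {s} (ℓ : Fin s → List A) {x} → x ∈ join ℓ → ∃ λ i → x ∈ ℓ i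
  join⁻ {suc s} ℓ x∈ with ∈-++⁻ (ℓ zero) x∈
  ... | inj₁ p = zero , p
  ... | inj₂ p = let i , q = join⁻ (ℓ ∘ suc) p in suc i , q

  unique-join : ∀ {s} (ℓ : Fin s → List A) → (∀ i → Unique (ℓ i)) →
                (∀ {i j x} → x ∈ ℓ i → x ∈ ℓ j → i ≡ j) → Unique (join ℓ)
  unique-join {zero}  ℓ uniq disj = []
  unique-join {suc s} ℓ uniq disj =
    Unique.++⁺ (uniq zero)
      (unique-join (ℓ ∘ suc) (uniq ∘ suc) (λ p q → Fin.suc-injective (disj p q)))
      (λ (p , q) → let i , q′ = join⁻ (ℓ ∘ suc) q in Fin.0≢1+n (disj p q′))

length-filter-⊎ : ∀ {A : Set} {P Q R : A → Set} (P? : Decidable P) (Q? : Decidable Q) (R? : Decidable R) →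
                  (∀ {x} → P x → Q x ⊎ R x) → (∀ {x} → Q x → P x) → (∀ {x} → R x → P x) →
                  (∀ {x} → Q x → ¬ R x) → ∀ xs →
                  length (filter P? xs) ≡ length (filter Q? xs) + length (filter R? xs)
length-filter-⊎ P? Q? R? split Q⇒P R⇒P disj [] = refl
length-filter-⊎ P? Q? R? split Q⇒P R⇒P disj (x ∷ xs)
  with rec ← length-filter-⊎ P? Q? R? split Q⇒P R⇒P disj xs | P? x | Q? x | R? x
... | yes p | yes q | yes r = contradiction r (disj q)
... | yes p | yes q | no  _ = cong suc rec
... | yes p | no  _ | yes r = trans (cong suc rec) (sym (ℕ.+-suc _ _))
... | yes p | no ¬q | no ¬r = case split p of λ { (inj₁ q) → contradiction q ¬q ; (inj₂ r) → contradiction r ¬r }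
... | no ¬p | yes q | _     = contradiction (Q⇒P q) ¬p
... | no ¬p | no  _ | yes r = contradiction (R⇒P r) ¬p
... | no  _ | no  _ | no  _ = rec

-- Colours, alternation, parity and residues

Colour : Set
Colour = Fin 3

abstract
  third-colour : (a b : Colour) → a ≢ b → ∃ λ c → c ≢ a × c ≢ b
  third-colour = from-yes (Fin.all? λ (a : Colour) → Fin.all? λ (b : Colour) → ¬? (a Fin.≟ b) →-dec
    Fin.any? λ (c : Colour) → ¬? (c Fin.≟ a) ×-dec ¬? (c Fin.≟ b))

  only-three-colours : (a b c d : Colour) → a ≢ b → a ≢ c → b ≢ c → d ≢ c → d ≡ a ⊎ d ≡ b
  only-three-colours = from-yes (Fin.all? λ (a : Colour) → Fin.all? λ (b : Colour) → Fin.all? λ (c : Colour) → Fin.all? λ (d : Colour) →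
    ¬? (a Fin.≟ b) →-dec (¬? (a Fin.≟ c) →-dec (¬? (b Fin.≟ c) →-dec (¬? (d Fin.≟ c) →-dec
    ((d Fin.≟ a) ⊎-dec (d Fin.≟ b))))))

alt : {A : Set} → A → A → ℕ → A
alt a b zero    = a
alt a b (suc i) = alt b a i

alt-cases : ∀ {A : Set} (a b : A) i → alt a b i ≡ a ⊎ alt a b i ≡ b
alt-cases a b zero = inj₁ refl
alt-cases a b (suc i) with alt-cases b a i
... | inj₁ e = inj₂ e
... | inj₂ e = inj₁ e

alt-order : ∀ {A : Set} i (a b : A) → (alt a b i ≡ a × alt b a i ≡ b) ⊎ (alt a b i ≡ b × alt b a i ≡ a)
alt-order zero    a b = inj₁ (refl , refl)
alt-order (suc i) a b with alt-order i b a
... | inj₁ p = inj₂ p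
... | inj₂ p = inj₁ p

alt-even : ∀ {A : Set} {a b : A} h i → alt a b (h * 2 + i) ≡ alt a b i
alt-even zero    i = refl
alt-even (suc h) i = alt-even h i

even⊎odd : ∀ m → (∃ λ h → m ≡ h * 2) ⊎ (∃ λ h → m ≡ suc (h * 2))
even⊎odd zero = inj₁ (0 , refl)
even⊎odd (suc m) with even⊎odd m
... | inj₁ (h , e) = inj₂ (h , cong suc e)
... | inj₂ (h , e) = inj₁ (suc h , cong suc e)

odd⇒¬2∣ : ∀ h → ¬ (2 ∣ suc (h * 2))
odd⇒¬2∣ zero    (divides zero ())
odd⇒¬2∣ zero    (divides (suc q) ())
odd⇒¬2∣ (suc h) (divides (suc q) e) = odd⇒¬2∣ h (divides q (ℕ.suc-injective (ℕ.suc-injective e)))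

¬2∣⇒odd : ∀ m → ¬ (2 ∣ m) → ∃ λ h → m ≡ suc (h * 2)
¬2∣⇒odd m ¬2∣m with even⊎odd m
... | inj₁ (h , e) = contradiction (divides h e) ¬2∣m
... | inj₂ odd = odd

-- Maximum degree at most 3, in the only form in which the argument uses it.
ThreeNeighbours : ∀ {n} → Graph n → Set
ThreeNeighbours G = ∀ {v p q r s} → G [ v ~ p ] → G [ v ~ q ] → G [ v ~ r ] → G [ v ~ s ] →
                    p ≢ q → p ≢ r → q ≢ r → s ≡ p ⊎ s ≡ q ⊎ s ≡ r

Δ≤3⇒three-neighbours : ∀ {n} (G : Graph n) → Δ G ≡ 3 →
  ∀ {v p q r s} → G [ v ~ p ] → G [ v ~ q ] → G [ v ~ r ] → G [ v ~ s ] →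
  p ≢ q → p ≢ r → q ≢ r → s ≡ p ⊎ s ≡ q ⊎ s ≡ r
Δ≤3⇒three-neighbours {n} G Δ≡3 {v} {p} {q} {r} {s} vp vq vr vs p≢q p≢r q≢r
  with s Fin.≟ p | s Fin.≟ q | s Fin.≟ r
... | yes e | _     | _     = inj₁ e
... | no _  | yes e | _     = inj₂ (inj₁ e)
... | no _  | no _  | yes e = inj₂ (inj₂ e)
... | no s≢p | no s≢q | no s≢r = contradiction four (ℕ.<⇒≱ (s≤s three))
  where
  three : degree G v ≤ 3
  three = subst (degree G v ≤_) Δ≡3 (All.lookup (xs≤max 0 (map (degree G) (allFin n))) (∈-map⁺ (degree G) (∈-allFin v)))
  nb : ∀ {u} → G [ v ~ u ] → u ∈ filter (G [ v ~?_]) (allFin n)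
  nb {u} e = ∈-filter⁺ (G [ v ~?_]) (∈-allFin u) e
  four : 4 ≤ degree G v
  four = unique-⊆⇒length≤ {xs = s ∷ p ∷ q ∷ r ∷ []}
    ((s≢p ∷ s≢q ∷ s≢r ∷ []) ∷ (p≢q ∷ p≢r ∷ []) ∷ (q≢r ∷ []) ∷ [] ∷ []) λ where
      (here refl) → nb vs
      (there (here refl)) → nb vp
      (there (there (here refl))) → nb vq
      (there (there (there (here refl)))) → nb vr

%-suc : ∀ K i → (i % suc (suc K) < suc K × suc i % suc (suc K) ≡ suc (i % suc (suc K)))
              ⊎ (i % suc (suc K) ≡ suc K × suc i % suc (suc K) ≡ 0)
%-suc K i with ℕ.m≤n⇒m<n∨m≡n (ℕ.≤-pred (m%n<n i (suc (suc K))))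
... | inj₁ lt = inj₁ (lt , trans (%-distribˡ-+ 1 i (suc (suc K))) (m<n⇒m%n≡m (s≤s lt)))
... | inj₂ eq = inj₂ (eq , trans (%-distribˡ-+ 1 i (suc (suc K)))
                       (trans (cong (λ r → suc r % suc (suc K)) eq) (n%n≡0 (suc (suc K)))))

-- Without wrap-around the residue strictly grows; with one, equality would force the shift to be a
-- whole period.
%-shift-≢ : ∀ L d i → suc d < suc L → i % suc L ≢ (suc d + i) % suc L
%-shift-≢ L d i d<L eq with suc d + i % suc L ℕ.<? suc L
... | yes lt = ℕ.m≢1+n+m (i % suc L) {d} (trans eq (trans shifted (m<n⇒m%n≡m lt)))
  where
  shifted : (suc d + i) % suc L ≡ (suc d + i % suc L) % suc L
  shifted = trans (%-distribˡ-+ (suc d) i (suc L)) (cong (λ t → (t + i % suc L) % suc L) (m<n⇒m%n≡m d<L))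
... | no ≮ = ℕ.<⇒≢ d<L (sym (ℕ.+-cancelʳ-≡ (i % suc L) (suc L) (suc d) (begin
    suc L + i % suc L                        ≡⟨ cong (suc L +_) (trans eq (trans shifted reduced)) ⟩
    suc L + (suc d + i % suc L ∸ suc L)      ≡⟨ ℕ.m+[n∸m]≡n (ℕ.≮⇒≥ ≮) ⟩
    suc d + i % suc L                        ∎)))
  where
  open ≡-Reasoning
  shifted : (suc d + i) % suc L ≡ (suc d + i % suc L) % suc L
  shifted = trans (%-distribˡ-+ (suc d) i (suc L)) (cong (λ t → (t + i % suc L) % suc L) (m<n⇒m%n≡m d<L))
  small : suc d + i % suc L ∸ suc L < suc L
  small = ℕ.m<n+o⇒m∸n<o _ (suc L) (ℕ.+-mono-<-≤ d<L (ℕ.<⇒≤ (m%n<n i (suc L))))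
  reduced : (suc d + i % suc L) % suc L ≡ suc d + i % suc L ∸ suc L
  reduced = trans (sym (m≤n⇒[n∸m]%m≡n%m (ℕ.≮⇒≥ ≮))) (m<n⇒m%n≡m small)

Odd : ℕ → Set
Odd m = ∃ λ h → m ≡ suc (h * 2)

Even : ℕ → Set
Even m = ∃ λ h → m ≡ h * 2

even+odd : ∀ {a b} → Even a → Odd (a + b) → Odd b
even+odd {b = b} (zero  , refl) (h , e) = h , e
even+odd {b = b} (suc k , refl) (zero , ())
even+odd {b = b} (suc k , refl) (suc h , e) = even+odd (k , refl) (h , ℕ.suc-injective (ℕ.suc-injective e))

odd+odd : ∀ {a b} → Odd a → Odd (a + b) → Even b
odd+odd (zero  , refl) (h , e) = h , ℕ.suc-injective e
odd+odd (suc k , refl) (zero , ())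
odd+odd (suc k , refl) (suc h , e) = odd+odd (k , refl) (h , ℕ.suc-injective (ℕ.suc-injective e))

-- Partial edge-colourings

module Colourings {n : ℕ} (G : Graph n) where

  V : Set
  V = Fin n

  open Graph G public using (_~_; _~?_; ~-sym; ~-irrefl)

  ~⇒≢ : ∀ {u v} → u ~ v → u ≢ v
  ~⇒≢ e refl = ~-irrefl refl e

  Same : V → V → V → V → Set
  Same x y u v = (u ≡ x × v ≡ y) ⊎ (u ≡ y × v ≡ x)

  same? : ∀ x y u v → Dec (Same x y u v)
  same? x y u v = ((u Fin.≟ x) ×-dec (v Fin.≟ y)) ⊎-dec ((u Fin.≟ y) ×-dec (v Fin.≟ x))

  same-swap : ∀ {x y u v} → Same x y u v → Same x y v u
  same-swap (inj₁ (p , q)) = inj₂ (q , p)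
  same-swap (inj₂ (p , q)) = inj₁ (q , p)

  -- A partial proper colouring. Non-edges and uncoloured edges both have the value `nothing`, so an
  -- uncoloured edge is always given by adjacency together with `col φ u v ≡ nothing`.
  record Colouring : Set where
    field
      col        : V → V → Maybe Colour
      col-sym    : ∀ u v → col u v ≡ col v u
      col-adj    : ∀ {u v c} → col u v ≡ just c → u ~ v
      col-proper : ∀ {u v w c} → col u v ≡ just c → col u w ≡ just c → v ≡ w

  open Colouring public

  flip : ∀ (φ : Colouring) {u v m} → col φ u v ≡ m → col φ v u ≡ m
  flip φ {u} {v} e = trans (col-sym φ v u) e

  Misses : Colouring → V → Colour → Set
  Misses φ u c = ∀ w → col φ u w ≢ just c

  seen? : ∀ φ u c → Dec (∃ λ w → col φ u w ≡ just c)
  seen? φ u c = Fin.any? λ w → Maybe.≡-dec Fin._≟_ (col φ u w) (just c)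

  Coloured : Colouring → V → V → Set
  Coloured φ u v = ∃ λ c → col φ u v ≡ just c

  coloured? : ∀ φ u v → Dec (Coloured φ u v)
  coloured? φ u v with col φ u v
  ... | just c  = yes (c , refl)
  ... | nothing = no λ ()

  pairs : List (V × V)
  pairs = cartesianProduct (allFin n) (allFin n)

  pairs-unique : Unique pairs
  pairs-unique = Unique.cartesianProduct⁺ (Unique.allFin⁺ n) (Unique.allFin⁺ n)

  pairs-complete : ∀ p → p ∈ pairs
  pairs-complete (u , v) = ∈-cartesianProduct⁺ (∈-allFin u) (∈-allFin v)

  -- Recolouring one pair

  update : V → V → Maybe Colour → (V → V → Maybe Colour) → V → V → Maybe Colour
  update x y m f u v with same? x y u v
  ... | yes _ = m
  ... | no  _ = f u v

  update-on : ∀ {x y m f u v} → Same x y u v → update x y m f u v ≡ m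
  update-on {x} {y} {u = u} {v} s with same? x y u v
  ... | yes _ = refl
  ... | no ¬s = contradiction s ¬s

  update-off : ∀ {x y m f u v} → ¬ Same x y u v → update x y m f u v ≡ f u v
  update-off {x} {y} {u = u} {v} ¬s with same? x y u v
  ... | yes s = contradiction s ¬s
  ... | no _  = refl

  update-sym : ∀ x y m {f} → (∀ u v → f u v ≡ f v u) → ∀ u v → update x y m f u v ≡ update x y m f v u
  update-sym x y m f-sym u v with same? x y u v
  ... | yes s = sym (update-on (same-swap s))
  ... | no ¬s = trans (f-sym u v) (sym (update-off (¬s ∘ same-swap)))

  update-elim : ∀ x y m f {u v m′} → update x y m f u v ≡ m′ →
                (Same x y u v × m′ ≡ m) ⊎ (¬ Same x y u v × f u v ≡ m′)
  update-elim x y m f {u} {v} e with same? x y u v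
  ... | yes s = inj₁ (s , sym e)
  ... | no ¬s = inj₂ (¬s , e)

  abstract
    erase : Colouring → V → V → Colouring
    erase φ x y = record
      { col        = update x y nothing (col φ)
      ; col-sym    = update-sym x y nothing (col-sym φ)
      ; col-adj    = λ {u} {v} e → col-adj φ (keep u v e)
      ; col-proper = λ {u} {v} {w} e e′ → col-proper φ (keep u v e) (keep u w e′)
      }
      where
      keep : ∀ u v {c} → update x y nothing (col φ) u v ≡ just c → col φ u v ≡ just c
      keep u v e with update-elim x y nothing (col φ) e
      ... | inj₂ (_ , e′) = e′

    erase-elim : ∀ φ x y {u v c} → col (erase φ x y) u v ≡ just c → ¬ Same x y u v × col φ u v ≡ just c
    erase-elim φ x y e with update-elim x y nothing (col φ) e
    ... | inj₂ r = r

    erase-misses : ∀ φ x y {u c} → Misses φ u c → Misses (erase φ x y) u c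
    erase-misses φ x y {u} m w e = m w (proj₂ (erase-elim φ x y e))

    erased-misses : ∀ φ {x y c} → col φ x y ≡ just c → Misses (erase φ x y) x c
    erased-misses φ {x} {y} xy w e = let ¬s , e′ = erase-elim φ x y e in ¬s (inj₁ (refl , col-proper φ e′ xy))

    erased-misses′ : ∀ φ {x y c} → col φ x y ≡ just c → Misses (erase φ x y) y c
    erased-misses′ φ {x} {y} xy w e = let ¬s , e′ = erase-elim φ x y e in ¬s (inj₂ (refl , col-proper φ e′ (flip φ xy)))

    paint : ∀ φ {x y} c → x ~ y → Misses φ x c → Misses φ y c → Colouring
    paint φ {x} {y} c x~y mx my = record
      { col        = update x y (just c) (col φ)
      ; col-sym    = update-sym x y (just c) (col-sym φ)
      ; col-adj    = λ {u} {v} {d} e → adj u v d (update-elim x y (just c) (col φ) e)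
      ; col-proper = λ {u} {v} {w} {d} e e′ →
          proper u v w d (update-elim x y (just c) (col φ) e) (update-elim x y (just c) (col φ) e′)
      }
      where
      Case : V → V → Colour → Set
      Case u v d = (Same x y u v × just d ≡ just c) ⊎ (¬ Same x y u v × col φ u v ≡ just d)
      adj : ∀ u v d → Case u v d → u ~ v
      adj u v d (inj₁ (inj₁ (refl , refl) , _)) = x~y
      adj u v d (inj₁ (inj₂ (refl , refl) , _)) = ~-sym x~y
      adj u v d (inj₂ (_ , e)) = col-adj φ e
      misses : ∀ {u v} w → Same x y u v → col φ u w ≢ just c
      misses w (inj₁ (refl , _)) = mx w
      misses w (inj₂ (refl , _)) = my w
      proper : ∀ u v w d → Case u v d → Case u w d → v ≡ w
      proper u v w d (inj₁ (inj₁ (p , q) , _)) (inj₁ (inj₁ (p′ , q′) , _)) = trans q (sym q′)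
      proper u v w d (inj₁ (inj₂ (p , q) , _)) (inj₁ (inj₂ (p′ , q′) , _)) = trans q (sym q′)
      proper u v w d (inj₁ (inj₁ (p , q) , _)) (inj₁ (inj₂ (p′ , q′) , _)) = contradiction (trans (sym p) p′) (~⇒≢ x~y)
      proper u v w d (inj₁ (inj₂ (p , q) , _)) (inj₁ (inj₁ (p′ , q′) , _)) = contradiction (trans (sym p′) p) (~⇒≢ x~y)
      proper u v w d (inj₁ (s , d≡c)) (inj₂ (_ , e)) = contradiction (trans e d≡c) (misses w s)
      proper u v w d (inj₂ (_ , e)) (inj₁ (s , d≡c)) = contradiction (trans e d≡c) (misses v s)
      proper u v w d (inj₂ (_ , e)) (inj₂ (_ , e′)) = col-proper φ e e′

    paint-misses : ∀ φ {x y c} x~y mx my {u d} → (d ≡ c → u ≢ x × u ≢ y) →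
                   Misses φ u d → Misses (paint φ {x} {y} c x~y mx my) u d
    paint-misses φ {x} {y} {c} x~y mx my {u} {d} ok m w e with update-elim x y (just c) (col φ) e
    ... | inj₂ (_ , e′) = m w e′
    ... | inj₁ (inj₁ (p , _) , d≡c) = proj₁ (ok (Maybe.just-injective d≡c)) p
    ... | inj₁ (inj₂ (p , _) , d≡c) = proj₂ (ok (Maybe.just-injective d≡c)) p

    erase-on : ∀ φ x y {u v} → Same x y u v → col (erase φ x y) u v ≡ nothing
    erase-on φ x y = update-on

    erase-off : ∀ φ x y {u v} → ¬ Same x y u v → col (erase φ x y) u v ≡ col φ u v
    erase-off φ x y = update-off

    paint-on : ∀ φ {x y c} x~y mx my {u v} → Same x y u v → col (paint φ {x} {y} c x~y mx my) u v ≡ just c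
    paint-on φ x~y mx my = update-on

    paint-off : ∀ φ {x y c} x~y mx my {u v} → ¬ Same x y u v → col (paint φ {x} {y} c x~y mx my) u v ≡ col φ u v
    paint-off φ x~y mx my = update-off

  private
    Ordered : Colouring → V × V → Set
    Ordered φ (u , v) = (u Fin.< v) × Coloured φ u v

    ordered? : ∀ φ p → Dec (Ordered φ p)
    ordered? φ (u , v) = (u Fin.<? v) ×-dec coloured? φ u v

    _≟ₚ_ : (p q : V × V) → Dec (p ≡ q)
    (a , b) ≟ₚ (c , d) = map′ (λ (e , f) → cong₂ _,_ e f) (λ { refl → refl , refl }) ((a Fin.≟ c) ×-dec (b Fin.≟ d))

    length-filter-≡ : ∀ p → length (filter (_≟ₚ p) pairs) ≡ 1
    length-filter-≡ p = ℕ.≤-antisym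
      (unique-⊆⇒length≤ {ys = p ∷ []} (Unique.filter⁺ (_≟ₚ p) pairs-unique)
        (λ x∈ → here (proj₂ (∈-filter⁻ (_≟ₚ p) {xs = pairs} x∈))))
      (unique-⊆⇒length≤ {xs = p ∷ []} ([] ∷ []) λ { (here refl) → ∈-filter⁺ (_≟ₚ p) (pairs-complete p) refl })

    sorted : ∀ {x y} → x ≢ y → ∃ λ p → proj₁ p Fin.< proj₂ p × (Same x y (proj₁ p) (proj₂ p))
      × (∀ {u v} → u Fin.< v → Same x y u v → (u , v) ≡ p)
    sorted {x} {y} x≢y with Fin.<-cmp x y
    ... | tri< lt _ _ = (x , y) , lt , inj₁ (refl , refl) , λ where
          u<v (inj₁ (refl , refl)) → refl
          u<v (inj₂ (refl , refl)) → contradiction u<v (ℕ.<-asym lt)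
    ... | tri≈ _ eq _ = contradiction eq x≢y
    ... | tri> _ _ gt = (y , x) , gt , inj₂ (refl , refl) , λ where
          u<v (inj₁ (refl , refl)) → contradiction u<v (ℕ.<-asym gt)
          u<v (inj₂ (refl , refl)) → refl

  abstract
    size : Colouring → ℕ
    size φ = length (orderedPairs (coloured? φ))

    -- Pairs are counted with the smaller end first, so the pairs coloured by `ψ` split into the
    -- single sorted copy of `x y` and the pairs coloured by `φ`.
    size-one-more : ∀ φ ψ {x y c} → x ≢ y →
                    (∀ {u v} → ¬ Same x y u v → col φ u v ≡ col ψ u v) →
                    (∀ {u v} → Same x y u v → col φ u v ≡ nothing) →
                    (∀ {u v} → Same x y u v → col ψ u v ≡ just c) → size ψ ≡ suc (size φ)
    size-one-more φ ψ {x} {y} {c} x≢y agree off on =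
      let p , lt , s , unique-p = sorted x≢y in
      trans (length-filter-⊎ (ordered? ψ) (_≟ₚ p) (ordered? φ)
              (λ { {u , v} (u<v , d , e) → case same? x y u v of λ where
                   (yes s′) → inj₁ (unique-p u<v s′)
                   (no ¬s) → inj₂ (u<v , d , trans (agree ¬s) e) })
              (λ { refl → lt , c , on s })
              (λ { {u , v} (u<v , d , e) → u<v , (case same? x y u v of λ where
                   (yes s′) → contradiction (trans (sym e) (off s′)) λ ()
                   (no ¬s) → d , trans (sym (agree ¬s)) e) })
              (λ { refl (_ , d , e) → contradiction (trans (sym e) (off s)) λ () })
              pairs)
            (cong (_+ size φ) (length-filter-≡ p))

    size-paint : ∀ φ {x y} c x~y mx my → col φ x y ≡ nothing → size (paint φ {x} {y} c x~y mx my) ≡ suc (size φ)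
    size-paint φ {x} {y} c x~y mx my unc = size-one-more φ (paint φ c x~y mx my) (~⇒≢ x~y)
      (λ ¬s → sym (paint-off φ x~y mx my ¬s)) off (paint-on φ x~y mx my)
      where
      off : ∀ {u v} → Same x y u v → col φ u v ≡ nothing
      off (inj₁ (refl , refl)) = unc
      off (inj₂ (refl , refl)) = flip φ unc

    size-erase : ∀ φ {x y c} → col φ x y ≡ just c → size φ ≡ suc (size (erase φ x y))
    size-erase φ {x} {y} {c} xy = size-one-more (erase φ x y) φ (~⇒≢ (col-adj φ xy)) (erase-off φ x y) (erase-on φ x y) on
      where
      on : ∀ {u v} → Same x y u v → col φ u v ≡ just c
      on (inj₁ (refl , refl)) = xy
      on (inj₂ (refl , refl)) = flip φ xy

    -- Comparison with the optimum

    colouring⇒subgraph : ∀ φ → Has3ColourableSubgraphOfSize G (size φ)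
    colouring⇒subgraph φ = H , (λ u v (_ , e) → col-adj φ e) , (colour , isProper) , refl
      where
      H : Graph n
      H = record
        { _~_      = Coloured φ
        ; _~?_     = coloured? φ
        ; ~-sym    = λ (c , e) → c , flip φ e
        ; ~-irrefl = λ { refl (c , e) → ~-irrefl refl (col-adj φ e) }
        }
      colour : V → V → Colour
      colour u v with col φ u v
      ... | just c  = c
      ... | nothing = 0F
      colour-col : ∀ {u v} → Coloured φ u v → col φ u v ≡ just (colour u v)
      colour-col {u} {v} (c , e) with col φ u v
      ... | just _ = refl
      isProper : IsProperEdgeColouring H colour
      isProper = record
        { symmetric = λ u v e → Maybe.just-injective
            (trans (sym (colour-col e)) (trans (col-sym φ u v) (colour-col (proj₁ e , flip φ (proj₂ e)))))
        ; proper = λ u v w e e′ eq → col-proper φ (colour-col e) (trans (colour-col e′) (cong just (sym eq)))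
        }

    subgraph⇒colouring : ∀ {k} → Has3ColourableSubgraphOfSize G k → ∃ λ φ → size φ ≡ k
    subgraph⇒colouring {k} (H , H⊆G , (c , isProper) , l) = φ , trans size≡ l
      where
      open IsProperEdgeColouring isProper
      f : V → V → Maybe Colour
      f u v with H [ u ~? v ]
      ... | yes _ = just (c u v)
      ... | no  _ = nothing
      f-on : ∀ {u v} → H [ u ~ v ] → f u v ≡ just (c u v)
      f-on {u} {v} e with H [ u ~? v ]
      ... | yes _ = refl
      ... | no ¬e = contradiction e ¬e
      f-edge : ∀ {u v d} → f u v ≡ just d → H [ u ~ v ] × c u v ≡ d
      f-edge {u} {v} e with H [ u ~? v ]
      ... | yes h = h , Maybe.just-injective e
      f-sym : ∀ u v → f u v ≡ f v u
      f-sym u v with H [ u ~? v ]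
      ... | yes e = trans (cong just (symmetric u v e)) (sym (f-on (Graph.~-sym H e)))
      ... | no ¬e with H [ v ~? u ]
      ...   | yes e = contradiction (Graph.~-sym H e) ¬e
      ...   | no _  = refl
      φ : Colouring
      φ = record
        { col        = f
        ; col-sym    = f-sym
        ; col-adj    = λ {u} {v} e → H⊆G u v (proj₁ (f-edge e))
        ; col-proper = λ {u} {v} {w} e e′ → let h , p = f-edge e ; h′ , p′ = f-edge e′ in
                         proper u v w h h′ (trans p (sym p′))
        }
      size≡ : size φ ≡ ∣E H ∣
      size≡ = cong length (List.filter-≐ (λ (u , v) → (u Fin.<? v) ×-dec coloured? φ u v)
        (λ (u , v) → (u Fin.<? v) ×-dec H [ u ~? v ])
        ((λ (lt , _ , e) → lt , proj₁ (f-edge e)) , (λ (lt , h) → lt , _ , f-on h)) pairs)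

  Uncoloured : Colouring → V × V → Set
  Uncoloured φ (u , v) = u Fin.< v × (u ~ v × col φ u v ≡ nothing)

  uncoloured? : ∀ φ p → Dec (Uncoloured φ p)
  uncoloured? φ (u , v) = (u Fin.<? v) ×-dec ((u ~? v) ×-dec Maybe.≡-dec Fin._≟_ (col φ u v) nothing)

  uncolouredEdges : Colouring → List (V × V)
  uncolouredEdges φ = filter {P = Uncoloured φ} (uncoloured? φ) pairs

  abstract
    edges-count : ∀ φ → ∣E G ∣ ≡ size φ + length (uncolouredEdges φ)
    edges-count φ = length-filter-⊎ {P = λ (u , v) → u Fin.< v × u ~ v} {Q = Ordered φ} {R = Uncoloured φ}
      (λ (u , v) → (u Fin.<? v) ×-dec (u ~? v)) (ordered? φ) (uncoloured? φ)
      (λ {p} (lt , e) → split (proj₁ p) (proj₂ p) lt e)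
      (λ {p} (lt , _ , e) → lt , col-adj φ e)
      (λ {p} (lt , e , _) → lt , e)
      (λ {p} (_ , _ , e) (_ , _ , e′) → contradiction (trans (sym e) e′) λ ())
      pairs
      where
      split : ∀ u v → u Fin.< v → u ~ v → Ordered φ (u , v) ⊎ Uncoloured φ (u , v)
      split u v lt e with col φ u v
      ... | just c  = inj₁ (lt , c , refl)
      ... | nothing = inj₂ (lt , e , refl)

  ∈-edges : ∀ {u v} → u Fin.< v → u ~ v → (u , v) ∈ edges G
  ∈-edges {u} {v} lt e = ∈-filter⁺ (λ (u , v) → (u Fin.<? v) ×-dec (u ~? v)) (pairs-complete (u , v)) (lt , e)

  allDarts : List (V × V)
  allDarts = edges G ++ map Product.swap (edges G)

  length-allDarts : length allDarts ≡ ∣E G ∣ + ∣E G ∣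
  length-allDarts = trans (List.length-++ (edges G)) (cong (∣E G ∣ +_) (List.length-map Product.swap (edges G)))

  ∈-allDarts : ∀ {u v} → u ~ v → (u , v) ∈ allDarts
  ∈-allDarts {u} {v} u~v with Fin.<-cmp u v
  ... | tri< lt _ _ = ∈-++⁺ˡ (∈-edges lt u~v)
  ... | tri≈ _ eq _ = contradiction eq (~⇒≢ u~v)
  ... | tri> _ _ gt = ∈-++⁺ʳ (edges G) (∈-map⁺ Product.swap (∈-edges gt (~-sym u~v)))

-- Walks and odd cycles

module Walks {n : ℕ} (G : Graph n) where

  private
    V : Set
    V = Fin n

  infixr 5 _∷_ _⊕_

  data Walk : V → V → ℕ → Set where
    []  : ∀ {u} → Walk u u 0
    _∷_ : ∀ {u v w ℓ} → G [ u ~ v ] → Walk v w ℓ → Walk u w (suc ℓ)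

  _⊕_ : ∀ {u v w k ℓ} → Walk u v k → Walk v w ℓ → Walk u w (k + ℓ)
  []      ⊕ q = q
  (e ∷ p) ⊕ q = e ∷ (p ⊕ q)

  at : ∀ {u v ℓ} → Walk u v ℓ → ℕ → V
  at {u} p       zero    = u
  -- Beyond its end a walk stays at its last vertex.
  at {u} []      (suc i) = u
  at     (e ∷ p) (suc i) = at p i

  at-adj : ∀ {u v ℓ} (p : Walk u v ℓ) i → i < ℓ → G [ at p i ~ at p (suc i) ]
  at-adj (e ∷ [])     zero    _         = e
  at-adj (e ∷ _ ∷ _) zero    _         = e
  at-adj (e ∷ p)      (suc i) (s≤s i<ℓ) = at-adj p i i<ℓ

  at-end : ∀ {u v ℓ} (p : Walk u v ℓ) → at p ℓ ≡ v
  at-end []      = refl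
  at-end (e ∷ p) = at-end p

  prefix : ∀ {u v ℓ} (p : Walk u v ℓ) i → i ≤ ℓ → Walk u (at p i) i
  prefix p       zero    _         = []
  prefix (e ∷ p) (suc i) (s≤s i≤ℓ) = e ∷ prefix p i i≤ℓ

  suffix : ∀ {u v ℓ} (p : Walk u v ℓ) i → i ≤ ℓ → Walk (at p i) v (ℓ ∸ i)
  suffix p       zero    _         = p
  suffix (e ∷ p) (suc i) (s≤s i≤ℓ) = suffix p i i≤ℓ

  at-suffix : ∀ {u v ℓ} (p : Walk u v ℓ) i i≤ℓ k → at (suffix p i i≤ℓ) k ≡ at p (i + k)
  at-suffix p       zero    _         k = refl
  at-suffix (e ∷ p) (suc i) (s≤s i≤ℓ) k = at-suffix p i i≤ℓ k

  -- A repeated vertex cuts the walk into two shorter closed walks, and as the lengths add up to an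
  -- odd number, one of them is odd. Without a repetition the walk is a cycle; length 1 would be a
  -- loop.
  odd-closed-walk⇒cycle : ∀ {u ℓ} → Odd ℓ → Walk u u ℓ → ∃ λ k → k ≤ ℓ × HasOddCycleOfLength G k
  odd-closed-walk⇒cycle {ℓ = ℓ} = go ℓ ℕ.≤-refl
    where
    go : ∀ fuel {u ℓ} → ℓ ≤ fuel → Odd ℓ → Walk u u ℓ → ∃ λ k → k ≤ ℓ × HasOddCycleOfLength G k
    go zero    ℓ≤ (h , refl) p = contradiction ℓ≤ λ ()
    go (suc fuel) {u} {ℓ} ℓ≤ odd@(h , refl) p
      with Fin.any? (λ (i : Fin ℓ) → Fin.any? λ (j : Fin ℓ) → (i Fin.<? j) ×-dec (at p (toℕ i) Fin.≟ at p (toℕ j)))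
    ... | no simple = ℓ , ℕ.≤-refl , odd⇒¬2∣ h , at p ∘ toℕ , record
      { length≥3 = long h p
      ; injective = inj
      ; consecutive = λ i j e → subst (λ k → G [ at p (toℕ i) ~ at p k ]) (sym e) (at-adj p (toℕ i) (Fin.toℕ<n i))
      ; closing = λ i j e e′ → subst (λ y → G [ at p (toℕ i) ~ y ])
          (trans (cong (at p) e) (trans (at-end p) (cong (at p) (sym e′)))) (at-adj p (toℕ i) (Fin.toℕ<n i))
      }
      where
      long : ∀ h → Walk u u (suc (h * 2)) → 3 ≤ suc (h * 2)
      long zero    (e ∷ []) = contradiction e (Graph.~-irrefl G refl)
      long (suc h) p        = s≤s (s≤s (s≤s z≤n))
      inj : ∀ {i j : Fin ℓ} → at p (toℕ i) ≡ at p (toℕ j) → i ≡ j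
      inj {i} {j} e with Fin.<-cmp i j
      ... | tri< lt _ _ = contradiction (i , j , lt , e) simple
      ... | tri≈ _ eq _ = eq
      ... | tri> _ _ gt = contradiction (j , i , gt , sym e) simple
    ... | yes (i , j , i<j , e) = split (even⊎odd d)
      where
      a b d : ℕ
      a = toℕ i
      b = toℕ j
      d = b ∸ a
      a≤b : a ≤ b
      a≤b = ℕ.<⇒≤ i<j
      b≤ℓ : b ≤ ℓ
      b≤ℓ = ℕ.<⇒≤ (Fin.toℕ<n j)
      a≤ℓ : a ≤ ℓ
      a≤ℓ = ℕ.≤-trans a≤b b≤ℓ
      inner : Walk (at p a) (at p a) d
      inner = subst (λ x → Walk (at p a) x d)
        (trans (at-suffix p a a≤ℓ d) (trans (cong (at p) (ℕ.m+[n∸m]≡n a≤b)) (sym e)))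
        (prefix (suffix p a a≤ℓ) d (ℕ.∸-monoˡ-≤ a b≤ℓ))
      outer : Walk u u (a + (ℓ ∸ b))
      outer = prefix p a a≤ℓ ⊕ subst (λ x → Walk x u (ℓ ∸ b)) (sym e) (suffix p b b≤ℓ)
      total : d + (a + (ℓ ∸ b)) ≡ ℓ
      total = trans (sym (ℕ.+-assoc d a _)) (trans (cong (_+ (ℓ ∸ b)) (ℕ.m∸n+n≡m a≤b)) (ℕ.m+[n∸m]≡n b≤ℓ))
      d<ℓ : d < ℓ
      d<ℓ = ℕ.≤-<-trans (ℕ.m∸n≤m b a) (Fin.toℕ<n j)
      0<d : 0 < d
      0<d = ℕ.m<n⇒0<n∸m i<j
      rest<ℓ : a + (ℓ ∸ b) < ℓ
      rest<ℓ = subst (a + (ℓ ∸ b) <_) total (ℕ.m<n+m (a + (ℓ ∸ b)) 0<d)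
      shorten : ∀ {u m} → m < ℓ → Odd m → Walk u u m → ∃ λ k → k ≤ ℓ × HasOddCycleOfLength G k
      shorten m<ℓ odd-m q with go fuel (ℕ.≤-pred (ℕ.≤-trans m<ℓ ℓ≤)) odd-m q
      ... | k , k≤m , c = k , ℕ.≤-trans k≤m (ℕ.<⇒≤ m<ℓ) , c
      split : Even d ⊎ Odd d → ∃ λ k → k ≤ ℓ × HasOddCycleOfLength G k
      split (inj₂ odd-d)  = shorten d<ℓ odd-d inner
      split (inj₁ even-d) = shorten rest<ℓ (even+odd even-d (subst Odd (sym total) odd)) outer

-- Recognising the Petersen graph

petersen-neighbours : Fin 10 → Fin 10 × Fin 10 × Fin 10
petersen-neighbours 0F = 1F , 4F , 5F
petersen-neighbours 1F = 2F , 0F , 6F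
petersen-neighbours 2F = 3F , 1F , 7F
petersen-neighbours 3F = 4F , 2F , 8F
petersen-neighbours 4F = 0F , 3F , 9F
petersen-neighbours 5F = 7F , 8F , 0F
petersen-neighbours 6F = 8F , 9F , 1F
petersen-neighbours 7F = 9F , 5F , 2F
petersen-neighbours 8F = 5F , 6F , 3F
petersen-neighbours 9F = 6F , 7F , 4F

abstract
  petersen-neighbours-adjacent : ∀ (a : Fin 10) → let p , q , r = petersen-neighbours a in
    Petersen [ a ~ p ] × Petersen [ a ~ q ] × Petersen [ a ~ r ] × p ≢ q × p ≢ r × q ≢ r
  petersen-neighbours-adjacent = from-yes (Fin.all? λ (a : Fin 10) → let p , q , r = petersen-neighbours a in
    (Petersen [ a ~? p ]) ×-dec (Petersen [ a ~? q ]) ×-dec (Petersen [ a ~? r ])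
    ×-dec ¬? (p Fin.≟ q) ×-dec ¬? (p Fin.≟ r) ×-dec ¬? (q Fin.≟ r))

-- Each vertex of the copy already has three neighbours inside it and so no others. Hence the copy
-- has no extra edges, and by connectedness it is the whole graph.
petersen-copy⇒≅ : ∀ {n} (G : Graph n) → ThreeNeighbours G → Connected G → (f : Fin 10 → Fin n) →
                  (∀ {a b} → f a ≡ f b → a ≡ b) →
                  All (λ (a , b) → G [ f a ~ f b ]) petersenEdges → G ≅ Petersen
petersen-copy⇒≅ {n} G nb3 connected f f-inj edges-kept = record
  { bijection = mk↔ₛ′ index f (λ a → f-inj (index-f (f a))) index-f
  ; adjacency = λ u v → mk⇔
      (λ e → let b , ab , fb≡v = reflects (index u) (subst (λ x → G [ x ~ v ]) (sym (index-f u)) e) in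
             subst (λ x → Petersen [ index u ~ x ]) (f-inj (trans (fb≡v) (sym (index-f v)))) ab)
      (λ e → subst₂ (λ x y → G [ x ~ y ]) (index-f u) (index-f v) (preserves e))
  }
  where
  preserves : ∀ {a b} → Petersen [ a ~ b ] → G [ f a ~ f b ]
  preserves (inj₁ ab∈) = All.lookup edges-kept ab∈
  preserves (inj₂ ba∈) = Graph.~-sym G (All.lookup edges-kept ba∈)
  reflects : ∀ a {y} → G [ f a ~ y ] → ∃ λ b → Petersen [ a ~ b ] × f b ≡ y
  reflects a e with petersen-neighbours a | petersen-neighbours-adjacent a
  ... | p , q , r | ap , aq , ar , p≢q , p≢r , q≢r
    with nb3 (preserves ap) (preserves aq) (preserves ar) e (p≢q ∘ f-inj) (p≢r ∘ f-inj) (q≢r ∘ f-inj)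
  ...   | inj₁ y≡ = p , ap , sym y≡
  ...   | inj₂ (inj₁ y≡) = q , aq , sym y≡
  ...   | inj₂ (inj₂ y≡) = r , ar , sym y≡
  reach : ∀ {x y} → Star (λ u v → G [ u ~ v ]) x y → (∃ λ a → f a ≡ x) → ∃ λ a → f a ≡ y
  reach ε p = p
  reach (e ◅ es) (a , refl) = let b , _ , q = reflects a e in reach es (b , q)
  index : Fin n → Fin 10
  index y = proj₁ (reach (connected (f 0F) y) (0F , refl))
  index-f : ∀ y → f (index y) ≡ y
  index-f y = proj₂ (reach (connected (f 0F) y) (0F , refl))

-- Arithmetic of the charging

odd-gap : ∀ {a b} → Odd a → Odd b → a < b → 2 + a ≤ b
odd-gap (h , refl) (k , refl) lt = s≤s (ℕ.*-monoˡ-≤ 2 {suc h} {k} (ℕ.*-cancelʳ-< 2 h k (ℕ.≤-pred lt)))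

∑-zero : ∀ {s} {f : Fin s → ℕ} → (∀ i → f i ≡ 0) → ∑ f ≡ 0
∑-zero {zero}  z = refl
∑-zero {suc s} z = cong₂ _+_ (z zero) (∑-zero (z ∘ suc))

-- A cycle of length L can spare two darts for each of r cycles of length g that exit
-- only into it.
long-cycle-pays : ∀ g L r → 3 ≤ g → 2 + g ≤ L → g * r ≤ L → 2 + 3 * g + 2 * r ≤ 3 * L
long-cycle-pays g L 0 3≤g g+2≤L _ = begin
  2 + 3 * g + 0 ≤⟨ ℕ.m≤m+n _ 4 ⟩
  2 + 3 * g + 0 + 4 ≡⟨ solve 1 (λ g → con 2 :+ con 3 :* g :+ con 0 :+ con 4 := con 3 :* (con 2 :+ g)) refl g ⟩
  3 * (2 + g)   ≤⟨ ℕ.*-monoʳ-≤ 3 g+2≤L ⟩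
  3 * L         ∎
  where
  open ℕ.≤-Reasoning
  open +-*-Solver
long-cycle-pays g L 1 3≤g g+2≤L _ = begin
  2 + 3 * g + 2 ≤⟨ ℕ.m≤m+n _ 2 ⟩
  2 + 3 * g + 2 + 2 ≡⟨ solve 1 (λ g → con 2 :+ con 3 :* g :+ con 2 :+ con 2 := con 3 :* (con 2 :+ g)) refl g ⟩
  3 * (2 + g)   ≤⟨ ℕ.*-monoʳ-≤ 3 g+2≤L ⟩
  3 * L         ∎
  where
  open ℕ.≤-Reasoning
  open +-*-Solver
long-cycle-pays g L (suc (suc r)) 3≤g _ gr≤L = begin
  2 + 3 * g + 2 * (2 + r)                 ≤⟨ ℕ.m≤m+n _ (3 + 7 * r) ⟩
  2 + 3 * g + 2 * (2 + r) + (3 + 7 * r)   ≡⟨ solve 2 (λ g r → con 2 :+ con 3 :* g :+ con 2 :* (con 2 :+ r) :+ (con 3 :+ con 7 :* r)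
                                                   := con 3 :* g :+ con 3 :* (con 3 :* (con 1 :+ r))) refl g r ⟩
  3 * g + 3 * (3 * (1 + r))               ≤⟨ ℕ.+-monoʳ-≤ (3 * g) (ℕ.*-monoʳ-≤ 3 (ℕ.*-monoˡ-≤ (1 + r) 3≤g)) ⟩
  3 * g + 3 * (g * (1 + r))               ≡⟨ solve 2 (λ g r → con 3 :* g :+ con 3 :* (g :* (con 1 :+ r)) := con 3 :* (g :* (con 2 :+ r))) refl g r ⟩
  3 * (g * (2 + r))                       ≤⟨ ℕ.*-monoʳ-≤ 3 gr≤L ⟩
  3 * L                                   ∎
  where
  open ℕ.≤-Reasoning
  open +-*-Solver

-- Largest colourings and local recolourings

module Optimum {n : ℕ} (G : Graph n) (nb3 : ThreeNeighbours G) (N : ℕ)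
  (bound : ∀ φ → Colourings.size G φ ≤ N) where

  open Colourings G public

  -- As `bound` gives the reverse inequality, these are the colourings of exactly `N` edges.
  Opt : Colouring → Set
  Opt φ = N ≤ size φ

  clash : ∀ {m : Maybe Colour} {c} → m ≡ nothing → m ≢ just c
  clash refl ()

  clash′ : ∀ {m : Maybe Colour} {c d} → c ≢ d → m ≡ just c → m ≢ just d
  clash′ c≢d refl refl = c≢d refl

  no-augment : ∀ φ → Opt φ → ∀ {x y c} → x ~ y → col φ x y ≡ nothing → Misses φ x c → Misses φ y c → ⊥
  no-augment φ opt {c = c} x~y unc mx my = ℕ.<⇒≱ (s≤s opt)
    (subst (_≤ N) (size-paint φ c x~y mx my unc) (bound (paint φ c x~y mx my)))

  -- Edges of all three colours together with the uncoloured one would give four neighbours.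
  missing-colour : ∀ φ {u w} → u ~ w → col φ u w ≡ nothing → ∃ (Misses φ u)
  missing-colour φ {u} {w} u~w unc with seen? φ u 0F | seen? φ u 1F | seen? φ u 2F
  ... | no ¬p | _ | _ = 0F , λ x e → ¬p (x , e)
  ... | yes _ | no ¬p | _ = 1F , λ x e → ¬p (x , e)
  ... | yes _ | yes _ | no ¬p = 2F , λ x e → ¬p (x , e)
  ... | yes (x , p) | yes (y , q) | yes (z , r)
    with nb3 (col-adj φ p) (col-adj φ q) (col-adj φ r) u~w
           (λ { refl → clash′ (λ ()) p q }) (λ { refl → clash′ (λ ()) p r }) (λ { refl → clash′ (λ ()) q r })
  ... | inj₁ refl = contradiction p (clash unc)
  ... | inj₂ (inj₁ refl) = contradiction q (clash unc)
  ... | inj₂ (inj₂ refl) = contradiction r (clash unc)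

  private
    replace-opt : ∀ φ → Opt φ → ∀ {p q c x y d} → col φ p q ≡ just c →
                  (x~y : x ~ y) → col (erase φ p q) x y ≡ nothing → ∀ mx my →
                  Opt (paint (erase φ p q) d x~y mx my)
    replace-opt φ opt {p} {q} {d = d} pq x~y unc mx my =
      subst (N ≤_) (trans (size-erase φ pq) (sym (size-paint (erase φ p q) d x~y mx my unc))) opt

  -- The uncoloured edge slides from `x y` to `y z`, handing its colour `a` back to `x y`. Missing
  -- colours survive, except possibly `a` at `x` and `y`.
  record Shift (φ : Colouring) (x y z : V) (a : Colour) : Set where
    field
      after    : Colouring
      opt      : Opt after
      painted  : col after x y ≡ just a
      erased   : col after y z ≡ nothing
      same     : ∀ {u v} → ¬ Same x y u v → ¬ Same y z u v → col after u v ≡ col φ u v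
      keeps    : ∀ {u d} → (d ≡ a → u ≢ x × u ≢ y) → Misses φ u d → Misses after u d
      end      : Misses after z a

  shift : ∀ φ → Opt φ → ∀ {x y z a} → x ~ y → col φ x y ≡ nothing → Misses φ x a → col φ y z ≡ just a → Shift φ x y z a
  shift φ opt {x} {y} {z} {a} x~y unc mx yz = record
    { after = paint (erase φ y z) a x~y mx′ my′
    ; opt = replace-opt φ opt yz x~y unc′ mx′ my′
    ; painted = paint-on (erase φ y z) x~y mx′ my′ (inj₁ (refl , refl))
    ; erased = trans (paint-off (erase φ y z) x~y mx′ my′ λ { (inj₁ (y≡x , _)) → ~⇒≢ x~y (sym y≡x) ; (inj₂ (_ , z≡x)) → z≢x z≡x })
                     (erase-on φ y z (inj₁ (refl , refl)))
    ; same = λ ¬xy ¬yz → trans (paint-off (erase φ y z) x~y mx′ my′ ¬xy) (erase-off φ y z ¬yz)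
    ; keeps = λ ok m → paint-misses (erase φ y z) x~y mx′ my′ ok (erase-misses φ y z m)
    ; end = paint-misses (erase φ y z) x~y mx′ my′ (λ _ → z≢x , λ z≡y → ~⇒≢ (col-adj φ yz) (sym z≡y)) (erased-misses′ φ yz)
    }
    where
    mx′ = erase-misses φ y z mx
    my′ = erased-misses φ yz
    z≢x : z ≢ x
    z≢x refl = clash (flip φ unc) yz
    unc′ : col (erase φ y z) x y ≡ nothing
    unc′ = trans (erase-off φ y z λ { (inj₁ (x≡y , _)) → ~⇒≢ x~y x≡y ; (inj₂ (x≡z , _)) → z≢x (sym x≡z) }) unc

  -- Recolours `q u` from `c` to a colour `a` that both ends miss; the purpose is to make `q` miss
  -- `c`.
  record Move (φ : Colouring) (q u : V) (c a : Colour) : Set where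
    field
      after    : Colouring
      opt      : Opt after
      freed    : Misses after q c
      same     : ∀ {v w} → ¬ Same q u v w → col after v w ≡ col φ v w
      keeps    : ∀ {v d} → (d ≡ a → v ≢ q × v ≢ u) → Misses φ v d → Misses after v d

  move : ∀ φ → Opt φ → ∀ {q u c a} → c ≢ a → col φ q u ≡ just c → Misses φ q a → Misses φ u a → Move φ q u c a
  move φ opt {q} {u} {c} {a} c≢a qu mq mu = record
    { after = paint (erase φ q u) a q~u mq′ mu′
    ; opt = replace-opt φ opt qu q~u (erase-on φ q u (inj₁ (refl , refl))) mq′ mu′
    ; freed = paint-misses (erase φ q u) q~u mq′ mu′ (λ e → contradiction e c≢a) (erased-misses φ qu)
    ; same = λ ¬s → trans (paint-off (erase φ q u) q~u mq′ mu′ ¬s) (erase-off φ q u ¬s)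
    ; keeps = λ ok m → paint-misses (erase φ q u) q~u mq′ mu′ ok (erase-misses φ q u m)
    }
    where
    q~u = col-adj φ qu
    mq′ = erase-misses φ q u mq
    mu′ = erase-misses φ q u mu

  -- Below, p q is the uncoloured edge of an odd cycle and c the colour of the edges
  -- leaving that cycle.

  -- Once the uncoloured edge has slid to `q x`, both of its ends still miss `a`, so it could be
  -- coloured.
  no-common-missing : ∀ φ → Opt φ → ∀ {p q x c a} → p ~ q → col φ p q ≡ nothing → Misses φ p c →
                      col φ q x ≡ just c → c ≢ a → Misses φ q a → Misses φ x a → ⊥
  no-common-missing φ opt {p} {q} {x} {c} {a} p~q unc mp qx c≢a mq mx =
    no-augment after opt′ (col-adj φ qx) erased (keeps ok mq) (keeps ok mx)
    where
    open Shift (shift φ opt p~q unc mp qx) renaming (opt to opt′)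
    ok : ∀ {u} → a ≡ c → u ≢ p × u ≢ q
    ok e = contradiction (sym e) c≢a

  -- After the slide to `q x` the vertex `x` misses `c`, as `y` does. Recolouring `x y` from `a` to
  -- `c` frees `a` at `x`, and `q x` can take it.
  no-common-missing′ : ∀ φ → Opt φ → ∀ {p q x y c a} → p ~ q → col φ p q ≡ nothing → Misses φ p c →
                       col φ q x ≡ just c → c ≢ a → Misses φ q a → col φ x y ≡ just a → Misses φ y c → p ≢ y → ⊥
  no-common-missing′ φ opt {p} {q} {x} {y} {c} {a} p~q unc mp qx c≢a mq xy my p≢y =
    no-augment M.after M.opt (col-adj φ qx)
      (trans (M.same λ { (inj₁ (q≡x , _)) → q≢x q≡x ; (inj₂ (q≡y , _)) → y≢q (sym q≡y) }) S.erased)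
      (M.keeps (λ _ → q≢x , y≢q ∘ sym) (S.keeps (λ e → contradiction (sym e) c≢a) mq)) M.freed
    where
    module S = Shift (shift φ opt p~q unc mp qx)
    q≢x : q ≢ x
    q≢x = ~⇒≢ (col-adj φ qx)
    y≢q : y ≢ q
    y≢q refl = clash′ c≢a (flip φ qx) xy
    x≢p : x ≢ p
    x≢p refl = clash (flip φ unc) qx
    xy′ : col S.after x y ≡ just a
    xy′ = trans (S.same (λ { (inj₁ (x≡p , _)) → x≢p x≡p ; (inj₂ (x≡q , _)) → q≢x (sym x≡q) })
                        (λ { (inj₁ (x≡q , _)) → q≢x (sym x≡q) ; (inj₂ (_ , y≡q)) → y≢q y≡q })) xy
    module M = Move (move S.after S.opt (c≢a ∘ sym) xy′ S.end (S.keeps (λ _ → p≢y ∘ sym , y≢q) my))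

  -- Recolouring `q u` from `c` to `a` makes `q` miss `c`. When the uncoloured edge has slid to
  -- `q r`, the vertices `q`, `r`, `u′` are in the position of `p`, `q`, `x` in `no-common-missing`,
  -- with `b` as the common missing colour.
  no-two-exits : ∀ φ → Opt φ → ∀ {p q r u u′ c a b} → p ~ q → col φ p q ≡ nothing → Misses φ p b → Misses φ q a →
                 col φ q r ≡ just b → col φ q u ≡ just c → Misses φ u a → col φ r u′ ≡ just c → Misses φ u′ b →
                 c ≢ a → c ≢ b → p ≢ u′ → ⊥
  no-two-exits φ opt {p} {q} {r} {u} {u′} {c} {a} {b} p~q unc mp mq qr qu mu ru′ mu′ c≢a c≢b p≢u′ =
    no-common-missing S.after S.opt (col-adj φ qr) S.erased
      (S.keeps (λ e → contradiction e c≢b) M.freed)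
      (trans (S.same (λ { (inj₁ (r≡p , _)) → r≢p r≡p ; (inj₂ (r≡q , _)) → r≢q r≡q })
                     (λ { (inj₁ (r≡q , _)) → r≢q r≡q ; (inj₂ (_ , u′≡q)) → u′≢q u′≡q }))
        (trans (M.same (λ { (inj₁ (r≡q , _)) → r≢q r≡q ; (inj₂ (_ , u′≡q)) → u′≢q u′≡q })) ru′))
      c≢b S.end
      (S.keeps (λ _ → p≢u′ ∘ sym , u′≢q) (M.keeps (λ e → contradiction e b≢a) mu′))
    where
    r≢q : r ≢ q
    r≢q refl = ~⇒≢ (col-adj φ qr) refl
    r≢p : r ≢ p
    r≢p refl = clash (flip φ unc) qr
    u′≢q : u′ ≢ q
    u′≢q refl = clash′ c≢b (flip φ ru′) qr
    b≢a : b ≢ a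
    b≢a refl = mq r qr
    u≢p : u ≢ p
    u≢p refl = clash (flip φ unc) qu
    u≢r : u ≢ r
    u≢r refl = clash′ c≢b qu qr
    module M = Move (move φ opt c≢a qu mq mu)
    unc′ : col M.after p q ≡ nothing
    unc′ = trans (M.same λ { (inj₁ (p≡q , _)) → ~⇒≢ p~q p≡q ; (inj₂ (p≡u , _)) → u≢p (sym p≡u) }) unc
    qr′ : col M.after q r ≡ just b
    qr′ = trans (M.same λ { (inj₁ (_ , r≡u)) → u≢r (sym r≡u) ; (inj₂ (_ , r≡q)) → r≢q r≡q }) qr
    module S = Shift (shift M.after M.opt p~q unc′ (M.keeps (λ e → contradiction e b≢a) mp) qr′)

  -- Turning an odd cycle

  -- An odd cycle of length suc K, listed periodically.
  record Shape (v : ℕ → V) (K : ℕ) : Set where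
    field
      adj  : ∀ i → v i ~ v (suc i)
      per  : ∀ i → v (suc K + i) ≡ v i
      inj  : ∀ i d → d < K → v i ≢ v (suc d + i)
      half : ℕ
      even : K ≡ suc half * 2

  -- The alternating path starts with `a` at position 1, which misses `b`. As `K` is even, it ends
  -- with `b` at position 0, which misses `a`.
  record State (φ : Colouring) (v : ℕ → V) (K : ℕ) (a b : Colour) : Set where
    field
      unc   : col φ (v 0) (v 1) ≡ nothing
      miss₀ : Misses φ (v 0) a
      miss₁ : Misses φ (v 1) b
      run   : ∀ i → i < K → col φ (v (1 + i)) (v (2 + i)) ≡ just (alt a b i)

  CycleEdge : (ℕ → V) → V → V → Set
  CycleEdge v p q = ∃ λ i → Same (v i) (v (suc i)) p q

  On : (ℕ → V) → V → Set
  On v u = ∃ λ i → u ≡ v i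

  shape-suc : ∀ {v K} → Shape v K → Shape (v ∘ suc) K
  shape-suc {v} {K} s = record
    { adj = adj ∘ suc
    ; per = λ i → trans (cong (v ∘ suc) (sym (ℕ.+-suc K i))) (per (suc i))
    ; inj = λ i d d<K e → inj (suc i) d d<K (trans e (cong (v ∘ suc) (sym (ℕ.+-suc d i))))
    ; half = half ; even = even
    }
    where open Shape s

  shape-cong : ∀ {v w K} → (∀ i → v i ≡ w i) → Shape v K → Shape w K
  shape-cong eq sh = record
    { adj = λ i → subst₂ _~_ (eq i) (eq (suc i)) (adj i)
    ; per = λ i → trans (sym (eq _)) (trans (per i) (eq i))
    ; inj = λ i d d<K e → inj i d d<K (trans (eq i) (trans e (sym (eq _))))
    ; half = half ; even = even }
    where open Shape sh

  shape-+ : ∀ {v K} j → Shape v K → Shape (λ i → v (i + j)) K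
  shape-+ {v} zero    sh = shape-cong (λ i → cong v (sym (ℕ.+-identityʳ i))) sh
  shape-+ {v} (suc j) sh = shape-cong (λ i → cong v (sym (ℕ.+-suc i j))) (shape-+ j (shape-suc sh))

  distinct : ∀ {v K} → Shape v K → ∀ {i j} → i < j → j ≤ K + i → v i ≢ v j
  distinct {v} {K} s {i} {j} i<j j≤K+i e = Shape.inj s i (j ∸ suc i)
    (ℕ.+-cancelʳ-< i _ _ (ℕ.<-≤-trans (ℕ.≤-reflexive eq) j≤K+i)) (trans e (cong v (sym eq)))
    where
    eq : suc (j ∸ suc i) + i ≡ j
    eq = trans (sym (ℕ.+-suc (j ∸ suc i) i)) (ℕ.m∸n+n≡m i<j)

  1<K : ∀ {v K} → Shape v K → 1 < K
  1<K s = subst (1 <_) (sym (Shape.even s)) (s≤s (s≤s z≤n))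

  record Agrees (v : ℕ → V) (φ ψ : Colouring) : Set where
    constructor agrees-off
    field off : ∀ {p q} → ¬ CycleEdge v p q → col ψ p q ≡ col φ p q

  open Agrees public

  step : ∀ {φ v K a b} → Opt φ → a ≢ b → Shape v K → State φ v K a b →
         Σ (Shift φ (v 0) (v 1) (v 2) a) λ S → State (Shift.after S) (v ∘ suc) K b a
  step {φ} {v} {K} {a} {b} opt a≢b sh st = S , record
      { unc   = erased
      ; miss₀ = keeps (λ b≡a → contradiction (sym b≡a) a≢b) miss₁
      ; miss₁ = end
      ; run   = run′
      }
    where
    open Shape sh
    open State st
    S = shift φ opt (adj 0) unc miss₀ (run 0 (ℕ.<-trans (s≤s z≤n) (1<K sh)))
    open Shift S hiding (opt)
    -- The edge just painted comes last in the new path; as `K` is even, the alternation starting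
    -- with `b` ends with `a`, the colour it has received.
    last : ∀ i → suc i ≡ K → alt b a i ≡ a
    last i e with refl ← ℕ.suc-injective (trans e even) =
      trans (cong (alt a b) (sym (ℕ.+-identityʳ (half * 2)))) (alt-even half 0)
    run′ : ∀ i → i < K → col after (v (2 + i)) (v (3 + i)) ≡ just (alt b a i)
    run′ i i<K with ℕ.m≤n⇒m<n∨m≡n i<K
    ... | inj₁ 1+i<K = trans
      (same (λ { (inj₁ (e , _)) → distinct sh (s≤s z≤n) (ℕ.≤-trans 1+i<K (ℕ.m≤m+n K 0)) (sym e)
               ; (inj₂ (e , _)) → distinct sh (s≤s (s≤s z≤n)) (ℕ.≤-trans 1+i<K (ℕ.m≤m+n K 1)) (sym e) })
            (λ { (inj₁ (e , _)) → distinct sh (s≤s (s≤s z≤n)) (ℕ.≤-trans 1+i<K (ℕ.m≤m+n K 1)) (sym e)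
               ; (inj₂ (_ , e)) → distinct sh (s≤s (s≤s z≤n))
                   (ℕ.≤-trans (s≤s 1+i<K) (ℕ.≤-reflexive (sym (ℕ.+-comm K 1)))) (sym e) }))
      (run (suc i) 1+i<K)
    ... | inj₂ refl = trans (cong₂ (col after)
                        (trans (cong (λ k → v (2 + k)) (sym (ℕ.+-identityʳ i))) (per 0))
                        (trans (cong (λ k → v (2 + k)) (sym (ℕ.+-comm i 1))) (per 1)))
                      (trans painted (cong just (sym (last i refl))))

  agrees-trans : ∀ {v φ ψ χ} → Agrees v φ ψ → Agrees (v ∘ suc) ψ χ → Agrees v φ χ
  agrees-trans f g = agrees-off λ ¬ce → trans (off g λ (i , s) → ¬ce (suc i , s)) (off f ¬ce)

  rotate : ∀ t {φ v K a b} → Opt φ → a ≢ b → Shape v K → State φ v K a b →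
           ∃ λ ψ → Opt ψ × State ψ (λ i → v (t + i)) K (alt a b t) (alt b a t) × Agrees v φ ψ
  rotate zero    {φ} opt a≢b sh st = φ , opt , st , agrees-off λ _ → refl
  rotate (suc t) {φ} {v} opt a≢b sh st with step opt a≢b sh st
  ... | S , st′ with rotate t (Shift.opt S) (λ e → a≢b (sym e)) (shape-suc sh) st′
  ...   | χ , opt′ , st″ , ag = χ , opt′ , st″ , agrees-trans
        (agrees-off λ ¬ce → Shift.same S (λ s → ¬ce (0 , s)) (λ s → ¬ce (1 , s))) ag

  state-cong : ∀ {φ v w K a b} → (∀ i → v i ≡ w i) → State φ v K a b → State φ w K a b
  state-cong {φ} {v} {w} eq st = record
    { unc = subst₂ (λ p q → col φ p q ≡ nothing) (eq 0) (eq 1) unc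
    ; miss₀ = subst (λ p → Misses φ p _) (eq 0) miss₀
    ; miss₁ = subst (λ p → Misses φ p _) (eq 1) miss₁
    ; run = λ i i<K → subst₂ (λ p q → col φ p q ≡ _) (eq _) (eq _) (run i i<K)
    }
    where open State st

  -- `c` is the colour that the cycle does not use; it turns out to be the colour of every edge
  -- leaving the cycle.
  record Ready (φ : Colouring) (v : ℕ → V) (K : ℕ) (c : Colour) : Set where
    field
      {a b} : Colour
      a≢b   : a ≢ b
      a≢c   : a ≢ c
      b≢c   : b ≢ c
      state : State φ v K a b

  record Rotated (φ : Colouring) (v : ℕ → V) (K : ℕ) (c : Colour) (j : ℕ) (d : Colour) : Set where
    field
      {after} : Colouring
      opt     : Opt after
      {d′}    : Colour
      d≢d′    : d ≢ d′
      d′≢c    : d′ ≢ c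
      state   : State after (λ i → v (i + j)) K d d′
      agrees  : Agrees v φ after

  -- Going once around the odd cycle exchanges the two colours.
  abstract
    rotate-to : ∀ {φ v K c} → Opt φ → Shape v K → Ready φ v K c → ∀ j d → d ≢ c → Rotated φ v K c j d
    rotate-to {φ} {v} {K} {c} opt sh record { a = a ; b = b ; a≢b = a≢b ; a≢c = a≢c ; b≢c = b≢c ; state = st } j d d≢c =
      choose (only-three-colours a b c d a≢b a≢c b≢c d≢c) (alt-order j a b)
      where
      open Shape sh using (per; half; even)
      full : ∀ (a b : Colour) → alt a b (suc K + j) ≡ alt b a j
      full a b = trans (cong (λ k → alt b a (k + j)) even) (alt-even (suc half) j)
      once : ∀ {x y} → alt a b j ≡ x → alt b a j ≡ y → x ≢ y → y ≢ c → Rotated φ v K c j x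
      once refl refl x≢y y≢c with rotate j opt a≢b sh st
      ... | ψ , opt′ , st′ , ag = record { opt = opt′ ; d≢d′ = x≢y ; d′≢c = y≢c ; state = state-cong (λ i → cong v (ℕ.+-comm j i)) st′ ; agrees = ag }
      twice : ∀ {x y} → alt a b j ≡ y → alt b a j ≡ x → x ≢ y → y ≢ c → Rotated φ v K c j x
      twice refl refl x≢y y≢c with rotate (suc K + j) opt a≢b sh st
      ... | ψ , opt′ , st′ , ag = record
        { opt = opt′ ; d≢d′ = x≢y ; d′≢c = y≢c
        ; state = subst₂ (State ψ _ K) (full a b) (full b a)
                    (state-cong (λ i → trans (cong v (ℕ.+-assoc (suc K) j i)) (trans (per (j + i)) (cong v (ℕ.+-comm j i)))) st′)
        ; agrees = ag }
      choose : d ≡ a ⊎ d ≡ b → (alt a b j ≡ a × alt b a j ≡ b) ⊎ (alt a b j ≡ b × alt b a j ≡ a) → Rotated φ v K c j d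
      choose (inj₁ refl) (inj₁ (p , q)) = once p q a≢b b≢c
      choose (inj₁ refl) (inj₂ (p , q)) = twice p q a≢b b≢c
      choose (inj₂ refl) (inj₁ (p , q)) = twice p q (a≢b ∘ sym) a≢c
      choose (inj₂ refl) (inj₂ (p , q)) = once p q (a≢b ∘ sym) a≢c

  -- Building a cycle from an uncoloured edge

  module Trail (φ₀ : Colouring) (opt₀ : Opt φ₀) {x y : V} (x~y : x ~ y) (unc : col φ₀ x y ≡ nothing)
    {a b : Colour} (mx : Misses φ₀ x a) (my : Misses φ₀ y b) where

    a≢b : a ≢ b
    a≢b refl = no-augment φ₀ opt₀ x~y unc mx my

    -- If the path stopped at a vertex missing the next colour, the uncoloured edge could slide
    -- along it to the last edge and be coloured there. Each slide changes the colouring and swaps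
    -- the colours, hence the generality.
    no-dead-end : ∀ m φ (w : ℕ → V) {a b} → Opt φ → a ≢ b → w 0 ~ w 1 → col φ (w 0) (w 1) ≡ nothing →
      Misses φ (w 0) a → Misses φ (w 1) b →
      (∀ i → i < m → col φ (w (1 + i)) (w (2 + i)) ≡ just (alt a b i)) →
      (∀ i j → i < j → j ≤ suc m → w i ≢ w j) → ¬ Misses φ (w (suc m)) (alt a b m)
    no-dead-end zero φ w opt a≢b e unc m₀ m₁ run dis m = no-augment φ opt e unc m₀ m
    no-dead-end (suc m) φ w {a} {b} opt a≢b e unc m₀ m₁ run dis miss =
      no-dead-end m after (w ∘ suc) opt′ (a≢b ∘ sym) (col-adj φ (run 0 (s≤s z≤n))) erased
        (keeps (λ b≡a → contradiction (sym b≡a) a≢b) m₁) end run′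
        (λ i j i<j j≤ → dis (suc i) (suc j) (s≤s i<j) (s≤s j≤))
        (keeps (λ _ → (λ e → dis 0 (2 + m) (s≤s z≤n) ℕ.≤-refl (sym e)) , λ e → dis 1 (2 + m) (s≤s (s≤s z≤n)) ℕ.≤-refl (sym e)) miss)
      where
      open Shift (shift φ opt e unc m₀ (run 0 (s≤s z≤n))) renaming (opt to opt′)
      run′ : ∀ i → i < m → col after (w (2 + i)) (w (3 + i)) ≡ just (alt b a i)
      run′ i i<m = trans
        (same (λ { (inj₁ (p , _)) → dis 0 (2 + i) (s≤s z≤n) (s≤s (s≤s (ℕ.<⇒≤ i<m))) (sym p)
                 ; (inj₂ (p , _)) → dis 1 (2 + i) (s≤s (s≤s z≤n)) (s≤s (s≤s (ℕ.<⇒≤ i<m))) (sym p) })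
              (λ { (inj₁ (p , _)) → dis 1 (2 + i) (s≤s (s≤s z≤n)) (s≤s (s≤s (ℕ.<⇒≤ i<m))) (sym p)
                 ; (inj₂ (_ , p)) → dis 1 (3 + i) (s≤s (s≤s z≤n)) (s≤s (s≤s i<m)) (sym p) }))
        (run (suc i) (s≤s i<m))

    -- The value `u` for a missing colour is a dummy: `no-dead-end` excludes this case wherever a
    -- path is extended.
    next : Colour → V → V
    next c u with seen? φ₀ u c
    ... | yes (w , _) = w
    ... | no _        = u

    next-seen : ∀ c u → ¬ Misses φ₀ u c → col φ₀ u (next c u) ≡ just c
    next-seen c u ¬m with seen? φ₀ u c
    ... | yes (w , e) = e
    ... | no ¬p       = contradiction (λ w e → ¬p (w , e)) ¬m

    w : ℕ → V
    w 0             = x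
    w 1             = y
    w (suc (suc i)) = next (alt a b i) (w (suc i))

    record Path (m : ℕ) : Set where
      field
        run : ∀ i → i < m → col φ₀ (w (1 + i)) (w (2 + i)) ≡ just (alt a b i)
        dis : ∀ i j → i < j → j ≤ suc m → w i ≢ w j

    alt-≢ : ∀ {a b : Colour} → a ≢ b → ∀ i → alt a b i ≢ alt b a i
    alt-≢ a≢b zero    = a≢b
    alt-≢ a≢b (suc i) = alt-≢ (a≢b ∘ sym) i

    alt-two : ∀ {a b : Colour} i m → alt a b m ≡ alt a b i ⊎ alt a b m ≡ alt b a i
    alt-two zero    m       = alt-cases _ _ m
    alt-two {a} {b} (suc i) zero with alt-order i a b
    ... | inj₁ (e , _) = inj₂ (sym e)
    ... | inj₂ (_ , e) = inj₁ (sym e)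
    alt-two (suc i) (suc m) = alt-two i m

    ≤⇒<⊎≡ : ∀ {i j} → i ≤ suc j → i ≤ j ⊎ i ≡ suc j
    ≤⇒<⊎≡ i≤ with ℕ.m≤n⇒m<n∨m≡n i≤
    ... | inj₁ (s≤s p) = inj₁ p
    ... | inj₂ e = inj₂ e

    module Extend {m} (p : Path m) where
      open Path p
      new : col φ₀ (w (1 + m)) (w (2 + m)) ≡ just (alt a b m)
      new = next-seen _ _ (no-dead-end m φ₀ w opt₀ a≢b x~y unc mx my run dis)

      -- The vertices `w 2` to `w m` have both colours on path edges, so by properness a new edge
      -- ending there would come from a path neighbour; distinctness or the alternation excludes
      -- this. The vertex `w 1` has `a` on its path edge and misses `b`.
      fresh : ∀ j → 1 ≤ j → j ≤ suc m → w j ≢ w (2 + m)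
      fresh j 1≤j j≤ e with ≤⇒<⊎≡ j≤
      ... | inj₂ refl = ~⇒≢ (col-adj φ₀ new) e
      fresh (suc zero) _ _ e | inj₁ 1≤m with alt-cases a b m
      ... | inj₂ alt≡b = my _ (flip φ₀ (trans (cong (col φ₀ _) e) (trans new (cong just alt≡b))))
      ... | inj₁ alt≡a with ℕ.m≤n⇒m<n∨m≡n 1≤m
      ...   | inj₂ refl = a≢b (sym alt≡a)
      ...   | inj₁ 1<m  = dis 2 (1 + m) (s≤s 1<m) ℕ.≤-refl
        (col-proper φ₀ (run 0 1≤m) (flip φ₀ (trans (cong (col φ₀ _) e) (trans new (cong just alt≡a)))))
      fresh (suc (suc j)) _ _ e | inj₁ j≤m with alt-two {a} {b} j m
      ... | inj₁ eq = dis (1 + j) (1 + m) (s≤s (ℕ.<-trans (ℕ.n<1+n j) j≤m)) ℕ.≤-refl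
        (col-proper φ₀ (flip φ₀ (run j (ℕ.<-trans (ℕ.n<1+n j) j≤m))) (flip φ₀ (trans (cong (col φ₀ _) e) (trans new (cong just eq)))))
      ... | inj₂ eq with ℕ.m≤n⇒m<n∨m≡n j≤m
      ...   | inj₂ refl = alt-≢ a≢b j eq
      ...   | inj₁ j<m = dis (3 + j) (1 + m) (s≤s j<m) ℕ.≤-refl
        (col-proper φ₀ (run (1 + j) j≤m) (flip φ₀ (trans (cong (col φ₀ _) e) (trans new (cong just eq)))))

      longer : x ≢ w (2 + m) → Path (suc m)
      longer x≢ = record { run = run′ ; dis = dis′ }
        where
        run′ : ∀ i → i < suc m → col φ₀ (w (1 + i)) (w (2 + i)) ≡ just (alt a b i)
        run′ i (s≤s i≤m) with ℕ.m≤n⇒m<n∨m≡n i≤m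
        ... | inj₁ i<m  = run i i<m
        ... | inj₂ refl = new
        dis′ : ∀ i j → i < j → j ≤ suc (suc m) → w i ≢ w j
        dis′ i j i<j j≤ with ≤⇒<⊎≡ j≤
        ... | inj₁ j≤m = dis i j i<j j≤m
        dis′ zero    j i<j       j≤ | inj₂ refl = x≢
        dis′ (suc i) j (s≤s i≤m) j≤ | inj₂ refl = fresh (suc i) (s≤s z≤n) i≤m

    Closed : Set
    Closed = ∃ λ m → Path m × col φ₀ (w (suc m)) x ≡ just (alt a b m)

    -- A `Path m` has `m + 2` distinct vertices, so the path has to close before `m` reaches `n`.
    search : ∀ fuel m → n ≤ fuel + m → Path m → Closed
    search zero m n≤ p = contradiction (Fin.injective⇒≤ {f = w ∘ toℕ} inj′) (ℕ.<⇒≱ (s≤s (ℕ.≤-trans n≤ (ℕ.n≤1+n m))))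
      where
      open Path p
      inj′ : ∀ {i j : Fin (2 + m)} → w (toℕ i) ≡ w (toℕ j) → i ≡ j
      inj′ {i} {j} e with Fin.<-cmp i j
      ... | tri< lt _ _ = contradiction e (dis _ _ lt (ℕ.≤-pred (Fin.toℕ<n j)))
      ... | tri≈ _ eq _ = eq
      ... | tri> _ _ gt = contradiction (sym e) (dis _ _ gt (ℕ.≤-pred (Fin.toℕ<n i)))
    search (suc fuel) m n≤ p with x Fin.≟ w (2 + m)
    ... | yes e = m , p , trans (cong (col φ₀ (w (suc m))) e) (Extend.new p)
    ... | no x≢ = search fuel (suc m) (subst (n ≤_) (sym (ℕ.+-suc fuel m)) n≤) (Extend.longer p x≢)

    start : Path 0
    start = record { run = λ _ () ; dis = λ { zero (suc zero) _ _ → ~⇒≢ x~y ; zero (suc (suc _)) _ (s≤s ()) ; (suc _) (suc zero) (s≤s ()) _ ; (suc _) (suc (suc _)) _ (s≤s ()) } }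

    find-cycle : ∃₂ λ v K → Shape v K × State φ₀ v K a b × v 0 ≡ x × v 1 ≡ y
    find-cycle with search n 0 (ℕ.m≤m+n n 0) start
    ... | m , p , closing with even⊎odd m
    -- For even `m` the closing edge would have the colour `a`, which `x` misses.
    ...   | inj₁ (h , refl) = contradiction (flip φ₀ (trans closing (cong just (trans (cong (alt a b) (sym (ℕ.+-identityʳ (h * 2)))) (alt-even h 0))))) (mx _)
    ...   | inj₂ (h , refl) = v , K , shape , st , refl , refl
      where
      open Path p
      K = suc (suc (h * 2))
      v : ℕ → V
      v i = w (i % suc K)
      w-adj : ∀ i → i < K → w i ~ w (suc i)
      w-adj zero    _         = x~y
      w-adj (suc i) (s≤s i<m) = col-adj φ₀ (run i i<m)
      v-adj : ∀ i → v i ~ v (suc i)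
      v-adj i with %-suc (suc (h * 2)) i
      ... | inj₁ (lt , e) = subst (λ t → v i ~ w t) (sym e) (w-adj _ lt)
      ... | inj₂ (eq , e) = subst₂ (λ s t → w s ~ w t) (sym eq) (sym e) (col-adj φ₀ closing)
      w-inj : ∀ i j → i < suc K → j < suc K → i ≢ j → w i ≢ w j
      w-inj i j i<L j<L i≢j with ℕ.<-cmp i j
      ... | tri< lt _ _ = dis i j lt (ℕ.≤-pred j<L)
      ... | tri≈ _ eq _ = contradiction eq i≢j
      ... | tri> _ _ gt = dis j i gt (ℕ.≤-pred i<L) ∘ sym
      shape : Shape v K
      shape = record
        { adj = v-adj
        ; per = λ i → cong w (trans (cong (_% suc K) (ℕ.+-comm (suc K) i)) ([m+n]%n≡m%n i (suc K)))
        ; inj = λ i d d<K → w-inj _ _ (m%n<n i (suc K)) (m%n<n (suc d + i) (suc K)) (%-shift-≢ K d i (s≤s d<K))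
        ; half = h ; even = refl }
      v≡w : ∀ i → i < suc K → v i ≡ w i
      v≡w i i<L = cong w (m<n⇒m%n≡m i<L)
      st : State φ₀ v K a b
      st = record { unc = unc ; miss₀ = mx ; miss₁ = my ; run = run′ }
        where
        run′ : ∀ i → i < K → col φ₀ (v (1 + i)) (v (2 + i)) ≡ just (alt a b i)
        run′ i i<K with ≤⇒<⊎≡ i<K
        ... | inj₁ i<m = trans (cong₂ (col φ₀) (v≡w (1 + i) (s≤s i<K)) (v≡w (2 + i) (s≤s (s≤s i<m)))) (run i i<m)
        ... | inj₂ refl = trans (cong₂ (col φ₀) (v≡w (1 + i) (s≤s i<K)) (cong w (n%n≡0 (suc K)))) closing

    abstract
      cycle : ∃₂ λ v K → Shape v K × State φ₀ v K a b × v 0 ≡ x × v 1 ≡ y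
      cycle = find-cycle

  -- Positions on a cycle and edges leaving it

  module _ {v : ℕ → V} {K : ℕ} (sh : Shape v K) where
    open Shape sh

    v-mod : ∀ i → v i ≡ v (i % suc K)
    v-mod i = trans (cong v (trans (m≡m%n+[m/n]*n i (suc K)) (ℕ.+-comm (i % suc K) _))) (turns (i ℕ./ suc K))
      where
      turns : ∀ q → v (q * suc K + i % suc K) ≡ v (i % suc K)
      turns zero    = refl
      turns (suc q) = trans (cong v (ℕ.+-assoc (suc K) (q * suc K) _)) (trans (per (q * suc K + i % suc K)) (turns q))

    residue : ∀ {i j} → v i ≡ v j → i % suc K ≡ j % suc K
    residue {i} {j} e with ℕ.<-cmp (i % suc K) (j % suc K)
    ... | tri< lt _ _ = contradiction (trans (sym (v-mod i)) (trans e (v-mod j)))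
          (distinct sh lt (ℕ.≤-trans (ℕ.≤-pred (m%n<n j (suc K))) (ℕ.m≤m+n K _)))
    ... | tri≈ _ eq _ = eq
    ... | tri> _ _ gt = contradiction (trans (sym (v-mod j)) (trans (sym e) (v-mod i)))
          (distinct sh gt (ℕ.≤-trans (ℕ.≤-pred (m%n<n i (suc K))) (ℕ.m≤m+n K _)))

    translate : ∀ t {i j} → v i ≡ v j → v (t + i) ≡ v (t + j)
    translate t {i} {j} e = trans (v-mod (t + i)) (trans (cong v (trans (%-distribˡ-+ t i (suc K))
      (trans (cong (λ r → (t % suc K + r) % suc K) (residue e)) (sym (%-distribˡ-+ t j (suc K)))))) (sym (v-mod (t + j))))

    on? : ∀ u → Dec (On v u)
    on? u = map′ (λ (i , e) → toℕ i , e)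
      (λ (i , e) → fromℕ< (m%n<n i (suc K)) , trans e (trans (v-mod i) (cong v (sym (Fin.toℕ-fromℕ< (m%n<n i (suc K)))))))
      (Fin.any? λ (i : Fin (suc K)) → u Fin.≟ v (toℕ i))

    -- K + j plays the role of j − 1.
    pred-adj : ∀ j → v j ~ v (K + j)
    pred-adj j = ~-sym (subst (v (K + j) ~_) (per j) (adj (K + j)))

    next≢pred : ∀ j → v (suc j) ≢ v (K + j)
    next≢pred j = distinct sh (ℕ.+-monoˡ-< j (1<K sh)) (ℕ.+-monoʳ-≤ K (ℕ.n≤1+n j))

    edge-next : ∀ j → CycleEdge v (v j) (v (suc j))
    edge-next j = j , inj₁ (refl , refl)

    edge-pred : ∀ j → CycleEdge v (v j) (v (K + j))
    edge-pred j = K + j , inj₂ (sym (per j) , refl)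

    edge-cases : ∀ {j q} → CycleEdge v (v j) q → q ≡ v (suc j) ⊎ q ≡ v (K + j)
    edge-cases {j} (i , inj₁ (e , q≡)) = inj₁ (trans q≡ (translate 1 {i} {j} (sym e)))
    edge-cases {j} (i , inj₂ (e , q≡)) = inj₂ (trans q≡ (trans (sym (per i))
      (trans (cong v (sym (ℕ.+-suc K i))) (translate K {suc i} {j} (sym e)))))

  edge-on : ∀ {v p q} → CycleEdge v p q → On v p
  edge-on (i , inj₁ (e , _)) = i , e
  edge-on (i , inj₂ (e , _)) = suc i , e

  edge-sym : ∀ {v p q} → CycleEdge v p q → CycleEdge v q p
  edge-sym (i , s) = i , same-swap s

  -- The neighbour `y` may lie on the cycle itself, as the other end of a chord.
  record Third (v : ℕ → V) (K j : ℕ) (y : V) : Set where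
    constructor third
    field
      adjacent : v j ~ y
      ≢next    : y ≢ v (suc j)
      ≢pred    : y ≢ v (K + j)

  NoThird : (ℕ → V) → ℕ → ℕ → Set
  NoThird v K j = ∀ y → ¬ Third v K j y

  third? : ∀ v K j → Dec (∃ (Third v K j))
  third? v K j = map′ (λ (y , a , b , c) → y , third a b c) (λ (y , third a b c) → y , a , b , c)
    (Fin.any? λ y → (v j ~? y) ×-dec ¬? (y Fin.≟ v (suc j)) ×-dec ¬? (y Fin.≟ v (K + j)))

  third-unique : ∀ {v K j y z} → Shape v K → Third v K j y → Third v K j z → z ≡ y
  third-unique {j = j} sh (third a n p) (third a′ n′ p′)
    with nb3 (Shape.adj sh j) (pred-adj sh j) a a′ (next≢pred sh j) (n ∘ sym) (p ∘ sym)
  ... | inj₁ e = contradiction e n′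
  ... | inj₂ (inj₁ e) = contradiction e p′
  ... | inj₂ (inj₂ e) = e

  third-off : ∀ {v K j y} → Shape v K → Third v K j y → ¬ CycleEdge v (v j) y
  third-off sh (third _ n p) ce with edge-cases sh ce
  ... | inj₁ e = n e
  ... | inj₂ e = p e

  off-third : ∀ {v K j y} → Shape v K → v j ~ y → ¬ CycleEdge v (v j) y → Third v K j y
  off-third {j = j} sh a ¬ce = third a (λ { refl → ¬ce (edge-next sh j) }) (λ { refl → ¬ce (edge-pred sh j) })

  state-edges : ∀ {φ v K a b} → Shape v K → State φ v K a b → ∀ i →
                col φ (v i) (v (suc i)) ≡ nothing ⊎ ∃ λ d → (d ≡ a ⊎ d ≡ b) × col φ (v i) (v (suc i)) ≡ just d
  state-edges {φ} {v} {K} sh st i with i % suc K | m%n<n i (suc K) | v-mod sh i | translate sh 1 {i} {i % suc K} (v-mod sh i)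
  ... | zero  | _ | p | q = inj₁ (trans (cong₂ (col φ) p q) (State.unc st))
  ... | suc r | s≤s r<K | p | q = inj₂ (_ , alt-cases _ _ r , trans (cong₂ (col φ) p q) (State.run st r r<K))

  ready-clean : ∀ {φ v K c} → Shape v K → Ready φ v K c → ∀ {p q} → CycleEdge v p q → col φ p q ≢ just c
  ready-clean {φ} {v} {K} {c} sh r (i , s) = clean s
    where
    open Ready r
    along : col φ (v i) (v (suc i)) ≢ just c
    along with state-edges sh state i
    ... | inj₁ e = clash e
    ... | inj₂ (_ , inj₁ refl , e) = clash′ a≢c e
    ... | inj₂ (_ , inj₂ refl , e) = clash′ b≢c e
    clean : ∀ {p q} → Same (v i) (v (suc i)) p q → col φ p q ≢ just c
    clean (inj₁ (refl , refl)) = along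
    clean (inj₂ (refl , refl)) = along ∘ flip φ

  rotated-ready : ∀ {φ v K c j d} → d ≢ c → (R : Rotated φ v K c j d) → Ready (Rotated.after R) (λ i → v (i + j)) K c
  rotated-ready d≢c R = record { a≢b = d≢d′ ; a≢c = d≢c ; b≢c = d′≢c ; state = state }
    where open Rotated R

  cycle-edge-+ : ∀ {v K} → Shape v K → ∀ j {p q} → CycleEdge v p q → CycleEdge (λ i → v (i + j)) p q
  -- The shift by `j` is compensated by starting at `i + K * j`, because `K * j + j` is `j` full
  -- turns.
  cycle-edge-+ {v} {K} sh j {p} {q} (i , s) = i + K * j , subst₂ (λ x y → Same x y p q) (eq i) (eq (suc i)) s
    where
    turn : ∀ m i → v i ≡ v (i + m * suc K)
    turn zero i = cong v (sym (ℕ.+-identityʳ i))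
    turn (suc m) i = trans (turn m i) (trans (sym (Shape.per sh (i + m * suc K))) (cong v (begin
      suc K + (i + m * suc K) ≡⟨ sym (ℕ.+-assoc (suc K) i _) ⟩
      suc K + i + m * suc K   ≡⟨ cong (_+ m * suc K) (ℕ.+-comm (suc K) i) ⟩
      i + suc K + m * suc K   ≡⟨ ℕ.+-assoc i (suc K) _ ⟩
      i + (suc K + m * suc K) ∎)))
      where open ≡-Reasoning
    eq : ∀ i → v i ≡ v (i + K * j + j)
    eq i = trans (turn j i) (cong v (begin
      i + j * suc K     ≡⟨ cong (i +_) (trans (ℕ.*-suc j K) (ℕ.+-comm j (j * K))) ⟩
      i + (j * K + j)   ≡⟨ cong (λ t → i + (t + j)) (ℕ.*-comm j K) ⟩
      i + (K * j + j)   ≡⟨ sym (ℕ.+-assoc i (K * j) j) ⟩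
      i + K * j + j     ∎))
      where open ≡-Reasoning

  on-+ : ∀ {v K} → Shape v K → ∀ j {p} → On v p → On (λ i → v (i + j)) p
  on-+ sh j {p} (i , refl) = edge-on (cycle-edge-+ sh j (edge-next sh i))

  ready-unshift : ∀ {φ v K c} j → Shape v K → Ready φ (λ i → v (i + j)) K c → ∀ {p q} → CycleEdge v p q → col φ p q ≢ just c
  ready-unshift j sh r ce = ready-clean (shape-+ j sh) r (cycle-edge-+ sh j ce)

  misses-third-colour : ∀ {φ v K c} → Shape v K → (∀ {p q} → CycleEdge v p q → col φ p q ≢ just c) → ∀ {i} →
                        (∀ {y} → Third v K i y → col φ (v i) y ≢ just c) → Misses φ (v i) c
  misses-third-colour {φ} {v} {K} {c} sh clean {i} h w e with v (suc i) Fin.≟ w | v (K + i) Fin.≟ w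
  ... | yes refl | _ = clean (edge-next sh i) e
  ... | no _ | yes refl = clean (edge-pred sh i) e
  ... | no n | no p = h (third (col-adj φ e) (n ∘ sym) (p ∘ sym)) e

  -- Let `e` be missing at `q`. If `q` is off the cycle and `e` is a cycle colour, the cycle can be
  -- turned so that `v j` misses `e` too. Otherwise both ends miss `c`: the uncoloured edge takes up
  -- the third place at `v j` and, if it is a chord, also at `q`. In each case it could be coloured.
  no-uncoloured-exit : ∀ {φ v K c} → Opt φ → Shape v K → Ready φ v K c → ∀ {j q} →
                       v j ~ q → col φ (v j) q ≡ nothing → ¬ CycleEdge v (v j) q → ⊥
  no-uncoloured-exit {φ} {v} {K} {c} opt sh r {j} {q} vq unc ¬ce
    with missing-colour φ (~-sym vq) (flip φ unc) | on? sh q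
  ... | _ | yes (i , refl) = finish (rotate-to opt sh r j (Ready.a r) (Ready.a≢c r)) λ R →
      misses-third-colour {φ = Rotated.after R} sh (ready-unshift {φ = Rotated.after R} j sh (rotated-ready (Ready.a≢c r) R))
        λ t → clash (trans (cong (col (Rotated.after R) (v i)) (third-unique sh (off-third sh (~-sym vq) (¬ce ∘ edge-sym)) t))
          (trans (off (Rotated.agrees R) (¬ce ∘ edge-sym)) (flip φ unc)))
    where
    finish : Rotated φ v K c j (Ready.a r) → (∀ (R : Rotated φ v K c j (Ready.a r)) → Misses (Rotated.after R) (v i) c) → ⊥
    finish R m = no-augment after opt′ vq (trans (off agrees ¬ce) unc)
      (misses-third-colour {φ = after} sh (ready-unshift {φ = after} j sh (rotated-ready (Ready.a≢c r) R))
        λ t → clash (trans (cong (col after (v j)) (third-unique sh (off-third sh vq ¬ce) t)) (trans (off agrees ¬ce) unc)))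
      (m R)
      where open Rotated R renaming (opt to opt′)
  ... | e , m | no ¬on with e Fin.≟ c
  ...   | no e≢c = no-augment after opt′ vq (trans (off agrees ¬ce) unc) (State.miss₀ state)
             (λ w e → m w (trans (sym (off agrees (¬on ∘ edge-on))) e))
    where open Rotated (rotate-to opt sh r j e e≢c) renaming (opt to opt′)
  ...   | yes refl = no-augment φ opt vq unc
      (misses-third-colour {φ = φ} sh (ready-clean sh r) λ t → clash (trans (cong (col φ (v j)) (third-unique sh (off-third sh vq ¬ce) t)) unc)) m

  -- If the exit had a cycle colour, turning the cycle would make `v j` miss that colour without
  -- recolouring the exit.
  third-colour-exit : ∀ {φ v K c} → Opt φ → Shape v K → Ready φ v K c → ∀ {j y} → Third v K j y → col φ (v j) y ≡ just c
  third-colour-exit {φ} {v} {K} {c} opt sh r {j} {y} t with col φ (v j) y in eq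
  ... | nothing = ⊥-elim (no-uncoloured-exit opt sh r (Third.adjacent t) eq (third-off sh t))
  ... | just e with e Fin.≟ c
  ...   | yes refl = refl
  ...   | no e≢c = ⊥-elim (State.miss₀ state y (trans (off agrees (third-off sh t)) eq))
    where open Rotated (rotate-to opt sh r j e e≢c)

  ready-persist : ∀ {φ ψ v K c} → (∀ {p q} → On v p → On v q → col ψ p q ≡ col φ p q) →
                  (∀ {p d} → On v p → Misses φ p d → Misses ψ p d) → Ready φ v K c → Ready ψ v K c
  ready-persist same keeps r = record
    { a≢b = a≢b ; a≢c = a≢c ; b≢c = b≢c
    ; state = record
      { unc = trans (same (_ , refl) (_ , refl)) unc ; miss₀ = keeps (_ , refl) miss₀ ; miss₁ = keeps (_ , refl) miss₁
      ; run = λ i i<K → trans (same (_ , refl) (_ , refl)) (run i i<K) } }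
    where
    open Ready r
    open State state

  -- Disjoint cycles and independent turning

  Disjoint : (ℕ → V) → (ℕ → V) → Set
  Disjoint v u = ∀ {p} → On v p → ¬ On u p

  -- Sliding the uncoloured edge of `u` along `u` leaves `v` intact until a common vertex is met,
  -- and there it would be an uncoloured exit of `v`.
  disjoint : ∀ {v K c} → Shape v K → ∀ {φ u M a b} → Opt φ → Ready φ v K c → Shape u M → a ≢ b → State φ u M a b →
             ¬ CycleEdge v (u 0) (u 1) → Disjoint v u
  disjoint {v} {K} {c} sh opt r sh′ a≢b st ¬ce on-v (t , refl) = avoids t opt r sh′ a≢b st ¬ce on-v
    where
    avoids : ∀ t {φ u M a b} → Opt φ → Ready φ v K c → Shape u M → a ≢ b → State φ u M a b →
             ¬ CycleEdge v (u 0) (u 1) → ¬ On v (u t)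
    avoids zero {φ} {u} opt r sh′ a≢b st ¬ce (j , e) = no-uncoloured-exit opt sh r
      (subst (_~ u 1) e (Shape.adj sh′ 0)) (trans (cong (λ p → col φ p (u 1)) (sym e)) (State.unc st))
      (¬ce ∘ subst (λ p → CycleEdge v p (u 1)) (sym e))
    avoids (suc t) {φ} {u} {M} {a} {b} opt r sh′ a≢b st ¬ce with step opt a≢b sh′ st
    ... | S , st′ = avoids t (Shift.opt S) r′ (shape-suc sh′) (a≢b ∘ sym) st′ (¬on₁ ∘ edge-on)
      where
      ¬on₀ : ¬ On v (u 0)
      ¬on₀ = avoids zero opt r sh′ a≢b st ¬ce
      ¬on₁ : ¬ On v (u 1)
      ¬on₁ (j , e) = no-uncoloured-exit opt sh r (subst (_~ u 0) e (~-sym (Shape.adj sh′ 0)))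
        (trans (cong (λ p → col φ p (u 0)) (sym e)) (flip φ (State.unc st)))
        (¬ce ∘ edge-sym ∘ subst (λ p → CycleEdge v p (u 0)) (sym e))
      r′ : Ready (Shift.after S) v K c
      r′ = ready-persist
        (λ on-p on-q → Shift.same S (λ { (inj₁ (refl , _)) → ¬on₀ on-p ; (inj₂ (refl , _)) → ¬on₁ on-p })
                                    (λ { (inj₁ (refl , _)) → ¬on₁ on-p ; (inj₂ (_ , refl)) → ¬on₁ on-q }))
        (λ on-p → Shift.keeps S (λ _ → (λ { refl → ¬on₀ on-p }) , (λ { refl → ¬on₁ on-p }))) r

  col-persist : ∀ {u φ ψ p q} → Agrees u φ ψ → ¬ On u p → col ψ p q ≡ col φ p q
  col-persist ag ¬on = off ag (¬on ∘ edge-on)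

  misses-persist : ∀ {u φ ψ p d} → Agrees u φ ψ → ¬ On u p → Misses φ p d → Misses ψ p d
  misses-persist ag ¬on m w e = m w (trans (sym (col-persist ag ¬on)) e)

  cycle-persist : ∀ {u φ ψ v K c} → Agrees u φ ψ → Disjoint v u → Ready φ v K c → Ready ψ v K c
  cycle-persist ag dis = ready-persist (λ on-p _ → col-persist ag (dis on-p)) (λ on-p → misses-persist ag (dis on-p))

  state-persist : ∀ {u φ ψ v K a b} → Agrees u φ ψ → Disjoint v u → State φ v K a b → State ψ v K a b
  state-persist {u} {v = v} ag dis st = record
    { unc = trans (col-persist ag (avoid 0)) unc
    ; miss₀ = misses-persist ag (avoid 0) miss₀ ; miss₁ = misses-persist ag (avoid 1) miss₁
    ; run = λ i i<K → trans (col-persist ag (avoid (suc i))) (run i i<K) }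
    where
    open State st
    avoid : ∀ i → ¬ On u (v i)
    avoid i = dis (i , refl)

  last-colour : ∀ {a b c d : Colour} → a ≢ b → a ≢ c → b ≢ c → d ≢ c → d ≢ b → d ≡ a
  last-colour {a} {b} {c} {d} ab ac bc dc db with only-three-colours a b c d ab ac bc dc
  ... | inj₁ e = e
  ... | inj₂ e = contradiction e db

  record Placed (φ : Colouring) (v : ℕ → V) (K j : ℕ) (d d′ : Colour) : Set where
    field
      {after} : Colouring
      opt     : Opt after
      state   : State after (λ i → v (i + j)) K d d′
      agrees  : Agrees v φ after

  abstract
    place : ∀ {φ v K c} → Opt φ → Shape v K → Ready φ v K c → ∀ j {d d′} → d ≢ d′ → d ≢ c → d′ ≢ c → Placed φ v K j d d′
    place {φ} {v} {K} {c} opt sh r j {d} {d′} dd′ dc d′c = record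
      { opt = opt′ ; agrees = agrees
      ; state = subst (State after _ K d) (last-colour (dd′ ∘ sym) d′c dc d′₁≢c (λ e → d≢d′ (sym e))) state }
      where open Rotated (rotate-to opt sh r j d dc) renaming (opt to opt′; d′≢c to d′₁≢c)

  record Free (φ : Colouring) (v : ℕ → V) (u : V) (d : Colour) : Set where
    field
      {after} : Colouring
      opt     : Opt after
      misses  : Misses after u d
      agrees  : Agrees v φ after

  abstract
    free : ∀ {φ v K c u d} → Opt φ → Shape v K → Ready φ v K c → On v u → d ≢ c → Free φ v u d
    free {d = d} opt sh r (j , refl) dc = record { opt = opt′ ; misses = State.miss₀ state ; agrees = agrees }
      where open Rotated (rotate-to opt sh r j d dc) renaming (opt to opt′)

  off⇒third : ∀ {v K j y} → Shape v K → v j ~ y → ¬ On v y → Third v K j y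
  off⇒third sh a ¬on = off-third sh a (¬on ∘ edge-on ∘ edge-sym)

  exit-colour : ∀ {φ v K c p q} → Opt φ → Shape v K → Ready φ v K c → On v p → ¬ On v q → p ~ q → col φ p q ≡ just c
  exit-colour opt sh r (j , refl) ¬on a = third-colour-exit opt sh r (off⇒third sh a ¬on)

  just-≡ : ∀ {m : Maybe Colour} {c d} → m ≡ just c → m ≡ just d → c ≡ d
  just-≡ p q = Maybe.just-injective (trans (sym p) q)

  -- Cycles with a vertex that has no third neighbour

  module Deficient {φ v K a b c} (opt : Opt φ) (sh : Shape v K) (a≢b : a ≢ b) (a≢c : a ≢ c) (b≢c : b ≢ c)
    (st : State φ v K a b) (no3 : NoThird v K 0) {x} (3x : Third v K 1 x) (¬on-x : ¬ On v x) where

    private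
      placed : Placed φ v K 0 b a
      placed = place opt sh (record { a≢b = a≢b ; a≢c = a≢c ; b≢c = b≢c ; state = st }) 0 (a≢b ∘ sym) b≢c a≢c

      module AtStart (P : Placed φ v K 0 b a) where
        open Placed P public renaming (opt to opt′)

        st′ : State after v K b a
        st′ = state-cong (λ i → cong v (ℕ.+-identityʳ i)) state

        ready′ : Ready after v K c
        ready′ = record { a≢b = a≢b ∘ sym ; a≢c = b≢c ; b≢c = a≢c ; state = st′ }

        misses-c : Misses after (v 0) c
        misses-c = misses-third-colour {φ = after} sh (ready-clean sh ready′) (λ t _ → no3 _ t)

    -- The cycle is turned so that `v 0` misses `b` and `v 1` misses `a`. Having no third neighbour,
    -- `v 0` misses `c` as well, and `no-common-missing` applies to `v 0`, `v 1`, `x`.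
    neighbour-sees : ¬ Misses φ x a
    neighbour-sees m = go placed
      where
      go : Placed φ v K 0 b a → ⊥
      go P = no-common-missing after opt′ (Shape.adj sh 0) (State.unc st′) misses-c
        (third-colour-exit opt′ sh ready′ 3x) (a≢c ∘ sym) (State.miss₁ st′) (misses-persist agrees ¬on-x m)
        where open AtStart P

    neighbour-avoids : ∀ {u M e} → Shape u M → Ready φ u M e → Disjoint v u → Disjoint u v → ¬ On u x →
                       ∀ {y} → col φ x y ≡ just a → ¬ On u y
    neighbour-avoids {u} {M} {e} sh′ r v#u u#v ¬on-u {y} xy on-y = go placed
      where
      e≡a : e ≡ a
      e≡a = just-≡ (exit-colour opt sh′ r on-y ¬on-u (~-sym (col-adj φ xy))) (flip φ xy)
      go : Placed φ v K 0 b a → ⊥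
      go P = finish (free opt′ sh′ (cycle-persist agrees u#v r) on-y (λ c≡e → a≢c (sym (trans c≡e e≡a))))
        where
        open AtStart P
        finish : Free after u y c → ⊥
        finish F = no-common-missing′ (Free.after F) (Free.opt F) (Shape.adj sh 0) (State.unc (state-persist ag v#u st′))
          (misses-persist ag (v#u (0 , refl)) misses-c)
          (trans (col-persist ag (v#u (1 , refl))) (third-colour-exit opt′ sh ready′ 3x)) (a≢c ∘ sym)
          (State.miss₁ (state-persist ag v#u st′))
          (trans (col-persist ag ¬on-u) (trans (col-persist agrees ¬on-x) xy)) (Free.misses F) (λ { refl → v#u (0 , refl) on-y })
          where ag = Free.agrees F

  -- A vertex v j on a cycle whose successor is joined to another cycle

  record Freed (φ : Colouring) (v : ℕ → V) (j : ℕ) (x : V) (c d d′ : Colour) : Set where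
    field
      {after}  : Colouring
      opt      : Opt after
      unc      : col after (v (suc j)) (v j) ≡ nothing
      free₁    : Misses after (v (suc j)) c
      free₀    : Misses after (v j) d
      exit     : col after (v j) x ≡ just c
      keeps    : ∀ {z e} → ¬ On v z → e ≢ d′ → Misses φ z e → Misses after z e
      keeps-col : ∀ {y z} → ¬ On v y → ¬ On v z → col after y z ≡ col φ y z

  -- With the uncoloured edge placed between `v j` and its successor, the exit of the successor is
  -- recoloured from `c` to `d′`, so that the successor misses `c`. Read backwards, the uncoloured
  -- edge and the exit at `v j` then fit `no-common-missing`.
  freed : ∀ {φ v K c} → Opt φ → (sh : Shape v K) → Ready φ v K c → ∀ {j u x} →
    Third v K (suc j) u → ¬ On v u → Third v K j x → ¬ On v x →
    ∀ {d d′} → d ≢ d′ → d ≢ c → d′ ≢ c → Misses φ u d′ → Freed φ v j x c d d′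
  freed {φ} {v} {K} {c} opt sh r {j} {u} {x} 3u ¬on-u 3x ¬on-x {d} {d′} d≢d′ d≢c d′≢c mu = go (place opt sh r j d≢d′ d≢c d′≢c)
    where
    p q : V
    p = v j
    q = v (suc j)
    go : Placed φ v K j d d′ → Freed φ v j x c d d′
    go P = finish (move after opt′ (d′≢c ∘ sym) (trans (off agrees (third-off sh 3u)) (third-colour-exit opt sh r 3u))
                        (State.miss₁ state) (misses-persist agrees ¬on-u mu))
      where
      open Placed P renaming (opt to opt′)
      finish : Move after q u c d′ → Freed φ v j x c d d′
      finish M = record
        { after = Move.after M
        ; opt = Move.opt M
        ; unc = trans (same λ { (inj₁ (_ , p≡u)) → ¬on-u (j , sym p≡u) ; (inj₂ (q≡u , _)) → ¬on-u (suc j , sym q≡u) }) (flip after (State.unc state))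
        ; free₁ = Move.freed M
        ; free₀ = keeps (λ e → contradiction e d≢d′) (State.miss₀ state)
        ; exit = trans (same λ { (inj₁ (p≡q , _)) → ~⇒≢ (Shape.adj sh j) p≡q ; (inj₂ (p≡u , _)) → ¬on-u (j , sym p≡u) })
            (trans (off agrees (third-off sh 3x)) (third-colour-exit opt sh r 3x))
        ; keeps = λ ¬on e≢d′ m → keeps (λ e≡d′ → contradiction e≡d′ e≢d′) (misses-persist agrees ¬on m)
        ; keeps-col = λ ¬on ¬on′ → trans (same λ { (inj₁ (y≡q , _)) → ¬on (suc j , y≡q) ; (inj₂ (_ , z≡q)) → ¬on′ (suc j , z≡q) })
            (col-persist agrees ¬on)
        }
        where open Move M using (same; keeps)

  module Joined {φ v K c w M} (opt : Opt φ) (sh : Shape v K) (r : Ready φ v K c) {j u x}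
    (3u : Third v K (suc j) u) (3x : Third v K j x) (¬on-x : ¬ On v x)
    (sh-w : Shape w M) (r-w : Ready φ w M c) (v#w : Disjoint v w) (w#v : Disjoint w v)
    (on-u : On w u) (¬on-w : ¬ On w x) where

    private
      other : ∀ {d} → d ≢ c → ∃ λ d′ → d ≢ d′ × d′ ≢ c
      other {d} d≢c = let d′ , p , q = third-colour d c d≢c in d′ , p ∘ sym , q

      after-free : ∀ {d d′} → d ≢ d′ → d ≢ c → d′ ≢ c → (F : Free φ w u d′) → Freed (Free.after F) v j x c d d′
      after-free d≢d′ d≢c d′≢c F =
        freed (Free.opt F) sh (cycle-persist (Free.agrees F) v#w r) 3u (w#v on-u) 3x ¬on-x d≢d′ d≢c d′≢c (Free.misses F)

    -- The cycle `w` can be turned until `u` misses the cycle colour of `v` other than `d`, as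
    -- `freed` requires; an `x` missing `d` would then contradict `no-common-missing`.
    exit-sees : ∀ {d} → d ≢ c → ¬ Misses φ x d
    exit-sees {d} d≢c m with other d≢c
    ... | d′ , d≢d′ , d′≢c = go (free opt sh-w r-w on-u d′≢c)
      where
      go : Free φ w u d′ → ⊥
      go F = finish (after-free d≢d′ d≢c d′≢c F)
        where
        finish : Freed (Free.after F) v j x c d d′ → ⊥
        finish E = no-common-missing (Freed.after E) (Freed.opt E) (~-sym (Shape.adj sh j)) (Freed.unc E) (Freed.free₁ E)
          (Freed.exit E) (d≢c ∘ sym) (Freed.free₀ E) (Freed.keeps E ¬on-x d≢d′ (misses-persist (Free.agrees F) ¬on-w m))

    exit-next-sees : ∀ {d} → d ≢ c → ∀ {y} → col φ x y ≡ just d → ¬ On v y → ¬ On w y → ¬ Misses φ y c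
    exit-next-sees {d} d≢c {y} xy ¬on-y ¬on-y′ m with other d≢c
    ... | d′ , d≢d′ , d′≢c = go (free opt sh-w r-w on-u d′≢c)
      where
      go : Free φ w u d′ → ⊥
      go F = finish (after-free d≢d′ d≢c d′≢c F)
        where
        finish : Freed (Free.after F) v j x c d d′ → ⊥
        finish E = no-common-missing′ (Freed.after E) (Freed.opt E) (~-sym (Shape.adj sh j)) (Freed.unc E) (Freed.free₁ E)
          (Freed.exit E) (d≢c ∘ sym) (Freed.free₀ E)
          (trans (Freed.keeps-col E ¬on-x ¬on-y) (trans (col-persist (Free.agrees F) ¬on-w) xy))
          (Freed.keeps E ¬on-y (d′≢c ∘ sym) (misses-persist (Free.agrees F) ¬on-y′ m)) (λ q≡y → ¬on-y (suc j , sym q≡y))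

  module JoinedAndOff {φ v K c w M} (opt : Opt φ) (sh : Shape v K) (r : Ready φ v K c) {j u x}
    (3u : Third v K (suc j) u) (3x : Third v K j x) (¬on-x : ¬ On v x)
    (sh-w : Shape w M) (r-w : Ready φ w M c) (v#w : Disjoint v w) (w#v : Disjoint w v)
    (on-u : On w u) (¬on-w : ¬ On w x)
    {t L e} (sh-t : Shape t L) (r-t : Ready φ t L e)
    (v#t : Disjoint v t) (t#v : Disjoint t v) (w#t : Disjoint w t) (t#w : Disjoint t w) where

    private
      jx : v j ~ x
      jx = Third.adjacent 3x

    -- If `x` were on `t`, the exit from `v j` would also be an exit of `t`, so `t` would use the
    -- same two colours as `v`. Turning `t` would make `x` miss one of them, against `exit-sees`.
    exit-off : ¬ On t x
    exit-off on-t = go (free opt sh-t r-t on-t (λ d≡e → Ready.a≢c r (trans d≡e e≡c)))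
      where
      e≡c : e ≡ c
      e≡c = just-≡ (exit-colour opt sh-t r-t on-t (v#t (j , refl)) (~-sym jx)) (flip φ (third-colour-exit opt sh r 3x))
      go : Free φ t x (Ready.a r) → ⊥
      go F = Joined.exit-sees (Free.opt F) sh (cycle-persist ag v#t r) 3u 3x ¬on-x sh-w (cycle-persist ag w#t r-w) v#w w#v on-u ¬on-w
               (Ready.a≢c r) (Free.misses F)
        where ag = Free.agrees F

    -- The edge of colour `c` at `x` ends in `v j`, so `x y` has another colour. If it led to `t`,
    -- then `c` would be a colour of `t`, and turning `t` would make `y` miss it, against
    -- `exit-next-sees`.
    exit-next-off : ∀ {y} → x ~ y → y ≢ v j → ¬ On t y
    exit-next-off {y} x~y y≢ on-t = go (free opt sh-t r-t on-t (e≢c ∘ sym))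
      where
      xy : col φ x y ≡ just e
      xy = flip φ (exit-colour opt sh-t r-t on-t exit-off (~-sym x~y))
      e≢c : e ≢ c
      e≢c refl = y≢ (col-proper φ xy (flip φ (third-colour-exit opt sh r 3x)))
      go : Free φ t y c → ⊥
      go F = Joined.exit-next-sees (Free.opt F) sh (cycle-persist ag v#t r) 3u 3x ¬on-x sh-w (cycle-persist ag w#t r-w) v#w w#v on-u ¬on-w
               e≢c (trans (col-persist ag exit-off) xy) (t#v on-t) (t#w on-t) (Free.misses F)
        where ag = Free.agrees F

  -- Two consecutive vertices joined to other cycles

  no-two-free : ∀ {φ v K c} → Opt φ → Shape v K → Ready φ v K c → ∀ {j u u′} →
    Third v K (1 + j) u → Third v K (2 + j) u′ → ¬ On v u → ¬ On v u′ →
    ∀ {a b} → a ≢ b → a ≢ c → b ≢ c → Misses φ u a → Misses φ u′ b → ⊥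
  no-two-free {φ} {v} {K} {c} opt sh r {j} {u} {u′} 3u 3u′ ¬on ¬on′ {a} {b} a≢b a≢c b≢c mu mu′ =
    go (place opt sh r j (a≢b ∘ sym) b≢c a≢c)
    where
    go : Placed φ v K j b a → ⊥
    go P = no-two-exits after opt′ (Shape.adj sh j) (State.unc state) (State.miss₀ state) (State.miss₁ state)
      (State.run state 0 (ℕ.<-trans (s≤s z≤n) (1<K sh)))
      (trans (off agrees (third-off sh 3u)) (third-colour-exit opt sh r 3u)) (misses-persist agrees ¬on mu)
      (trans (off agrees (third-off sh 3u′)) (third-colour-exit opt sh r 3u′)) (misses-persist agrees ¬on′ mu′)
      (a≢c ∘ sym) (b≢c ∘ sym) (λ p≡u′ → ¬on′ (j , sym p≡u′))
      where open Placed P renaming (opt to opt′)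

  module ConsecutiveExits {φ v K c w M e} (opt : Opt φ) (sh : Shape v K) (r : Ready φ v K c)
    (sh-w : Shape w M) (r-w : Ready φ w M e) (v#w : Disjoint v w) (w#v : Disjoint w v)
    {j u u′} (3u : Third v K (1 + j) u) (3u′ : Third v K (2 + j) u′) (on-u : On w u) where

    private
      open Ready r
      join-colour : ∀ {w M e i y} → Third v K i y → Shape w M → Ready φ w M e → Disjoint v w → On w y → e ≡ c
      join-colour 3y sh-w r-w v#w on-y = just-≡ (exit-colour opt sh-w r-w on-y (v#w (_ , refl)) (~-sym (Third.adjacent 3y)))
        (flip φ (third-colour-exit opt sh r 3y))
      e≡c : e ≡ c
      e≡c = join-colour 3u sh-w r-w v#w on-u

    -- Two different cycles could be turned independently, making `u` miss `a` and `u′` miss `b`.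
    exits-to-same-cycle : ∀ {t L e′} → Shape t L → Ready φ t L e′ → Disjoint v t → Disjoint t v → Disjoint w t → Disjoint t w → ¬ On t u′
    exits-to-same-cycle {t} {L} {e′} sh-t r-t v#t t#v w#t t#w on-t = go (free opt sh-w r-w on-u (a≢c ∘ λ p → trans p e≡c))
      where
      e′≡c : e′ ≡ c
      e′≡c = join-colour 3u′ sh-t r-t v#t on-t
      go : Free φ w u a → ⊥
      go F = finish (free (Free.opt F) sh-t (cycle-persist (Free.agrees F) t#w r-t) on-t (b≢c ∘ λ p → trans p e′≡c))
        where
        finish : Free (Free.after F) t u′ b → ⊥
        finish F′ = no-two-free (Free.opt F′) sh (cycle-persist (Free.agrees F′) v#t (cycle-persist (Free.agrees F) v#w r))
          3u 3u′ (w#v on-u) (t#v on-t) a≢b a≢c b≢c (misses-persist (Free.agrees F′) (w#t on-u) (Free.misses F)) (Free.misses F′)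

    -- The uncoloured edge of `w` could be placed between the two exits, whose missing colours would
    -- then be `a` and `b` in the order that `no-two-free` forbids.
    exits-not-consecutive : ∀ l → (u ≡ w l × u′ ≡ w (suc l)) ⊎ (u ≡ w (suc l) × u′ ≡ w l) → ⊥
    exits-not-consecutive l (inj₁ (refl , refl)) = go (place opt sh-w r-w l a≢b (a≢c ∘ λ p → trans p e≡c) (b≢c ∘ λ p → trans p e≡c))
      where
      go : Placed φ w M l a b → ⊥
      go P = no-two-free (Placed.opt P) sh (cycle-persist (Placed.agrees P) v#w r) 3u 3u′ (w#v (l , refl)) (w#v (suc l , refl))
        a≢b a≢c b≢c (State.miss₀ (Placed.state P)) (State.miss₁ (Placed.state P))
    exits-not-consecutive l (inj₂ (refl , refl)) = go (place opt sh-w r-w l (a≢b ∘ sym) (b≢c ∘ λ p → trans p e≡c) (a≢c ∘ λ p → trans p e≡c))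
      where
      go : Placed φ w M l b a → ⊥
      go P = no-two-free (Placed.opt P) sh (cycle-persist (Placed.agrees P) v#w r) 3u 3u′ (w#v (suc l , refl)) (w#v (l , refl))
        a≢b a≢c b≢c (State.miss₁ (Placed.state P)) (State.miss₀ (Placed.state P))

-- Cycle lengths and the odd girth

module OddGirth {n : ℕ} (G : Graph n) (nb3 : ThreeNeighbours G) (N : ℕ)
  (bound : ∀ φ → Colourings.size G φ ≤ N)
  (g : ℕ) (g-least : ∀ k → HasOddCycleOfLength G k → g ≤ k) where

  open Optimum G nb3 N bound public
  open Walks G public

  g≤odd-walk : ∀ {u ℓ} → Odd ℓ → Walk u u ℓ → g ≤ ℓ
  g≤odd-walk odd p = let k , k≤ℓ , c = odd-closed-walk⇒cycle odd p in ℕ.≤-trans (g-least k c) k≤ℓ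

  along : ∀ {v K} → Shape v K → ∀ i d → Walk (v i) (v (d + i)) d
  along sh i zero = []
  along {v} sh i (suc d) = Shape.adj sh i ∷ subst (λ k → Walk (v (suc i)) (v k) d) (ℕ.+-suc d i) (along sh (suc i) d)

  length-odd : ∀ {v K} → Shape v K → Odd (suc K)
  length-odd sh = suc (Shape.half sh) , cong suc (Shape.even sh)

  g≤length : ∀ {v K} → Shape v K → g ≤ suc K
  g≤length {v} {K} sh = g≤odd-walk (length-odd sh)
    (subst (λ x → Walk (v 0) x (suc K)) (Shape.per sh 0) (along sh 0 (suc K)))

  position-from : ∀ {v K} → Shape v K → ∀ j {y} → On v y → ∃ λ d → d ≤ K × y ≡ v (d + j)
  position-from {v} {K} sh j on-y with on-+ sh j on-y
  ... | i , e = i % suc K , ℕ.≤-pred (m%n<n i (suc K)) , trans e (v-mod (shape-+ j sh) i)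

  back : ∀ {v K} → Shape v K → ∀ j {d} → d ≤ K → Walk (v (d + j)) (v j) (suc K ∸ d)
  back {v} {K} sh j {d} d≤K = subst (λ x → Walk (v (d + j)) x (suc K ∸ d))
    (trans (cong v (trans (sym (ℕ.+-assoc (suc K ∸ d) d j)) (cong (_+ j) (ℕ.m∸n+n≡m (ℕ.m≤n⇒m≤1+n d≤K))))) (Shape.per sh j))
    (along sh (d + j) (suc K ∸ d))

  -- A chord of an odd cycle closes an odd cycle with one of the two arcs.
  chordless : ∀ {v K} → Shape v K → suc K ≤ g → ∀ {j y} → Third v K j y → ¬ On v y
  chordless {v} {K} sh L≤g {j} {y} (third a n p) on-y with position-from sh j on-y
  ... | d , d≤K , refl with even⊎odd d
  ...   | inj₁ (h , refl) with ℕ.m≤n⇒m<n∨m≡n d≤K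
  ...     | inj₂ refl = p refl
  ...     | inj₁ d<K = ℕ.<⇒≱ d<K (ℕ.≤-pred (ℕ.≤-trans L≤g (g≤odd-walk (h , refl) (~-sym a ∷ along sh j (h * 2)))))
  chordless {v} {K} sh L≤g {j} {y} (third a n p) on-y | d , d≤K , refl | inj₂ (zero , refl) = n refl
  chordless {v} {K} sh L≤g {j} {y} (third a n p) on-y | d , d≤K , refl | inj₂ (suc h , refl) =
    ℕ.<⇒≱ (s≤s (ℕ.∸-monoʳ-< {o = 0} (s≤s z≤n) d≤L))
      (ℕ.≤-trans L≤g (g≤odd-walk odd (a ∷ back sh j d≤K)))
    where
    d≤L : suc h * 2 ≤ K
    d≤L = ℕ.≤-trans (ℕ.n≤1+n _) d≤K
    odd : Odd (suc (suc K ∸ d))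
    odd with odd+odd {b = suc K ∸ d} (suc h , refl) (subst Odd (sym (ℕ.m+[n∸m]≡n (ℕ.m≤n⇒m≤1+n d≤K))) (length-odd sh))
    ... | k , e = k , cong suc e

  -- Systems of disjoint cycles

  record System (φ : Colouring) (s : ℕ) : Set where
    field
      v     : Fin s → ℕ → V
      K     : Fin s → ℕ
      c     : Fin s → Colour
      shape : ∀ i → Shape (v i) (K i)
      ready : ∀ i → Ready φ (v i) (K i) (c i)
      disj  : ∀ {i k} → i ≢ k → Disjoint (v i) (v k)

  uncoloured-cycle-edge : ∀ {φ v K a b} → Shape v K → State φ v K a b → ∀ {p q} → CycleEdge v p q → col φ p q ≡ nothing → Same (v 0) (v 1) p q
  uncoloured-cycle-edge {φ} {v} {K} sh st (i , s) unc
    with i % suc K | m%n<n i (suc K) | v-mod sh i | translate sh 1 {i} {i % suc K} (v-mod sh i)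
  ... | zero  | _ | p | q = subst₂ (λ x y → Same x y _ _) p q s
  ... | suc r | s≤s r<K | p | q = contradiction coloured (clash (uncoloured s unc))
    where
    uncoloured : ∀ {x y} → Same (v i) (v (suc i)) x y → col φ x y ≡ nothing → col φ (v i) (v (suc i)) ≡ nothing
    uncoloured (inj₁ (refl , refl)) e = e
    uncoloured (inj₂ (refl , refl)) e = flip φ e
    coloured : col φ (v i) (v (suc i)) ≡ just _
    coloured = trans (cong₂ (col φ) p q) (State.run st r r<K)

  record Ring (φ : Colouring) (x y : V) : Set where
    field
      {v}   : ℕ → V
      {K}   : ℕ
      {c}   : Colour
      shape : Shape v K
      ready : Ready φ v K c
      start : v 0 ≡ x
      next  : v 1 ≡ y

  abstract
    ring : ∀ {φ} → Opt φ → ∀ {x y} → x ~ y → col φ x y ≡ nothing → Ring φ x y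
    ring {φ} opt {x} {y} x~y unc with missing-colour φ x~y unc | missing-colour φ (~-sym x~y) (flip φ unc)
    ... | a , mx | b , my with Trail.cycle φ opt x~y unc mx my | third-colour a b (Trail.a≢b φ opt x~y unc mx my)
    ...   | v , K , sh , st , e₀ , e₁ | c , c≢a , c≢b = record
      { shape = sh ; start = e₀ ; next = e₁
      ; ready = record { a≢b = Trail.a≢b φ opt x~y unc mx my ; a≢c = c≢a ∘ sym ; b≢c = c≢b ∘ sym ; state = st } }

  -- A cycle contains no uncoloured edge besides the one it was built from, so different uncoloured
  -- edges satisfy the hypothesis of `disjoint`.
  initial : ∀ {φ} → Opt φ → System φ (length (uncolouredEdges φ))
  initial {φ} opt = record
    { v = λ i → Ring.v (rings i) ; K = λ i → Ring.K (rings i) ; c = λ i → Ring.c (rings i)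
    ; shape = λ i → Ring.shape (rings i) ; ready = λ i → Ring.ready (rings i)
    ; disj = λ {i} {k} → disj′ i k }
    where
    edge : Fin (length (uncolouredEdges φ)) → V × V
    edge = lookup (uncolouredEdges φ)
    valid : ∀ i → Uncoloured φ (edge i)
    valid i = proj₂ (∈-filter⁻ (uncoloured? φ) {xs = pairs} (∈-lookup {xs = uncolouredEdges φ} i))
    rings : ∀ i → Ring φ (proj₁ (edge i)) (proj₂ (edge i))
    rings i = let _ , x~y , unc = valid i in ring opt x~y unc
    same⇒≡ : ∀ {p q : V × V} → proj₁ p Fin.< proj₂ p → proj₁ q Fin.< proj₂ q → Same (proj₁ p) (proj₂ p) (proj₁ q) (proj₂ q) → q ≡ p
    same⇒≡ _ _ (inj₁ (refl , refl)) = refl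
    same⇒≡ lt gt (inj₂ (refl , refl)) = contradiction gt (ℕ.<-asym lt)
    disj′ : ∀ i k → i ≢ k → Disjoint (Ring.v (rings i)) (Ring.v (rings k))
    disj′ i k i≢k = go (rings i) (rings k)
      where
      go : (R : Ring φ (proj₁ (edge i)) (proj₂ (edge i))) (R′ : Ring φ (proj₁ (edge k)) (proj₂ (edge k))) → Disjoint (Ring.v R) (Ring.v R′)
      go R R′ = disjoint R.shape opt R.ready R′.shape (Ready.a≢b R′.ready) (Ready.state R′.ready) not-edge
        where
        module R = Ring R
        module R′ = Ring R′
        not-edge : ¬ CycleEdge R.v (R′.v 0) (R′.v 1)
        not-edge ce = i≢k (sym (lookup-injective (Unique.filter⁺ (uncoloured? φ) pairs-unique)
          (same⇒≡ (proj₁ (valid i)) (proj₁ (valid k))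
            (subst₂ (λ x y → Same (proj₁ (edge i)) (proj₂ (edge i)) x y) R′.start R′.next
              (subst₂ (λ x y → Same x y (R′.v 0) (R′.v 1)) R.start R.next
                (uncoloured-cycle-edge R.shape (Ready.state R.ready) ce (State.unc (Ready.state R′.ready))))))))

  Full : (ℕ → V) → ℕ → Set
  Full v K = ∀ j → ∃ (Third v K j)

  -- A vertex of degree 2, if there is one, sits at position 0, an end of the uncoloured edge,
  -- because a second cycle is to start there.
  Kind : (ℕ → V) → ℕ → Set
  Kind v K = Full v K ⊎ NoThird v K 0

  third-cong : ∀ {v w K i j y} → (v i ≡ w j) → (v (suc i) ≡ w (suc j)) → (v (K + i) ≡ w (K + j)) → Third v K i y → Third w K j y
  third-cong e₀ e₁ e₂ (third a n p) = third (subst (_~ _) e₀ a) (n ∘ λ q → trans q (sym e₁)) (p ∘ λ q → trans q (sym e₂))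

  third-mod : ∀ {v K} → Shape v K → ∀ {i j y} → v i ≡ v j → Third v K i y → Third v K j y
  third-mod sh {i} {j} e = third-cong e (translate sh 1 {i} {j} e) (translate sh _ {i} {j} e)

  full? : ∀ {v K} → Shape v K → Full v K ⊎ ∃ λ j → NoThird v K j
  full? {v} {K} sh with Fin.any? (λ (i : Fin (suc K)) → ¬? (third? v K (toℕ i)))
  ... | yes (i , ¬t) = inj₂ (toℕ i , λ y t → ¬t (y , t))
  ... | no all = inj₁ λ j → let y , t = decidable-stable (third? v K (toℕ (fromℕ< (m%n<n j (suc K))))) (λ ¬t → all (_ , ¬t)) in
      y , third-mod sh (trans (cong v (Fin.toℕ-fromℕ< (m%n<n j (suc K)))) (sym (v-mod sh j))) t

  kind-cong : ∀ {v w K} → (∀ i → v i ≡ w i) → Kind v K → Kind w K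
  kind-cong eq (inj₁ f) = inj₁ λ j → let y , t = f j in y , third-cong (eq _) (eq _) (eq _) t
  kind-cong eq (inj₂ f) = inj₂ λ y t → f y (third-cong (sym (eq _)) (sym (eq _)) (sym (eq _)) t)

  record Normal (s : ℕ) : Set where
    field
      {φ}    : Colouring
      opt    : Opt φ
      system : System φ s
    open System system public
    field
      kind   : ∀ i → Kind (v i) (K i)

  record SemiNormal (s m : ℕ) : Set where
    field
      {φ}    : Colouring
      opt    : Opt φ
      system : System φ s
    open System system public
    field
      kind   : ∀ i → toℕ i < m → Kind (v i) (K i)

  -- Every cycle with a vertex of degree 2 can be rotated to start there.
  normalise-next : ∀ {s m} → m < s → SemiNormal s m → SemiNormal s (suc m)
  normalise-next {s} {m} m<s S = by-kind (full? (shape k))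
    where
    open SemiNormal S
    k : Fin s
    k = fromℕ< m<s
    earlier : ∀ i → i ≢ k → toℕ i < suc m → toℕ i < m
    earlier i i≢k (s≤s i≤m) = ℕ.≤∧≢⇒< i≤m λ e → i≢k (Fin.toℕ-injective (trans e (sym (Fin.toℕ-fromℕ< m<s))))
    by-kind : Full (v k) (K k) ⊎ (∃ λ j → NoThird (v k) (K k) j) → SemiNormal s (suc m)
    by-kind (inj₁ full) = record { opt = opt ; system = system ; kind = kind′ }
      where
      kind′ : ∀ i → toℕ i < suc m → Kind (v i) (K i)
      kind′ i lt with i Fin.≟ k
      ... | yes refl = inj₁ full
      ... | no i≢k   = kind i (earlier i i≢k lt)
    by-kind (inj₂ (j , none)) = go (rotate-to opt (shape k) (ready k) j (Ready.a (ready k)) (Ready.a≢c (ready k)))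
      where
      offset : Fin s → ℕ
      offset i with i Fin.≟ k
      ... | yes _ = j
      ... | no _  = 0
      v′ : Fin s → ℕ → V
      v′ i t = v i (t + offset i)
      kind′ : ∀ i → toℕ i < suc m → Kind (v′ i) (K i)
      kind′ i lt with i Fin.≟ k
      ... | yes refl = inj₂ λ y t → none y (third-cong refl refl (cong (λ t → v k (t + j)) (ℕ.+-identityʳ (K k))) t)
      ... | no i≢k   = kind-cong (λ t → cong (v i) (sym (ℕ.+-identityʳ t))) (kind i (earlier i i≢k lt))
      go : Rotated φ (v k) (K k) (c k) j (Ready.a (ready k)) → SemiNormal s (suc m)
      go R = record
        { φ = after ; opt = opt′ ; kind = kind′
        ; system = record { v = v′ ; K = K ; c = c
          ; shape = λ i → shape-+ (offset i) (shape i) ; ready = ready′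
          ; disj = λ i≢k (t , e) (t′ , e′) → disj i≢k (_ , e) (_ , e′) } }
        where
        open Rotated R using (after; agrees) renaming (opt to opt′)
        ready′ : ∀ i → Ready after (v′ i) (K i) (c i)
        ready′ i with i Fin.≟ k
        ... | yes refl = rotated-ready (Ready.a≢c (ready k)) R
        ... | no i≢k   = record { a≢b = a≢b ; a≢c = a≢c ; b≢c = b≢c
              ; state = state-cong (λ t → cong (v i) (sym (ℕ.+-identityʳ t))) state }
          where open Ready (cycle-persist agrees (disj i≢k) (ready i))

  normalise : ∀ {s} m → m ≤ s → SemiNormal s 0 → SemiNormal s m
  normalise zero    m≤s S = S
  normalise (suc m) m<s S = normalise-next m<s (normalise m (ℕ.<⇒≤ m<s) S)

  abstract
    normal : ∀ {φ} → Opt φ → Normal (length (uncolouredEdges φ))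
    normal {φ} opt = record { opt = S.opt ; system = S.system ; kind = λ i → S.kind i (Fin.toℕ<n i) }
      where
      unnormalised : SemiNormal (length (uncolouredEdges φ)) 0
      unnormalised = record { opt = opt ; system = initial opt ; kind = λ _ () }
      module S = SemiNormal (normalise (length (uncolouredEdges φ)) ℕ.≤-refl unnormalised)

-- Charging darts to cycles

module Charging {n : ℕ} (G : Graph n) (nb3 : ThreeNeighbours G) (N : ℕ)
  (bound : ∀ φ → Colourings.size G φ ≤ N)
  (g : ℕ) (g-least : ∀ k → HasOddCycleOfLength G k → g ≤ k)
  (s : ℕ) (normal-form : OddGirth.Normal G nb3 N bound g g-least s) where

  open OddGirth G nb3 N bound g g-least
  open Normal normal-form

  L : Fin s → ℕ
  L i = suc (K i)

  FullAt : Fin s → Set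
  FullAt i = Full (v i) (K i)

  fullAt? : ∀ i → Dec (FullAt i)
  fullAt? i with kind i
  ... | inj₁ full = yes full
  ... | inj₂ none = no λ full → let y , t = full 0 in none y t

  -- The second cycle through the uncoloured edge at a vertex of degree 2

  record Second (i : Fin s) : Set where
    field
      {a b}  : Colour
      a≢b    : a ≢ b
      a≢c    : a ≢ c i
      b≢c    : b ≢ c i
      state₁ : State φ (v i) (K i) a b
      {u}    : ℕ → V
      {M}    : ℕ
      shape₂ : Shape u M
      state₂ : State φ u M (c i) b
      start₂ : u 0 ≡ v i 0
      next₂  : u 1 ≡ v i 1

  second-ready : ∀ {i} (S : Second i) → Ready φ (Second.u S) (Second.M S) (Second.a S)
  second-ready S = record { a≢b = b≢c ∘ sym ; a≢c = a≢c ∘ sym ; b≢c = a≢b ∘ sym ; state = state₂ }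
    where open Second S

  abstract
    -- The vertex `v i 0` has no third neighbour and thus misses `c i` besides a cycle colour. So
    -- the Kempe chain can be built with `c i` and `b` as well.
    second : ∀ i → NoThird (v i) (K i) 0 → Second i
    second i none = record
        { a≢b = a≢b ; a≢c = a≢c ; b≢c = b≢c ; state₁ = state
        ; shape₂ = proj₁ (proj₂ (proj₂ cyc)) ; state₂ = proj₁ (proj₂ (proj₂ (proj₂ cyc)))
        ; start₂ = proj₁ (proj₂ (proj₂ (proj₂ (proj₂ cyc)))) ; next₂ = proj₂ (proj₂ (proj₂ (proj₂ (proj₂ cyc)))) }
      where
      open Ready (ready i)
      cyc : ∃₂ λ u M → Shape u M × State φ u M (c i) b × u 0 ≡ v i 0 × u 1 ≡ v i 1
      cyc = Trail.cycle φ opt (Shape.adj (shape i) 0) (State.unc state)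
        (misses-third-colour {φ = φ} (shape i) (ready-clean (shape i) (ready i)) (λ t _ → none _ t)) (State.miss₁ state)

  on-second : ∀ i → Kind (v i) (K i) → V → Set
  on-second i (inj₁ _)    t = ⊥
  on-second i (inj₂ none) t = On (Second.u (second i none)) t

  OnSecond : Fin s → V → Set
  OnSecond i = on-second i (kind i)

  second-disjoint : ∀ {i k} → i ≢ k → (S : Second k) → Disjoint (v i) (Second.u S)
  second-disjoint {i} {k} i≢k S = disjoint (shape i) opt (ready i) shape₂ (b≢c ∘ sym) state₂
    (λ ce → disj i≢k (edge-on (subst (λ x → CycleEdge (v i) x (u 1)) start₂ ce)) (0 , refl))
    where open Second S

  seconds-disjoint : ∀ {i k} → i ≢ k → (S : Second i) (S′ : Second k) → Disjoint (Second.u S) (Second.u S′)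
  seconds-disjoint {i} {k} i≢k S S′ = disjoint (Second.shape₂ S) opt (second-ready S) shape₂ (b≢c ∘ sym) state₂
    (λ ce → second-disjoint (i≢k ∘ sym) S (0 , refl) (edge-on (subst (λ x → CycleEdge (Second.u S) x (u 1)) start₂ ce)))
    where open Second S′

  OnSecond-disjoint : ∀ {i k t} → i ≢ k → OnSecond i t → ¬ OnSecond k t
  OnSecond-disjoint {i} {k} i≢k on-s on-s′ with kind i | kind k
  ... | inj₂ none | inj₂ none′ = seconds-disjoint i≢k (second i none) (second k none′) on-s on-s′

  -- Darts and their owners

  Dart : Set
  Dart = V × V

  -- A dart between two cycles is charged to the cycle of its tail, unless the latter
  -- has a vertex of degree 2: that cycle gets the darts of a second cycle instead.
  data Owned (i : Fin s) : Dart → Set where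
    own : ∀ {t h} → On (v i) t → FullAt i ⊎ (∀ k → k ≢ i → ¬ On (v k) h) → Owned i (t , h)
    into : ∀ {t h} → On (v i) h → ¬ On (v i) t → (∀ k → FullAt k → ¬ On (v k) t) → Owned i (t , h)
    along-second : ∀ {t h} → OnSecond i t → (∀ k → ¬ On (v k) t) → (∀ k → k ≢ i → ¬ On (v k) h) → Owned i (t , h)
    private-exit : ∀ {t h y} → (∀ k → ¬ On (v k) t) → (∀ k → k ≢ i → ¬ OnSecond k t) → t ~ y → On (v i) y →
                   (∀ k → k ≢ i → ∀ {z} → t ~ z → ¬ On (v k) z) → Owned i (t , h)

  -- The side conditions of each constructor exclude the claims of other cycles. Adjacency matters
  -- for `private-exit` against `into`, where the head is one of the neighbours barred from other
  -- cycles.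
  owner-unique : ∀ {i k t h} → t ~ h → Owned i (t , h) → Owned k (t , h) → i ≡ k
  owner-unique {i} {k} t~h o o′ with i Fin.≟ k
  ... | yes e = e
  ... | no i≢k = ⊥-elim (clash-of o o′)
    where
    k≢i : k ≢ i
    k≢i = i≢k ∘ sym
    clash-of : Owned i _ → Owned k _ → ⊥
    clash-of (own p _) (own q _) = disj i≢k p q
    clash-of (own p (inj₁ full)) (into _ _ off) = off i full p
    clash-of (own p (inj₂ f)) (into q _ _) = f k k≢i q
    clash-of (own p _) (along-second _ off _) = off i p
    clash-of (own p _) (private-exit off _ _ _ _) = off i p
    clash-of (into _ _ off) (own p (inj₁ full)) = off k full p
    clash-of (into q _ _) (own p (inj₂ f)) = f i i≢k q
    clash-of (into p _ _) (into q _ _) = disj i≢k p q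
    clash-of (into p _ _) (along-second _ _ f) = f i i≢k p
    clash-of (into p _ _) (private-exit _ _ _ _ f) = f i i≢k t~h p
    clash-of (along-second _ off _) (own p _) = off k p
    clash-of (along-second _ _ f) (into p _ _) = f k k≢i p
    clash-of (along-second p _ _) (along-second q _ _) = OnSecond-disjoint i≢k p q
    clash-of (along-second p _ _) (private-exit _ f _ _ _) = f i i≢k p
    clash-of (private-exit off _ _ _ _) (own p _) = off k p
    clash-of (private-exit _ _ _ _ f) (into p _ _) = f k k≢i t~h p
    clash-of (private-exit _ f _ _ _) (along-second p _ _) = f k k≢i p
    clash-of (private-exit _ _ t~y p _) (private-exit _ _ _ _ f) = f i i≢k t~y p

  record Charge (i : Fin s) : Set where
    field
      list   : List Dart
      unique : Unique list
      adj    : ∀ {t h} → (t , h) ∈ list → t ~ h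
      owned  : ∀ {t h} → (t , h) ∈ list → Owned i (t , h)

  abstract
    darts : (ℕ → V) → (ℕ → V) → ℕ → List Dart
    darts t h m = tabulate {n = m} λ p → t (toℕ p) , h (toℕ p)

    length-darts : ∀ t h m → length (darts t h m) ≡ m
    length-darts t h m = List.length-tabulate {n = m} λ p → t (toℕ p) , h (toℕ p)

    ∈-darts⁻ : ∀ {t h m x} → x ∈ darts t h m → ∃ λ p → p < m × x ≡ (t p , h p)
    ∈-darts⁻ x∈ = let p , e = ∈-tabulate⁻ x∈ in toℕ p , Fin.toℕ<n p , e

    unique-darts : ∀ {t h m} → (∀ {p q} → p < q → q < m → t p ≢ t q) → Unique (darts t h m)
    unique-darts {t} {h} {m} dis = Unique.tabulate⁺ inj
      where
      inj : ∀ {p q : Fin m} → (t (toℕ p) , h (toℕ p)) ≡ (t (toℕ q) , h (toℕ q)) → p ≡ q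
      inj {p} {q} e with Fin.<-cmp p q
      ... | tri< lt _ _ = contradiction (cong proj₁ e) (dis lt (Fin.toℕ<n q))
      ... | tri≈ _ eq _ = eq
      ... | tri> _ _ gt = contradiction (sym (cong proj₁ e)) (dis gt (Fin.toℕ<n p))

  shape-distinct : ∀ {v K} → Shape v K → ∀ {p q} → p < q → q < suc K → v p ≢ v q
  shape-distinct sh p<q q<L = distinct sh p<q (ℕ.≤-trans (ℕ.≤-pred q<L) (ℕ.m≤m+n _ _))

  cycle-darts : Fin s → List Dart
  cycle-darts i = darts (v i) (v i ∘ suc) (L i) ++ darts (v i) (λ p → v i (K i + p)) (L i)

  length-cycle-darts : ∀ i → length (cycle-darts i) ≡ L i + L i
  length-cycle-darts i = trans (List.length-++ (darts (v i) (v i ∘ suc) (L i)))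
    (cong₂ _+_ (length-darts _ _ (L i)) (length-darts _ _ (L i)))

  ∈-cycle-darts⁻ : ∀ {i t h} → (t , h) ∈ cycle-darts i → ∃ λ p → t ≡ v i p × p < L i × (h ≡ v i (suc p) ⊎ h ≡ v i (K i + p))
  ∈-cycle-darts⁻ {i} x∈ with ∈-++⁻ (darts (v i) (v i ∘ suc) (L i)) x∈
  ... | inj₁ q with ∈-darts⁻ {v i} {v i ∘ suc} q
  ...   | p , lt , refl = p , refl , lt , inj₁ refl
  ∈-cycle-darts⁻ {i} x∈ | inj₂ q with ∈-darts⁻ {v i} {λ p → v i (K i + p)} q
  ...   | p , lt , refl = p , refl , lt , inj₂ refl

  cycle-darts-edge : ∀ {i t h} → (t , h) ∈ cycle-darts i → CycleEdge (v i) t h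
  cycle-darts-edge {i} x∈ with ∈-cycle-darts⁻ {i} x∈
  ... | p , refl , _ , inj₁ refl = edge-next (shape i) p
  ... | p , refl , _ , inj₂ refl = edge-pred (shape i) p

  unique-cycle-darts : ∀ i → Unique (cycle-darts i)
  unique-cycle-darts i = Unique.++⁺ (unique-darts (shape-distinct (shape i))) (unique-darts (shape-distinct (shape i)))
    λ (x∈ , y∈) → apart (∈-darts⁻ {v i} {v i ∘ suc} x∈) (∈-darts⁻ {v i} {λ p → v i (K i + p)} y∈)
    where
    apart : ∀ {x} → (∃ λ p → p < L i × x ≡ (v i p , v i (suc p))) → (∃ λ p → p < L i × x ≡ (v i p , v i (K i + p))) → ⊥
    apart (p , _ , refl) (q , _ , e) = next≢pred (shape i) p
      (trans (cong proj₂ e) (sym (translate (shape i) (K i) {p} {q} (cong proj₁ e))))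

  edge-adj : ∀ {v K t h} → Shape v K → CycleEdge v t h → t ~ h
  edge-adj sh (i , inj₁ (refl , refl)) = Shape.adj sh i
  edge-adj sh (i , inj₂ (refl , refl)) = ~-sym (Shape.adj sh i)

  -- Cycles all of whose vertices have degree 3

  module FullCycle (i : Fin s) (full : FullAt i) where
    exit : ℕ → V
    exit j = proj₁ (full j)

    exit-third : ∀ j → Third (v i) (K i) j (exit j)
    exit-third j = proj₂ (full j)

    all-darts : List Dart
    all-darts = cycle-darts i ++ darts (v i) exit (L i)

    length-all-darts : length all-darts ≡ 3 * L i
    length-all-darts = trans (List.length-++ (cycle-darts i))
      (trans (cong₂ _+_ (length-cycle-darts i) (length-darts _ _ _)) (solve 1 (λ l → l :+ l :+ l := con 3 :* l) refl (L i)))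
      where open +-*-Solver

    ∈-all-darts⁻ : ∀ {t h} → (t , h) ∈ all-darts → On (v i) t × t ~ h
    ∈-all-darts⁻ x∈ with ∈-++⁻ (cycle-darts i) x∈
    ... | inj₁ q = let ce = cycle-darts-edge q in edge-on ce , edge-adj (shape i) ce
    ... | inj₂ q with ∈-darts⁻ {v i} {exit} q
    ...   | p , _ , refl = (p , refl) , Third.adjacent (exit-third p)

    unique-all-darts : Unique all-darts
    unique-all-darts = Unique.++⁺ (unique-cycle-darts i) (unique-darts (shape-distinct (shape i)))
      λ (x∈ , y∈) → apart (cycle-darts-edge x∈) (∈-darts⁻ {v i} {exit} y∈)
      where
      apart : ∀ {t h} → CycleEdge (v i) t h → (∃ λ p → p < L i × (t , h) ≡ (v i p , exit p)) → ⊥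
      apart ce (p , _ , refl) = third-off (shape i) (exit-third p) ce

    charge : Charge i
    charge = record { list = all-darts ; unique = unique-all-darts ; adj = proj₂ ∘ ∈-all-darts⁻
                    ; owned = λ x∈ → own (proj₁ (∈-all-darts⁻ x∈)) (inj₁ full) }

    charge₂ : ∀ {t t′ h h′} → (t , h) ≢ (t′ , h′) → ¬ On (v i) t → ¬ On (v i) t′ → t ~ h → t′ ~ h′ →
              Owned i (t , h) → Owned i (t′ , h′) → Σ (Charge i) λ C → length (Charge.list C) ≡ 2 + 3 * L i
    charge₂ {t} {t′} {h} {h′} ≢ off off′ a a′ o o′ = record
      { list = (t , h) ∷ (t′ , h′) ∷ all-darts
      ; unique = (≢ ∷ away off) ∷ away off′ ∷ unique-all-darts
      ; adj = λ { (here refl) → a ; (there (here refl)) → a′ ; (there (there x∈)) → proj₂ (∈-all-darts⁻ x∈) }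
      ; owned = λ { (here refl) → o ; (there (here refl)) → o′ ; (there (there x∈)) → own (proj₁ (∈-all-darts⁻ x∈)) (inj₁ full) }
      } , cong (2 +_) length-all-darts
      where
      away : ∀ {x y} → ¬ On (v i) x → All ((x , y) ≢_) all-darts
      away off = All.tabulate λ { z∈ refl → off (proj₁ (∈-all-darts⁻ z∈)) }

  -- Cycles with a vertex of degree 2

  module DegreeTwo (i : Fin s) (none : NoThird (v i) (K i) 0) (S : Second i) (on-S : ∀ {t} → On (Second.u S) t → OnSecond i t) where
    open Second S

    -- The colours alternate, so the edge of colour `c i` leads either forwards or backwards.
    c-neighbour : ∀ p → p < M → ∃ λ q → col φ (u (suc p)) (u q) ≡ just (c i)
    c-neighbour p p<M with alt-order p (c i) b
    ... | inj₁ (e , _) = 2 + p , trans (State.run state₂ p p<M) (cong just e)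
    ... | inj₂ (_ , e) with p
    ...   | zero   = contradiction e b≢c
    ...   | suc p′ = suc p′ , flip φ (trans (State.run state₂ p′ (ℕ.<-trans (ℕ.n<1+n p′) p<M)) (cong just e))

    -- The value `u 0` from `M` on is a dummy.
    c-head : ℕ → V
    c-head p with p ℕ.<? M
    ... | yes lt = u (proj₁ (c-neighbour p lt))
    ... | no _   = u 0

    c-head-col : ∀ {p} → p < M → col φ (u (suc p)) (c-head p) ≡ just (c i)
    c-head-col {p} p<M with p ℕ.<? M
    ... | yes lt = proj₂ (c-neighbour p lt)
    ... | no ≮   = contradiction p<M ≮

    c-head-on : ∀ p → On u (c-head p)
    c-head-on p with p ℕ.<? M
    ... | yes lt = _ , refl
    ... | no _   = 0 , refl

    -- One dart for each vertex of the second cycle except position 0, which misses `c i`. Their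
    -- colour keeps them apart from the darts along the first cycle.
    c-darts : List Dart
    c-darts = darts (u ∘ suc) c-head M

    base : List Dart
    base = cycle-darts i ++ c-darts

    length-base : length base ≡ L i + L i + M
    length-base = trans (List.length-++ (cycle-darts i)) (cong₂ _+_ (length-cycle-darts i) (length-darts _ _ _))

    ∈-c-darts⁻ : ∀ {t h} → (t , h) ∈ c-darts → On u t × On u h × col φ t h ≡ just (c i)
    ∈-c-darts⁻ x∈ with ∈-darts⁻ {u ∘ suc} {c-head} x∈
    ... | p , lt , refl = (suc p , refl) , c-head-on p , c-head-col lt

    unique-base : Unique base
    unique-base = Unique.++⁺ (unique-cycle-darts i)
      (unique-darts λ p<q q<M → shape-distinct shape₂ (s≤s p<q) (s≤s q<M))
      λ (x∈ , y∈) → ready-clean (shape i) (ready i) (cycle-darts-edge x∈) (proj₂ (proj₂ (∈-c-darts⁻ y∈)))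

    off-others : ∀ {t} → On u t → ∀ k → k ≢ i → ¬ On (v k) t
    off-others on-t k k≢i on-k = second-disjoint k≢i S on-k on-t

    owned-along : ∀ {t h} → On u t → (∀ k → k ≢ i → ¬ On (v k) h) → Owned i (t , h)
    owned-along {t} on-t f with on? (shape i) t
    ... | yes on-v = own on-v (inj₂ f)
    ... | no ¬on-v = along-second (on-S on-t) (λ k on-k → case k Fin.≟ i of λ { (yes refl) → ¬on-v on-k ; (no k≢i) → off-others on-t k k≢i on-k }) f

    base-props : ∀ {t h} → (t , h) ∈ base → t ~ h × Owned i (t , h)
    base-props x∈ with ∈-++⁻ (cycle-darts i) x∈
    ... | inj₁ q = let ce = cycle-darts-edge q in edge-adj (shape i) ce ,
          own (edge-on ce) (inj₂ λ k k≢i on-k → disj k≢i on-k (edge-on (edge-sym ce)))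
    ... | inj₂ q = let on-t , on-h , e = ∈-c-darts⁻ q in col-adj φ e , owned-along on-t (off-others on-h)

    charge : Charge i
    charge = record { list = base ; unique = unique-base ; adj = proj₁ ∘ base-props ; owned = proj₂ ∘ base-props }

    module Short (L≤g : L i ≤ g) where
      x y : V
      -- Positions 0 and 1 are the ends of the uncoloured edge, which both cycles share, so position
      -- 2 is the first that can be off the first cycle.
      x = u 2
      y = u 3

      0<M : 0 < M
      0<M = ℕ.<-trans (s≤s z≤n) (1<K shape₂)

      1x : col φ (v i 1) x ≡ just (c i)
      1x = subst (λ t → col φ t x ≡ just (c i)) next₂ (State.run state₂ 0 0<M)

      xy : col φ x y ≡ just b
      xy = State.run state₂ 1 (1<K shape₂)

      3x : Third (v i) (K i) 1 x
      3x = off-third (shape i) (col-adj φ 1x) (λ ce → ready-clean (shape i) (ready i) ce 1x)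

      ¬on-x : ¬ On (v i) x
      ¬on-x = chordless (shape i) L≤g 3x

      ¬on-y : ¬ On (v i) y
      ¬on-y on-y = clash′ b≢c xy (flip φ (exit-colour opt (shape i) (ready i) on-y ¬on-x (~-sym (col-adj φ xy))))

      module D = Deficient opt (shape i) a≢b a≢c b≢c state₁ none 3x ¬on-x

      a-neighbour : ∃ λ h → col φ x h ≡ just a
      a-neighbour = decidable-stable (seen? φ x a) λ ¬seen → D.neighbour-sees λ w e → ¬seen (w , e)

      z : V
      z = proj₁ a-neighbour

      xz : col φ x z ≡ just a
      xz = proj₂ a-neighbour

      z-off : ∀ k → k ≢ i → ¬ On (v k) z
      z-off k k≢i = D.neighbour-avoids (shape k) (ready k) (disj (k≢i ∘ sym)) (disj k≢i) (off-others (2 , refl) k k≢i) xz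

      off-all : ∀ {t} → On u t → ¬ On (v i) t → ∀ k → ¬ On (v k) t
      off-all on-t ¬on k on-k = case k Fin.≟ i of λ { (yes refl) → ¬on on-k ; (no k≢i) → off-others on-t k k≢i on-k }

      away : ∀ {t h d} → ¬ On (v i) t → col φ t h ≡ just d → d ≢ c i → All ((t , h) ≢_) base
      away {t} {h} ¬on e d≢c = All.tabulate λ { w∈ refl → apart (∈-++⁻ (cycle-darts i) w∈) }
        where
        apart : (t , h) ∈ cycle-darts i ⊎ (t , h) ∈ c-darts → ⊥
        apart (inj₁ q) = ¬on (edge-on (cycle-darts-edge q))
        apart (inj₂ q) = clash′ d≢c e (proj₂ (proj₂ (∈-c-darts⁻ q)))

      -- If both cycles have length `g`, then `base` has `3 * g - 1` darts, three too few. Both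
      -- darts of the `b`-edge `x y` and the `a`-dart at `x` make up for them; they are new since
      -- their tails are off the first cycle and their colours differ from `c i`.
      charge₃ : Σ (Charge i) λ C → length (Charge.list C) ≡ 3 + (L i + L i + M)
      charge₃ = record
        { list = (x , y) ∷ (y , x) ∷ (x , z) ∷ base
        ; unique = ((x≢y ∘ cong proj₁) ∷ (λ e → clash′ (a≢b ∘ sym) xy (subst (λ t → col φ x t ≡ just a) (sym (cong proj₂ e)) xz)) ∷ away ¬on-x xy b≢c)
                 ∷ ((x≢y ∘ sym ∘ cong proj₁) ∷ away ¬on-y (flip φ xy) b≢c)
                 ∷ away ¬on-x xz a≢c ∷ unique-base
        ; adj = λ { (here refl) → col-adj φ xy ; (there (here refl)) → ~-sym (col-adj φ xy)
                  ; (there (there (here refl))) → col-adj φ xz ; (there (there (there w∈))) → proj₁ (base-props w∈) }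
        ; owned = λ { (here refl) → along-second (on-S (2 , refl)) (off-all (2 , refl) ¬on-x) (off-others (3 , refl))
                    ; (there (here refl)) → along-second (on-S (3 , refl)) (off-all (3 , refl) ¬on-y) (off-others (2 , refl))
                    ; (there (there (here refl))) → along-second (on-S (2 , refl)) (off-all (2 , refl) ¬on-x) z-off
                    ; (there (there (there w∈))) → proj₂ (base-props w∈) }
        } , cong (3 +_) length-base
        where
        x≢y : x ≢ y
        x≢y = ~⇒≢ (col-adj φ xy)

  -- Cycles of length g without vertices of degree 2

  Joined : V → Set
  Joined y = ∃ λ k → FullAt k × On (v k) y

  joined? : ∀ y → Dec (Joined y)
  joined? y = Fin.any? λ k → fullAt? k ×-dec on? (shape k) y

  module ShortFull (i : Fin s) (full : FullAt i) (L≤g : L i ≤ g) where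
    open FullCycle i full public

    exit-off-cycle : ∀ j → ¬ On (v i) (exit j)
    exit-off-cycle j = chordless (shape i) L≤g (exit-third j)

    exit-cong : ∀ {p q} → v i p ≡ v i q → exit p ≡ exit q
    exit-cong {p} {q} e = third-unique (shape i) (exit-third q) (third-mod (shape i) e (exit-third p))

    exit-col : ∀ j → col φ (v i j) (exit j) ≡ just (c i)
    exit-col j = third-colour-exit opt (shape i) (ready i) (exit-third j)

    exit-inj : ∀ {p q} → exit p ≡ exit q → v i p ≡ v i q
    exit-inj {p} {q} e = col-proper φ (flip φ (exit-col p)) (flip φ (trans (cong (col φ (v i q)) e) (exit-col q)))

    Poor : Set
    Poor = ∃ λ k → k ≢ i × FullAt k × ∀ j → On (v k) (exit j)

    -- By `exits-to-same-cycle` the cycle that receives an exit also receives the next one.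
    same-partner : (∀ j → Joined (exit j)) → Poor
    same-partner jn with jn 1
    ... | k , full-k , on₁ = k , k≢i , full-k , λ
      -- Position 0 comes last: it is reached as position `suc (K i)`, after a full turn.
      { zero    → subst (On (v k)) (exit-cong (trans (cong (v i) (cong suc (sym (ℕ.+-identityʳ (K i))))) (Shape.per (shape i) 0))) (later (K i))
      ; (suc j) → later j }
      where
      k≢i : k ≢ i
      k≢i refl = exit-off-cycle 1 on₁
      later : ∀ j → On (v k) (exit (suc j))
      later zero = on₁
      later (suc j) with jn (2 + j)
      ... | k′ , full-k′ , on′ with k′ Fin.≟ k
      ...   | yes refl = on′
      ...   | no k′≢k = contradiction on′ (ConsecutiveExits.exits-to-same-cycle opt (shape i) (ready i) (shape k) (ready k)
                (disj (k≢i ∘ sym)) (disj k≢i) (exit-third (suc j)) (exit-third (2 + j)) (later j)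
                (shape k′) (ready k′) (disj (k′≢i ∘ sym)) (disj k′≢i) (disj (k′≢k ∘ sym)) (disj k′≢k))
        where
        k′≢i : k′ ≢ i
        k′≢i refl = exit-off-cycle (2 + j) on′

    into-charge : ∀ j → ¬ Joined (exit j) → Owned i (exit j , v i j)
    into-charge j ¬j = into (j , refl) (exit-off-cycle j) (λ k full-k on-k → ¬j (k , full-k , on-k))

    -- Exactly one edge leaves the full cycles, at v j; its end x then has all its
    -- darts to itself.
    module OneExit (j : ℕ) (¬joined : ¬ Joined (exit j)) {k : Fin s} (full-k : FullAt k) (on-u : On (v k) (exit (suc j))) where
      x : V
      x = exit j

      k≢i : k ≢ i
      k≢i refl = exit-off-cycle (suc j) on-u

      ck≡ci : c k ≡ c i
      ck≡ci = just-≡ (exit-colour opt (shape k) (ready k) on-u (disj (k≢i ∘ sym) (suc j , refl)) (~-sym (Third.adjacent (exit-third (suc j)))))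
        (flip φ (exit-col (suc j)))

      ready-k : Ready φ (v k) (K k) (c i)
      ready-k = subst (Ready φ (v k) (K k)) ck≡ci (ready k)

      ¬on-k : ¬ On (v k) x
      ¬on-k on = ¬joined (k , full-k , on)

      module JO {t : ℕ → V} {M : ℕ} {e : Colour} = JoinedAndOff opt (shape i) (ready i) (exit-third (suc j)) (exit-third j) (exit-off-cycle j)
        (shape k) ready-k (disj (k≢i ∘ sym)) (disj k≢i) on-u ¬on-k {t} {M} {e}

      off-all : ∀ k′ → ¬ On (v k′) x
      off-all k′ on with k′ Fin.≟ i | k′ Fin.≟ k
      ... | yes refl | _ = exit-off-cycle j on
      ... | no _ | yes refl = ¬on-k on
      ... | no k′≢i | no k′≢k = JO.exit-off (shape k′) (ready k′) (disj (k′≢i ∘ sym)) (disj k′≢i) (disj (k′≢k ∘ sym)) (disj k′≢k) on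

      off-second : ∀ k′ → k′ ≢ i → ¬ OnSecond k′ x
      off-second k′ k′≢i on with kind k′ in eq
      ... | inj₂ none = JO.exit-off (Second.shape₂ S) (second-ready S)
            (second-disjoint (k′≢i ∘ sym) S) (λ p q → second-disjoint (k′≢i ∘ sym) S q p)
            (second-disjoint (k′≢k ∘ sym) S) (λ p q → second-disjoint (k′≢k ∘ sym) S q p) on
        where
        S : Second k′
        S = second k′ none
        k′≢k : k′ ≢ k
        k′≢k refl = let y , t = full-k 0 in none y t

      neighbours-off : ∀ k′ → k′ ≢ i → ∀ {z} → x ~ z → ¬ On (v k′) z
      neighbours-off k′ k′≢i {z} x~z on with k′ Fin.≟ k
      ... | no k′≢k = JO.exit-next-off (shape k′) (ready k′) (disj (k′≢i ∘ sym)) (disj k′≢i) (disj (k′≢k ∘ sym)) (disj k′≢k)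
                        x~z (λ { refl → disj k′≢i on (j , refl) }) on
      ... | yes refl = disj k′≢i on (j , col-proper φ
              (flip φ (exit-colour opt (shape k) ready-k on ¬on-k (~-sym x~z))) (flip φ (exit-col j)))

      a : Colour
      a = Ready.a (ready i)

      a-neighbour : ∃ λ h → col φ x h ≡ just a
      a-neighbour = decidable-stable (seen? φ x a) λ ¬seen →
        Joined.exit-sees opt (shape i) (ready i) (exit-third (suc j)) (exit-third j) (exit-off-cycle j)
          (shape k) ready-k (disj (k≢i ∘ sym)) (disj k≢i) on-u ¬on-k (Ready.a≢c (ready i)) λ w e → ¬seen (w , e)

      owned-x : ∀ {h} → Owned i (x , h)
      owned-x = private-exit off-all off-second (~-sym (Third.adjacent (exit-third j))) (j , refl) neighbours-off

      -- Both darts start at `x`: the one back into the cycle, of colour `c i`, and one of colour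
      -- `a`, which exists by `exit-sees`.
      two-more : Σ (Charge i) λ C → length (Charge.list C) ≡ 2 + 3 * L i
      two-more = charge₂ {x} {x} {v i j} {proj₁ a-neighbour}
        (λ e → clash′ (Ready.a≢c (ready i) ∘ sym) (flip φ (exit-col j)) (subst (λ t → col φ x t ≡ just a) (sym (cong proj₂ e)) (proj₂ a-neighbour)))
        (exit-off-cycle j) (exit-off-cycle j) (~-sym (Third.adjacent (exit-third j))) (col-adj φ (proj₂ a-neighbour)) owned-x owned-x

    abstract
      -- The cases are the number of exits that miss all full cycles. Two such exits give one
      -- entering dart each. If there is only one, the next exit is joined and `OneExit` applies. If
      -- there is none, the cycle is poor.
      analysis : (Σ (Charge i) λ C → length (Charge.list C) ≡ 2 + 3 * L i) ⊎ Poor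
      analysis with Fin.any? (λ (p : Fin (L i)) → ¬? (joined? (exit (toℕ p))))
      ... | no all = inj₂ (same-partner λ j → subst Joined
              (exit-cong (trans (cong (v i) (Fin.toℕ-fromℕ< (m%n<n j (L i)))) (sym (v-mod (shape i) j))))
              (decidable-stable (joined? _) λ ¬j → all (fromℕ< (m%n<n j (L i)) , ¬j)))
      ... | yes (p , ¬j) with Fin.any? (λ (q : Fin (L i)) → ¬? (q Fin.≟ p) ×-dec ¬? (joined? (exit (toℕ q))))
      ...   | yes (q , q≢p , ¬j′) = inj₁ (charge₂
              (λ e → distinct-heads (cong proj₂ e)) (exit-off-cycle (toℕ p)) (exit-off-cycle (toℕ q))
              (~-sym (Third.adjacent (exit-third (toℕ p)))) (~-sym (Third.adjacent (exit-third (toℕ q))))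
              (into-charge (toℕ p) ¬j) (into-charge (toℕ q) ¬j′))
        where
        distinct-heads : v i (toℕ p) ≢ v i (toℕ q)
        distinct-heads e with ℕ.<-cmp (toℕ p) (toℕ q)
        ... | tri< lt _ _ = shape-distinct (shape i) lt (Fin.toℕ<n q) e
        ... | tri≈ _ eq _ = q≢p (Fin.toℕ-injective (sym eq))
        ... | tri> _ _ gt = shape-distinct (shape i) gt (Fin.toℕ<n p) (sym e)
      ...   | no others = inj₁ (from-next (decidable-stable (joined? (exit (toℕ r))) λ ¬jr → others (r , r≢p , ¬jr)))
        where
        j : ℕ
        j = toℕ p
        r : Fin (L i)
        r = fromℕ< (m%n<n (suc j) (L i))
        vr : v i (toℕ r) ≡ v i (suc j)
        vr = trans (cong (v i) (Fin.toℕ-fromℕ< (m%n<n (suc j) (L i)))) (sym (v-mod (shape i) (suc j)))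
        r≢p : r ≢ p
        r≢p e = ~⇒≢ (Shape.adj (shape i) j) (trans (cong (v i ∘ toℕ) (sym e)) vr)
        from-next : Joined (exit (toℕ r)) → Σ (Charge i) λ C → length (Charge.list C) ≡ 2 + 3 * L i
        from-next (k , full-k , on) = OneExit.two-more j ¬j full-k (subst (On (v k)) (exit-cong vr) on)

  -- Two cycles of length g joined by a perfect matching

  module Permutation (i : Fin s) (full : FullAt i) (L≤g : L i ≤ g) (k : Fin s) (k≢i : k ≢ i) (Lk≤g : L k ≤ g)
    (on-k : ∀ j → On (v k) (proj₁ (full j))) where
    open ShortFull i full L≤g using (exit; exit-third; exit-cong; exit-inj; exit-off-cycle)

    w : ℕ → V
    w = v k

    sh : Shape w (K k)
    sh = shape k

    exit-adj : ∀ j → v i j ~ exit j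
    exit-adj j = Third.adjacent (exit-third j)

    not-consecutive : ∀ j l → ¬ ((exit j ≡ w l × exit (suc j) ≡ w (suc l)) ⊎ (exit j ≡ w (suc l) × exit (suc j) ≡ w l))
    not-consecutive j l h = ConsecutiveExits.exits-not-consecutive opt (shape i) (ready i) sh (ready k) (disj (k≢i ∘ sym)) (disj k≢i)
      {K i + j} (exit-third (1 + (K i + j))) (exit-third (2 + (K i + j))) (on-k _) l
      (subst₂ (λ x y → (x ≡ w l × y ≡ w (suc l)) ⊎ (x ≡ w (suc l) × y ≡ w l))
        (exit-cong (sym (Shape.per (shape i) j)))
        (exit-cong (sym (trans (cong (v i) (cong suc (sym (ℕ.+-suc (K i) j)))) (Shape.per (shape i) (suc j))))) h)

    exits-differ : ∀ {p q} → v i p ≢ v i q → exit p ≢ exit q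
    exits-differ ne e = ne (exit-inj e)

    Apart : ℕ → V → V → Set
    Apart t y z = ∃ λ m → (y ≡ w m × z ≡ w (t + m)) ⊎ (z ≡ w m × y ≡ w (t + m))

    g≡L : g ≡ L k
    g≡L = ℕ.≤-antisym (g≤length sh) Lk≤g

    -- The three edges from exit to exit by way of `v i`, together with the even one of the two arcs
    -- of `w`, close an odd walk, of length at least `g`. So the odd arc has length at most 3, and
    -- `not-consecutive` excludes 1.
    three-apart : ∀ j → Apart 3 (exit j) (exit (suc j))
    three-apart j with on-k (suc j)
    ... | m , em with position-from sh m (on-k j)
    ...   | d , d≤K , ed = cases (even⊎odd d)
      where
      closes : ∀ {ℓ} → Walk (exit (suc j)) (exit j) ℓ → Walk (exit j) (exit j) (3 + ℓ)
      closes q = ~-sym (exit-adj j) ∷ Shape.adj (shape i) j ∷ exit-adj (suc j) ∷ q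
      opens : ∀ {ℓ} → Walk (exit j) (exit (suc j)) ℓ → Walk (exit j) (exit j) (ℓ + 3)
      opens q = q ⊕ (~-sym (exit-adj (suc j)) ∷ ~-sym (Shape.adj (shape i) j) ∷ exit-adj j ∷ [])
      cases : (∃ λ h → d ≡ h * 2) ⊎ (∃ λ h → d ≡ suc (h * 2)) → Apart 3 (exit j) (exit (suc j))
      cases (inj₁ (h , refl)) with ℕ.m≤n⇒m<n∨m≡n d≤K
      ... | inj₂ d≡K = contradiction (inj₁ (trans ed (cong (λ t → w (t + m)) d≡K) , trans em (sym (Shape.per sh m)))) (not-consecutive j (K k + m))
      ... | inj₁ d<K  = h * 2 + m , inj₁ (ed , trans em (trans (sym (Shape.per sh m)) (cong (λ t → w (t + m)) (sym 3+d≡L))))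
        where
        walk : Walk (exit (suc j)) (exit j) (h * 2)
        walk = subst₂ (λ x y → Walk x y (h * 2)) (sym em) (sym ed) (along sh m (h * 2))
        3+d≤L : 3 + h * 2 ≤ L k
        3+d≤L = s≤s (parity {h′ = Shape.half sh} (Shape.even sh) d<K)
          where
          parity : ∀ {K h′} → K ≡ suc h′ * 2 → h * 2 < K → 2 + h * 2 ≤ K
          parity {h′ = h′} refl lt = ℕ.*-monoˡ-≤ 2 {suc h} {suc h′} (ℕ.*-cancelʳ-< 2 h (suc h′) lt)
        3+d≡L : 3 + h * 2 ≡ L k
        3+d≡L = ℕ.≤-antisym 3+d≤L (subst (_≤ 3 + h * 2) g≡L (g≤odd-walk (suc h , refl) (closes walk)))
      cases (inj₂ (zero , refl)) = contradiction (inj₂ (ed , em)) (not-consecutive j m)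
      cases (inj₂ (suc zero , refl)) = m , inj₂ (em , ed)
      cases (inj₂ (suc (suc h) , refl)) = contradiction (g≤odd-walk odd (opens walk)) (ℕ.<⇒≱ short)
        where
        D : ℕ
        D = 5 + h * 2
        walk : Walk (exit j) (exit (suc j)) (L k ∸ D)
        walk = subst₂ (λ x y → Walk x y (L k ∸ D)) (sym ed) (sym em) (back sh m d≤K)
        odd : Odd (L k ∸ D + 3)
        odd with odd+odd {b = L k ∸ D} (suc (suc h) , refl) (subst Odd (sym (ℕ.m+[n∸m]≡n (ℕ.m≤n⇒m≤1+n d≤K))) (length-odd sh))
        ... | t , e = suc t , trans (cong (_+ 3) e) (ℕ.+-comm (t * 2) 3)
        short : L k ∸ D + 3 < g
        short = subst (L k ∸ D + 3 <_) (trans (ℕ.m∸n+n≡m (ℕ.m≤n⇒m≤1+n d≤K)) (sym g≡L)) (ℕ.+-monoʳ-< (L k ∸ D) (s≤s (s≤s (s≤s (s≤s z≤n)))))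

    cancel-three : ∀ {m m′} → w (3 + m) ≡ w (3 + m′) → w m ≡ w m′
    -- Another `K k ∸ 2` steps complete the three to a full turn.
    cancel-three {m} {m′} e = trans (sym (turn m)) (trans (translate sh (K k ∸ 2) {3 + m} {3 + m′} e) (turn m′))
      where
      turn : ∀ m → w (K k ∸ 2 + (3 + m)) ≡ w m
      turn m = trans (cong w (trans (sym (ℕ.+-assoc (K k ∸ 2) 3 m)) (cong (_+ m)
        (trans (ℕ.+-suc (K k ∸ 2) 2) (cong suc (ℕ.m∸n+n≡m (1<K sh))))))) (Shape.per sh m)

    -- Two steps of length 3 in opposite directions would lead back to the first exit, but exits of
    -- different vertices differ; so the steps add up.
    six-apart : ∀ j → Apart 6 (exit j) (exit (2 + j))
    six-apart j with three-apart j | three-apart (suc j)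
    ... | m , inj₁ (p , q) | m′ , inj₁ (p′ , q′) = m , inj₁ (p , trans q′ (translate sh 3 {m′} {3 + m} (trans (sym p′) q)))
    ... | m , inj₂ (p , q) | m′ , inj₂ (p′ , q′) = m′ , inj₂ (p′ , trans q (translate sh 3 {m} {3 + m′} (trans (sym p) q′)))
    ... | m , inj₁ (p , q) | m′ , inj₂ (p′ , q′) = contradiction (trans p (trans (cancel-three (trans (sym q) q′)) (sym p′)))
          (exits-differ (distinct (shape i) (ℕ.<-trans (ℕ.n<1+n j) (ℕ.n<1+n (suc j))) (ℕ.+-monoˡ-≤ j (1<K (shape i)))))
    ... | m , inj₂ (p , q) | m′ , inj₁ (p′ , q′) = contradiction (trans q (trans (translate sh 3 {m} {m′} (trans (sym p) p′)) (sym q′)))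
          (exits-differ (distinct (shape i) (ℕ.<-trans (ℕ.n<1+n j) (ℕ.n<1+n (suc j))) (ℕ.+-monoˡ-≤ j (1<K (shape i)))))

    -- On a triangle, exits at distance 3 would coincide. From length 7 on, the arc that completes
    -- the six steps and the four edges by way of `v i` close an odd walk of length `L k - 2`, which
    -- is less than `g`.
    K≡4 : K k ≡ 4
    K≡4 with Shape.half sh | Shape.even sh
    ... | 0 | e = contradiction (three-apart 0) λ
            { (m , inj₁ (p , q)) → same-exit (trans p (trans (sym (loop e m)) (sym q)))
            ; (m , inj₂ (p , q)) → same-exit (trans q (trans (loop e m) (sym p))) }
      where
      loop : K k ≡ 2 → ∀ m → w (3 + m) ≡ w m
      loop e m = trans (cong (λ t → w (suc t + m)) (sym e)) (Shape.per sh m)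
      same-exit : exit 0 ≢ exit 1
      same-exit = exits-differ (~⇒≢ (Shape.adj (shape i) 0))
    ... | 1 | e = e
    ... | suc (suc h) | e = ⊥-elim (long (six-apart 0))
      where
      6≤K : 6 ≤ K k
      6≤K = subst (6 ≤_) (sym e) (s≤s (s≤s (s≤s (s≤s (s≤s (s≤s z≤n))))))
      odd : Odd (4 + (L k ∸ 6))
      odd with even+odd {6} {L k ∸ 6} (3 , refl) (subst Odd (sym (ℕ.m+[n∸m]≡n (ℕ.m≤n⇒m≤1+n 6≤K))) (length-odd sh))
      ... | t , eq = suc (suc t) , cong (4 +_) eq
      short : 4 + (L k ∸ 6) < g
      short = subst (4 + (L k ∸ 6) <_) (trans (ℕ.m+[n∸m]≡n (ℕ.m≤n⇒m≤1+n 6≤K)) (sym g≡L))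
        (ℕ.+-monoˡ-< (L k ∸ 6) {4} {6} (s≤s (s≤s (s≤s (s≤s (s≤s z≤n))))))
      there-and-back : Walk (exit 2) (exit 0) (L k ∸ 6) → ⊥
      there-and-back q = ℕ.<⇒≱ short (g≤odd-walk odd
        (~-sym (exit-adj 0) ∷ Shape.adj (shape i) 0 ∷ Shape.adj (shape i) 1 ∷ exit-adj 2 ∷ q))
      there-and-back′ : Walk (exit 0) (exit 2) (L k ∸ 6) → ⊥
      there-and-back′ q = ℕ.<⇒≱ short (g≤odd-walk odd
        (~-sym (exit-adj 2) ∷ ~-sym (Shape.adj (shape i) 1) ∷ ~-sym (Shape.adj (shape i) 0) ∷ exit-adj 0 ∷ q))
      long : Apart 6 (exit 0) (exit 2) → ⊥
      long (m , inj₁ (p , q)) = there-and-back (subst₂ (λ x y → Walk x y (L k ∸ 6)) (sym q) (sym p) (back sh m 6≤K))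
      long (m , inj₂ (p , q)) = there-and-back′ (subst₂ (λ x y → Walk x y (L k ∸ 6)) (sym q) (sym p) (back sh m 6≤K))

    Ki≡4 : K i ≡ 4
    Ki≡4 = ℕ.suc-injective (trans (ℕ.≤-antisym L≤g (g≤length (shape i))) (trans g≡L (cong suc K≡4)))

    six≡one : ∀ m → w (6 + m) ≡ w (suc m)
    six≡one m = trans (cong w (sym (trans (ℕ.+-suc (L k) m) (cong (λ t → 2 + t + m) K≡4)))) (Shape.per sh (suc m))

    -- Six steps around a pentagon amount to one, so these adjacencies form the inner pentagram.
    inner : ∀ j → exit j ~ exit (2 + j)
    inner j with six-apart j
    ... | m , inj₁ (p , q) = subst₂ _~_ (sym p) (sym (trans q (six≡one m))) (Shape.adj sh m)
    ... | m , inj₂ (p , q) = ~-sym (subst₂ _~_ (sym p) (sym (trans q (six≡one m))) (Shape.adj sh m))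

    per5 : ∀ j → v i (5 + j) ≡ v i j
    per5 j = trans (cong (λ t → v i (suc t + j)) (sym Ki≡4)) (Shape.per (shape i) j)

    corner : Fin 10 → V
    corner 0F = v i 0
    corner 1F = v i 1
    corner 2F = v i 2
    corner 3F = v i 3
    corner 4F = v i 4
    corner 5F = exit 0
    corner 6F = exit 1
    corner 7F = exit 2
    corner 8F = exit 3
    corner 9F = exit 4

    corner-edges : All (λ (a , b) → corner a ~ corner b) petersenEdges
    corner-edges = adj 0 ∷ adj 1 ∷ adj 2 ∷ adj 3 ∷ subst (v i 4 ~_) (per5 0) (adj 4)
      ∷ inner 0 ∷ inner 2 ∷ subst (exit 4 ~_) (exit-cong (per5 1)) (inner 4) ∷ inner 1 ∷ subst (exit 3 ~_) (exit-cong (per5 0)) (inner 3)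
      ∷ exit-adj 0 ∷ exit-adj 1 ∷ exit-adj 2 ∷ exit-adj 3 ∷ exit-adj 4 ∷ []
      where open Shape (shape i) using (adj)

    corner′ : Fin 5 ⊎ Fin 5 → V
    corner′ (inj₁ a) = v i (toℕ a)
    corner′ (inj₂ a) = exit (toℕ a)

    v-inj : ∀ {a b : Fin 5} → v i (toℕ a) ≡ v i (toℕ b) → a ≡ b
    v-inj {a} {b} e with Fin.<-cmp a b
    ... | tri< lt _ _ = contradiction e (shape-distinct (shape i) lt (subst (toℕ b <_) (cong suc (sym Ki≡4)) (Fin.toℕ<n b)))
    ... | tri≈ _ eq _ = eq
    ... | tri> _ _ gt = contradiction (sym e) (shape-distinct (shape i) gt (subst (toℕ a <_) (cong suc (sym Ki≡4)) (Fin.toℕ<n a)))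

    corner′-inj : ∀ x y → corner′ x ≡ corner′ y → x ≡ y
    corner′-inj (inj₁ a) (inj₁ b) e = cong inj₁ (v-inj e)
    corner′-inj (inj₂ a) (inj₂ b) e = cong inj₂ (v-inj (exit-inj e))
    corner′-inj (inj₁ a) (inj₂ b) e = contradiction (toℕ a , sym e) (exit-off-cycle (toℕ b))
    corner′-inj (inj₂ a) (inj₁ b) e = contradiction (toℕ b , e) (exit-off-cycle (toℕ a))

    corner-split : ∀ a → corner a ≡ corner′ (Fin.splitAt 5 a)
    corner-split 0F = refl
    corner-split 1F = refl
    corner-split 2F = refl
    corner-split 3F = refl
    corner-split 4F = refl
    corner-split 5F = refl
    corner-split 6F = refl
    corner-split 7F = refl
    corner-split 8F = refl
    corner-split 9F = refl

    corner-inj : ∀ {a b} → corner a ≡ corner b → a ≡ b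
    corner-inj {a} {b} e = trans (sym (Fin.join-splitAt 5 5 a)) (trans (cong (Fin.join 5 5)
      (corner′-inj (Fin.splitAt 5 a) (Fin.splitAt 5 b) (trans (sym (corner-split a)) (trans e (corner-split b))))) (Fin.join-splitAt 5 5 b))

    petersen : Connected G → G ≅ Petersen
    petersen connected = petersen-copy⇒≅ G nb3 connected corner corner-inj corner-edges

  -- Debts between cycles and the final count

  module Counting (g-odd : Odd g) (3≤g : 3 ≤ g) (connected : Connected G) (not-petersen : ¬ (G ≅ Petersen)) where

    charge-length : ∀ {i} → Charge i → ℕ
    charge-length C = length (Charge.list C)

    -- A `rich` cycle supports itself, a `long` one has a surplus to draw on, and a `poor` one is
    -- two darts short and draws on cycle `k`. The last argument of `rich` ensures that no poor
    -- cycle draws on a rich one.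
    data Verdict (i : Fin s) : Set where
      rich : (C : Charge i) → 2 + 3 * g ≤ charge-length C → (FullAt i → L i ≤ g) → Verdict i
      long : (C : Charge i) → charge-length C ≡ 3 * L i → g < L i → Verdict i
      poor : (C : Charge i) → charge-length C ≡ 3 * g → (full : FullAt i) → L i ≡ g →
             ∀ k → k ≢ i → FullAt k → g < L k → (∀ j → On (v k) (proj₁ (full j))) → Verdict i

    L≡g : ∀ {i} → L i ≤ g → L i ≡ g
    L≡g {i} L≤g = ℕ.≤-antisym L≤g (g≤length (shape i))

    judge : ∀ i → (κ : Kind (v i) (K i)) → kind i ≡ κ → Verdict i
    judge i (inj₁ full) _ with L i ℕ.≤? g
    ... | no L≰g = long (FullCycle.charge i full) (FullCycle.length-all-darts i full) (ℕ.≰⇒> L≰g)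
    ... | yes L≤g with ShortFull.analysis i full L≤g
    ...   | inj₁ (C , len) = rich C (ℕ.≤-reflexive (trans (cong (λ l → 2 + 3 * l) (sym (L≡g {i} L≤g))) (sym len))) (λ _ → L≤g)
    ...   | inj₂ (k , k≢i , full-k , on-k) with L k ℕ.≤? g
    ...     | yes Lk≤g = contradiction (Permutation.petersen i full L≤g k k≢i Lk≤g on-k connected) not-petersen
    ...     | no Lk≰g  = poor (FullCycle.charge i full) (trans (FullCycle.length-all-darts i full) (cong (3 *_) (L≡g {i} L≤g)))
                           full (L≡g {i} L≤g) k k≢i full-k (ℕ.≰⇒> Lk≰g) on-k
    judge i (inj₂ none) eq with L i ℕ.≤? g
    ... | yes L≤g = rich (proj₁ C) (subst (2 + 3 * g ≤_) (sym (proj₂ C)) enough) (λ full → let y , t = full 0 in contradiction t (none y))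
      where
      S : Second i
      S = second i none
      C : Σ (Charge i) λ C → length (Charge.list C) ≡ 3 + (L i + L i + Second.M S)
      C = DegreeTwo.Short.charge₃ i none S (λ {t} → subst (λ κ → on-second i κ t) (sym eq)) L≤g
      enough : 2 + 3 * g ≤ 3 + (L i + L i + Second.M S)
      enough = begin
        2 + 3 * g                          ≡⟨ solve 1 (λ g → con 2 :+ con 3 :* g := con 2 :+ (g :+ g :+ g)) refl g ⟩
        2 + (g + g + g)                    ≤⟨ ℕ.+-monoʳ-≤ 2 (ℕ.+-mono-≤ (ℕ.+-mono-≤ (g≤length (shape i)) (g≤length (shape i))) (g≤length (Second.shape₂ S))) ⟩
        2 + (L i + L i + suc (Second.M S)) ≡⟨ cong (2 +_) (ℕ.+-suc (L i + L i) (Second.M S)) ⟩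
        3 + (L i + L i + Second.M S)       ∎
        where
        open ℕ.≤-Reasoning
        open +-*-Solver
    ... | no L≰g = rich C (subst (2 + 3 * g ≤_) (sym (DegreeTwo.length-base i none S on-S)) enough) (λ full → let y , t = full 0 in contradiction t (none y))
      where
      S : Second i
      S = second i none
      on-S : ∀ {t} → On (Second.u S) t → OnSecond i t
      on-S {t} = subst (λ κ → on-second i κ t) (sym eq)
      C : Charge i
      C = DegreeTwo.charge i none S on-S
      2+g≤L : 2 + g ≤ L i
      2+g≤L = odd-gap g-odd (length-odd (shape i)) (ℕ.≰⇒> L≰g)
      -- The first cycle has length at least `g + 2` and the second at least `g`, so `base` alone
      -- has at least `3 * g + 3` darts.
      enough : 2 + 3 * g ≤ L i + L i + Second.M S
      enough = ℕ.≤-pred (begin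
        3 + 3 * g                          ≤⟨ ℕ.n≤1+n _ ⟩
        4 + 3 * g                          ≡⟨ solve 1 (λ g → con 4 :+ con 3 :* g := (con 2 :+ g) :+ (con 2 :+ g) :+ g) refl g ⟩
        (2 + g) + (2 + g) + g              ≤⟨ ℕ.+-mono-≤ (ℕ.+-mono-≤ 2+g≤L 2+g≤L) (g≤length (Second.shape₂ S)) ⟩
        L i + L i + suc (Second.M S)       ≡⟨ ℕ.+-suc (L i + L i) (Second.M S) ⟩
        suc (L i + L i + Second.M S)       ∎)
        where
        open ℕ.≤-Reasoning
        open +-*-Solver

    abstract
      verdict : ∀ i → Verdict i
      verdict i = judge i (kind i) refl

    charge-of : ∀ {i} → Verdict i → Charge i
    charge-of (rich C _ _)               = C
    charge-of (long C _ _)               = C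
    charge-of (poor C _ _ _ _ _ _ _ _) = C

    debt : ∀ {i} → Verdict i → ℕ
    debt (rich _ _ _)               = 0
    debt (long _ _ _)               = 0
    debt (poor _ _ _ _ _ _ _ _ _) = 1

    owes : ∀ {i} → Verdict i → Fin s → ℕ
    owes (rich _ _ _) j = 0
    owes (long _ _ _) j = 0
    owes (poor _ _ _ _ k _ _ _ _) j with k Fin.≟ j
    ... | yes _ = 1
    ... | no _  = 0

    -- The vertices of the j-th cycle joined to a poor cycle that is in debt to it.
    mates : ∀ {i} → Verdict i → Fin s → List V
    mates (rich _ _ _) j = []
    mates (long _ _ _) j = []
    mates {i} (poor _ _ full _ k _ _ _ _) j with k Fin.≟ j
    ... | yes _ = tabulate {n = L i} λ p → proj₁ (full (toℕ p))
    ... | no _  = []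

    length-mates : ∀ {i} (W : Verdict i) j → length (mates W j) ≡ g * owes W j
    length-mates (rich _ _ _) j = sym (ℕ.*-zeroʳ g)
    length-mates (long _ _ _) j = sym (ℕ.*-zeroʳ g)
    length-mates {i} (poor _ _ full L≡g k _ _ _ _) j with k Fin.≟ j
    ... | yes _ = trans (List.length-tabulate {n = L i} λ p → proj₁ (full (toℕ p))) (trans L≡g (sym (ℕ.*-identityʳ g)))
    ... | no _  = sym (ℕ.*-zeroʳ g)

    ∈-mates : ∀ {i} (W : Verdict i) j {y} → y ∈ mates W j → j ≢ i × On (v j) y × ∃ λ p → y ~ v i p
    ∈-mates {i} (poor _ _ full _ k k≢i _ _ on-k) j y∈ with k Fin.≟ j
    ... | yes refl with ∈-tabulate⁻ {n = L i} {f = λ p → proj₁ (full (toℕ p))} y∈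
    ...   | p , refl = k≢i , on-k (toℕ p) , toℕ p , ~-sym (Third.adjacent (proj₂ (full (toℕ p))))

    unique-mates : ∀ {i} (W : Verdict i) j → Unique (mates W j)
    unique-mates (rich _ _ _) j = []
    unique-mates (long _ _ _) j = []
    unique-mates {i} (poor _ _ full L≡g k _ _ _ _) j with k Fin.≟ j
    ... | no _  = []
    ... | yes _ = Unique.tabulate⁺ inj
      where
      inj : ∀ {p q : Fin (L i)} → proj₁ (full (toℕ p)) ≡ proj₁ (full (toℕ q)) → p ≡ q
      inj {p} {q} e with Fin.<-cmp p q
      ... | tri< lt _ _ = contradiction (ShortFull.exit-inj i full (ℕ.≤-reflexive L≡g) e) (shape-distinct (shape i) lt (Fin.toℕ<n q))
      ... | tri≈ _ eq _ = eq
      ... | tri> _ _ gt = contradiction (ShortFull.exit-inj i full (ℕ.≤-reflexive L≡g) (sym e)) (shape-distinct (shape i) gt (Fin.toℕ<n p))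

    -- A vertex of the `j`-th cycle has a single third neighbour, and this cannot lie on two
    -- disjoint cycles.
    disjoint-mates : ∀ j {i i′ y} → y ∈ mates (verdict i) j → y ∈ mates (verdict i′) j → i ≡ i′
    disjoint-mates j {i} {i′} y∈ y∈′ with ∈-mates (verdict i) j y∈ | ∈-mates (verdict i′) j y∈′
    ... | j≢i , (m , refl) , p , a | j≢i′ , _ , p′ , a′ with i Fin.≟ i′
    ...   | yes e = e
    ...   | no i≢i′ = contradiction (p′ , third-unique (shape j) (off⇒third (shape j) a′ λ on → disj j≢i′ on (p′ , refl))
                                                         (off⇒third (shape j) a λ on → disj j≢i on (p , refl)))
                        (disj i≢i′ (p , refl))

    -- The number of poor cycles that draw on the `j`-th cycle; each is to receive two darts.
    creditors : Fin s → ℕ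
    creditors j = ∑ λ i → owes (verdict i) j

    -- Each poor cycle drawing on the `j`-th one is matched into it by `g` edges, and all these
    -- edges end in different vertices.
    creditors-bound : ∀ j → g * creditors j ≤ L j
    creditors-bound j = begin
      g * creditors j                               ≡⟨ sym (∑-*ˡ g λ i → owes (verdict i) j) ⟩
      ∑ (λ i → g * owes (verdict i) j)              ≤⟨ ∑-mono (λ i → ℕ.≤-reflexive (sym (length-mates (verdict i) j))) ⟩
      ∑ (λ i → length (mates (verdict i) j))        ≤⟨ ∑-disjoint-lists (λ i → unique-mates (verdict i) j) (disjoint-mates j) on-cycle ⟩
      length (tabulate {n = L j} (v j ∘ toℕ))       ≡⟨ List.length-tabulate {n = L j} (v j ∘ toℕ) ⟩
      L j                                           ∎
      where
      open ℕ.≤-Reasoning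
      on-cycle : ∀ {i y} → y ∈ mates (verdict i) j → y ∈ tabulate {n = L j} (v j ∘ toℕ)
      on-cycle {i} y∈ with ∈-mates (verdict i) j y∈
      ... | _ , (m , refl) , _ = subst (_∈ tabulate {n = L j} (v j ∘ toℕ))
            (trans (cong (v j) (Fin.toℕ-fromℕ< (m%n<n m (L j)))) (sym (v-mod (shape j) m)))
            (∈-tabulate⁺ {f = v j ∘ toℕ} (fromℕ< (m%n<n m (L j))))

    no-creditors : ∀ j → (FullAt j → L j ≤ g) → creditors j ≡ 0
    no-creditors j short = ∑-zero λ i → none (verdict i)
      where
      none : ∀ {i} (W : Verdict i) → owes W j ≡ 0
      none (rich _ _ _) = refl
      none (long _ _ _) = refl
      none (poor _ _ _ _ k _ full-k g<L _) with k Fin.≟ j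
      ... | yes refl = contradiction (short full-k) (ℕ.<⇒≱ g<L)
      ... | no _     = refl

    -- Requirement plus outgoing support on the left, own darts plus incoming support on the right.
    -- Only a `long` cycle gives support, and `long-cycle-pays` covers it.
    balance : ∀ j → 2 + 3 * g + 2 * creditors j ≤ charge-length (charge-of (verdict j)) + 2 * debt (verdict j)
    balance j = by (verdict j)
      where
      open ℕ.≤-Reasoning
      by : (W : Verdict j) → 2 + 3 * g + 2 * creditors j ≤ charge-length (charge-of W) + 2 * debt W
      by (rich C enough short) = begin
        2 + 3 * g + 2 * creditors j  ≡⟨ cong (λ r → 2 + 3 * g + 2 * r) (no-creditors j short) ⟩
        2 + 3 * g + 0                ≤⟨ ℕ.+-monoˡ-≤ 0 enough ⟩
        charge-length C + 0          ∎
      by (long C len g<L) = begin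
        2 + 3 * g + 2 * creditors j  ≤⟨ long-cycle-pays g (L j) (creditors j) 3≤g (odd-gap g-odd (length-odd (shape j)) g<L) (creditors-bound j) ⟩
        3 * L j                      ≡⟨ trans (sym len) (sym (ℕ.+-identityʳ _)) ⟩
        charge-length C + 0          ∎
      by (poor C len _ L≡g _ _ _ _ _) = begin
        2 + 3 * g + 2 * creditors j  ≡⟨ cong (λ r → 2 + 3 * g + 2 * r) (no-creditors j λ _ → ℕ.≤-reflexive L≡g) ⟩
        2 + 3 * g + 0                ≡⟨ trans (ℕ.+-identityʳ _) (ℕ.+-comm 2 (3 * g)) ⟩
        3 * g + 2                    ≡⟨ cong (_+ 2) (sym len) ⟩
        charge-length C + 2          ∎

    -- The double sum of `owes` is taken by debtor on one side and by supporting cycle on the other.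
    debts-paid : ∑ (λ i → debt (verdict i)) ≤ ∑ creditors
    debts-paid = ℕ.≤-trans (∑-mono λ i → pays (verdict i)) (ℕ.≤-reflexive (∑-swap λ i j → owes (verdict i) j))
      where
      pays : ∀ {i} (W : Verdict i) → debt W ≤ ∑ (owes W)
      pays (rich _ _ _) = z≤n
      pays (long _ _ _) = z≤n
      pays W@(poor _ _ _ _ k _ _ _ _) = ℕ.≤-trans one (term≤∑ (owes W) k)
        where
        one : 1 ≤ owes W k
        one with k Fin.≟ k
        ... | yes _   = ℕ.≤-refl
        ... | no k≢k  = contradiction refl k≢k

    charge-list : Fin s → List Dart
    charge-list i = Charge.list (charge-of (verdict i))

    charges-fit : ∑ (λ i → length (charge-list i)) ≤ ∣E G ∣ + ∣E G ∣
    charges-fit = subst (∑ (λ i → length (charge-list i)) ≤_) length-allDarts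
      (∑-disjoint-lists (λ i → Charge.unique (charge-of (verdict i)))
        (λ {i} {k} x∈ y∈ → owner-unique (Charge.adj (charge-of (verdict i)) x∈)
           (Charge.owned (charge-of (verdict i)) x∈) (Charge.owned (charge-of (verdict k)) y∈))
        (λ {i} x∈ → ∈-allDarts (Charge.adj (charge-of (verdict i)) x∈)))

    -- When `balance` is summed over all cycles, incoming support is at most outgoing support and
    -- can be cancelled.
    enough-edges : s * (2 + 3 * g) ≤ ∣E G ∣ + ∣E G ∣
    enough-edges = ℕ.+-cancelʳ-≤ (2 * ∑ creditors) _ _ (begin
      s * (2 + 3 * g) + 2 * ∑ creditors                         ≡⟨ cong₂ _+_ (sym (∑-const s (2 + 3 * g))) (sym (∑-*ˡ 2 creditors)) ⟩
      ∑ {s} (λ _ → 2 + 3 * g) + ∑ (λ j → 2 * creditors j)       ≡⟨ sym (∑-+ {s} (λ _ → 2 + 3 * g) λ j → 2 * creditors j) ⟩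
      ∑ (λ j → 2 + 3 * g + 2 * creditors j)                     ≤⟨ ∑-mono balance ⟩
      ∑ (λ j → length (charge-list j) + 2 * debt (verdict j))   ≡⟨ ∑-+ (λ j → length (charge-list j)) _ ⟩
      ∑ (λ j → length (charge-list j)) + ∑ (λ j → 2 * debt (verdict j))
                                                                ≡⟨ cong (∑ (λ j → length (charge-list j)) +_) (∑-*ˡ 2 λ j → debt (verdict j)) ⟩
      ∑ (λ j → length (charge-list j)) + 2 * ∑ (λ j → debt (verdict j))
                                                                ≤⟨ ℕ.+-mono-≤ charges-fit (ℕ.*-monoʳ-≤ 2 debts-paid) ⟩
      ∣E G ∣ + ∣E G ∣ + 2 * ∑ creditors                         ∎)
      where open ℕ.≤-Reasoning

-- From the edge count to the ratio

open import Data.Integer.Base using (+_)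

-- The hypothesis on `s` says that the uncoloured fraction `s / m` is at most `2 / suc w`. It is
-- used as `1 ≤ p + q`, which for unnormalised fractions is an inequality of numerators.
ratio-bound : ∀ m .{{_ : NonZero m}} {k s w} → m ≡ k + s → s * suc w ≤ m + m → + k / m ≥ 1ℚ - + 2 / suc w
ratio-bound m@(suc m′) {k} {s} {w} m≡k+s s-small = begin
  1ℚ - q               ≤⟨ ℚ.+-monoˡ-≤ (ℚ.- q) 1≤p+q ⟩
  (p ℚ.+ q) - q        ≡⟨ ℚ.+-assoc p q (ℚ.- q) ⟩
  p ℚ.+ (q - q)        ≡⟨ cong (p ℚ.+_) (ℚ.+-inverseʳ q) ⟩
  p ℚ.+ ℚ.0ℚ           ≡⟨ ℚ.+-identityʳ p ⟩
  p                    ∎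
  where
  open ℚ.≤-Reasoning
  p = + k / m
  q = + 2 / suc w
  numerators : m * suc w ≤ k * suc w + 2 * m
  numerators = ℕ.≤-trans (ℕ.≤-reflexive (trans (cong (_* suc w) m≡k+s) (ℕ.*-distribʳ-+ (suc w) k s)))
    (ℕ.+-monoʳ-≤ (k * suc w) (ℕ.≤-trans s-small (ℕ.≤-reflexive (cong (λ t → m + t) (sym (ℕ.+-identityʳ m))))))
  numeratorsℤ : + 1 ℤ.* + (m * suc w) ℤ.≤ (+ k ℤ.* + suc w ℤ.+ + 2 ℤ.* + m) ℤ.* + 1
  numeratorsℤ = subst₂ ℤ._≤_ (sym (ℤ.*-identityˡ _))
    (trans (cong₂ ℤ._+_ (ℤ.pos-* k (suc w)) (ℤ.pos-* 2 m)) (sym (ℤ.*-identityʳ _))) (ℤ.+≤+ numerators)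
  1≤p+q : 1ℚ ℚ.≤ p ℚ.+ q
  1≤p+q = ℚ.toℚᵘ-cancel-≤ (ℚᵘ.≤-respʳ-≃ (ℚᵘ.≃-sym (ℚᵘ.≃-trans (ℚ.toℚᵘ-homo-+ p q)
    (ℚᵘ.+-cong (ℚ.toℚᵘ-fromℚᵘ (ℚᵘ.mkℚᵘ (+ k) m′)) (ℚ.toℚᵘ-fromℚᵘ (ℚᵘ.mkℚᵘ (+ 2) w)))))
    (ℚᵘ.*≤* numeratorsℤ))

uncoloured-bound : ∀ {n} (G : Graph n) → Connected G → Δ G ≡ 3 → ¬ (G ≅ Petersen) → ∀ {g k} →
                   IsLeast (HasOddCycleOfLength G) g → IsGreatest (Has3ColourableSubgraphOfSize G) k →
                   ∃ λ s → ∣E G ∣ ≡ k + s × s * (2 + 3 * g) ≤ ∣E G ∣ + ∣E G ∣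
uncoloured-bound G connected Δ≡3 not-petersen {g} {k} ((¬2∣g , _ , g-cycle) , g-least) (largest , greatest) =
  length (uncolouredEdges φ) , subst (λ k → ∣E G ∣ ≡ k + length (uncolouredEdges φ)) size≡k (edges-count φ) ,
  Charging.Counting.enough-edges G nb3 k bound g g-least (length (uncolouredEdges φ))
    (OddGirth.normal G nb3 k bound g g-least {φ} (ℕ.≤-reflexive (sym size≡k)))
    (¬2∣⇒odd g ¬2∣g) (IsCycle.length≥3 g-cycle) connected not-petersen
  where
  open Colourings G
  nb3 : ThreeNeighbours G
  nb3 = Δ≤3⇒three-neighbours G Δ≡3
  bound : ∀ ψ → size ψ ≤ k
  bound ψ = greatest (size ψ) (colouring⇒subgraph ψ)
  φ : Colouring
  φ = proj₁ (subgraph⇒colouring largest)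
  size≡k : size φ ≡ k
  size≡k = proj₂ (subgraph⇒colouring largest)

theorem1 : ∀ {n : ℕ} (G : Graph n) →
    Connected G →
    Δ G ≡ 3 →
    (odd : HasOddCycle G) →
    ¬ (G ≅ Petersen) →
    γ G {{oddCycle⇒nonZero G odd}} ≥ 1ℚ - (+ 2) / (2 + 3 * oddGirth G odd)
theorem1 G connected Δ≡3 odd not-petersen =
  let s , m≡k+s , s-small = uncoloured-bound G connected Δ≡3 not-petersen
        {oddGirth G odd} {proj₁ (largest3ColourableSubgraph G)} (proj₂ (shortestOddCycle G odd)) (proj₂ (largest3ColourableSubgraph G)) in
  ratio-bound ∣E G ∣ {{oddCycle⇒nonZero G odd}} {proj₁ (largest3ColourableSubgraph G)} {s} {1 + 3 * oddGirth G odd} m≡k+s s-small
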